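{- Fix positive integers $a_1,a_2,a_3,a_4$. Let $F(n)$ be the maximum size of a Sidon subset of $[n]$ containing no solution with $x_1,\dots,x_5$ pairwise distinct to the equation $a_1x_1+a_2x_2+a_3x_3+a_4x_4=(a_1+a_2+a_3+a_4)x_5$. Then $F(n)=o(\sqrt n)$ and $F(n)\ge n^{1/2-o(1)}$ as $n\to\infty$.
   Context: $[n]=\{1,\dots,n\}$. A Sidon set is a set of integers with no nontrivial solution to $x_1+x_2=x_3+x_4$, where a solution is trivial if $(x_1,x_2)=(x_3,x_4)$ or $(x_1,x_2)=(x_4,x_3)$. -}

module Defs where

open import Data.Nat using (ℕ; _+_; _*_; _≤_; _^_)
open import Data.List using (List; length)
open import Data.List.Membership.Propositional using (_∈_)
open import Data.List.Relation.Unary.All using (All)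
open import Data.List.Relation.Unary.Unique.Propositional using (Unique)
open import Data.Product using (_×_)
open import Data.Sum using (_⊎_)
open import Relation.Binary.PropositionalEquality using (_≡_; _≢_)

-- A finite set of integers is represented by a duplicate-free list of naturals.

Sidon : List ℕ → Set
Sidon A = ∀ {x₁ x₂ x₃ x₄} → x₁ ∈ A → x₂ ∈ A → x₃ ∈ A → x₄ ∈ A →
  x₁ + x₂ ≡ x₃ + x₄ →
  (x₁ ≡ x₃ × x₂ ≡ x₄) ⊎ (x₁ ≡ x₄ × x₂ ≡ x₃)

PairwiseDistinct5 : ℕ → ℕ → ℕ → ℕ → ℕ → Set
PairwiseDistinct5 x₁ x₂ x₃ x₄ x₅ =
  x₁ ≢ x₂ × x₁ ≢ x₃ × x₁ ≢ x₄ × x₁ ≢ x₅ ×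
  x₂ ≢ x₃ × x₂ ≢ x₄ × x₂ ≢ x₅ ×
  x₃ ≢ x₄ × x₃ ≢ x₅ ×
  x₄ ≢ x₅

NoDistinctSolution : ℕ → ℕ → ℕ → ℕ → List ℕ → Set
NoDistinctSolution a₁ a₂ a₃ a₄ A = ∀ {x₁ x₂ x₃ x₄ x₅} →
  x₁ ∈ A → x₂ ∈ A → x₃ ∈ A → x₄ ∈ A → x₅ ∈ A →
  PairwiseDistinct5 x₁ x₂ x₃ x₄ x₅ →
  a₁ * x₁ + a₂ * x₂ + a₃ * x₃ + a₄ * x₄ ≢ (a₁ + a₂ + a₃ + a₄) * x₅

SubsetOfRange : ℕ → List ℕ → Set
SubsetOfRange n A = Unique A × All (λ x → 1 ≤ x × x ≤ n) A

-- The sets over which F(n) is the maximum size.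
Admissible : ℕ → ℕ → ℕ → ℕ → ℕ → List ℕ → Set
Admissible a₁ a₂ a₃ a₄ n A =
  SubsetOfRange n A × Sidon A × NoDistinctSolution a₁ a₂ a₃ a₄ A

{-# OPTIONS --safe #-}

-- Upper bound.  Let A be Sidon with a elements, in an interval of length O(a²), and let s(m) be the number of
-- solutions of a₁x₁ + a₂x₂ + a₃x₃ + a₄x₄ - S x₅ = m in A, where S = a₁ + a₂ + a₃ + a₄.  Degenerate solutions of the
-- homogeneous equation number O(a²), so it suffices that s(0) ≫ a³.  Because differences in A are unique, s is the
-- convolution of square-bounded functions with an operator whose kernel is (off the diagonal) 0-1 valued, and
-- the translates of such a function are totally bounded: among boundedly many of them two are a³/E-close.  Hence
-- the set of t for which s(m + t) is always within a³/E of s(m) has positive density for every E.  For a list ν of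
-- such almost periods put F(x) = #{t ∈ ν : x + t ∈ A}; its energy ∑ F² is at most 2|ν|².  If F changes much under
-- a coarser almost period d, then averaging ν with ν + d lowers the normalised energy by a constant, so after
-- boundedly many steps F is almost invariant under all coarse almost periods.  Its large level set then gives
-- many x and coarse shifts d₁, …, d₄ with a₁d₁ + a₂d₂ + a₃d₃ + a₄d₄ = 0 and F(x), F(x + d₁), …, F(x + d₄) all large.
-- These yield solutions of the equation with right-hand sides that are fine almost periods, where s is close to s(0).
--
-- Lower bound.  For a prime p the points 1 + (S + 1) p x + (x² mod p), 0 ≤ x < p, form a Sidon set, and a solution of the
-- equation among them is a solution among the x.  Restricting x to integers whose digits in a suitable base lie
-- on a sphere leaves only constant solutions, by strict convexity.  A prime of the right size exists because
-- every common multiple of 1, …, n is at least 2ⁿ⁻¹.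
module Submission where

open import Defs
open import Algebra.Structures using (IsCommutativeSemiring)
open import Data.Empty using (⊥; ⊥-elim)
open import Data.Integer as ℤ using (ℤ; +_; -[1+_])
import Data.Integer.Properties as ℤ
import Data.Integer.Tactic.RingSolver as ℤ-Solver
open import Data.List using (List; []; _∷_; _++_; map; filter; length; upTo; cartesianProduct; deduplicate)
open import Data.List.Membership.Propositional using (_∈_; find; lose)
open import Data.List.Membership.Propositional.Properties
open import Data.List.Properties using (length-map; length-++; length-upTo; length-filter; filter-all)
open import Data.List.Relation.Unary.All as All using (All; []; _∷_)
import Data.List.Relation.Unary.All.Properties as All
open import Data.List.Relation.Unary.AllPairs as AllPairs using (AllPairs; []; _∷_)
import Data.List.Relation.Unary.AllPairs.Properties as AllPairs
open import Data.List.Relation.Unary.Any as Any using (Any; here; there; any?)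
open import Data.List.Relation.Unary.Unique.DecPropositional.Properties ℤ._≟_ using (deduplicate-!)
open import Data.List.Relation.Unary.Unique.Propositional using (Unique)
import Data.List.Relation.Unary.Unique.Propositional.Properties as Unique
open import Data.Nat
open import Data.Nat.DivMod using (m/n≤m; m≥n⇒m/n>0; m≡m%n+[m/n]*n; m%n<n; m/n*n≤m; /-monoˡ-≤; m*n/n≡m)
open import Data.Nat.Divisibility using (_∣_; _∤_; divides; _∣?_; ∣⇒≤; n∣n; m∣m*n; ∣n⇒∣m*n; *-pres-∣)
open import Data.Nat.Induction using (<-wellFounded)
open import Data.Nat.ListAction using (product)
open import Data.Nat.Primality using (Prime; prime?; euclidsLemma; prime⇒nonTrivial; prime⇒nonZero)
open import Data.Nat.Primality.Factorisation using (factorise)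
open import Data.Nat.Properties
open import Data.Nat.Tactic.RingSolver using (solve-∀)
open import Data.Product using (_×_; _,_; proj₁; proj₂; ∃; ∃-syntax)
open import Data.Sum as Sum using (_⊎_; inj₁; inj₂)
open import Data.Vec using (Vec; []; _∷_)
open import Function using (_∘_; id)
open import Induction.WellFounded using (Acc; acc)
open import Relation.Binary.PropositionalEquality
open import Relation.Nullary using (¬_; Dec; yes; no; contradiction)
open import Relation.Nullary.Decidable using (¬?; _×-dec_)

-- Finite sums

module Summation {C : Set} {_⊕_ _⊗_ : C → C → C} {0# 1# : C}
  (isCommutativeSemiring : IsCommutativeSemiring _≡_ _⊕_ _⊗_ 0# 1#) where

  private module C = IsCommutativeSemiring isCommutativeSemiring

  ∑ : ∀ {I : Set} → List I → (I → C) → C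
  ∑ []      f = 0#
  ∑ (i ∷ L) f = f i ⊕ ∑ L f

  private
    interchange : ∀ a b c d → (a ⊕ b) ⊕ (c ⊕ d) ≡ (a ⊕ c) ⊕ (b ⊕ d)
    interchange a b c d = begin
      (a ⊕ b) ⊕ (c ⊕ d)  ≡⟨ C.+-assoc a b (c ⊕ d) ⟩
      a ⊕ (b ⊕ (c ⊕ d))  ≡⟨ cong (a ⊕_) (C.+-assoc b c d) ⟨
      a ⊕ ((b ⊕ c) ⊕ d)  ≡⟨ cong (λ e → a ⊕ (e ⊕ d)) (C.+-comm b c) ⟩
      a ⊕ ((c ⊕ b) ⊕ d)  ≡⟨ cong (a ⊕_) (C.+-assoc c b d) ⟩
      a ⊕ (c ⊕ (b ⊕ d))  ≡⟨ C.+-assoc a c (b ⊕ d) ⟨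
      (a ⊕ c) ⊕ (b ⊕ d)  ∎
      where open ≡-Reasoning

  ∑-cong-∈ : ∀ {I : Set} {f g : I → C} (L : List I) → (∀ {i} → i ∈ L → f i ≡ g i) → ∑ L f ≡ ∑ L g
  ∑-cong-∈ []      eq = refl
  ∑-cong-∈ (i ∷ L) eq = cong₂ _⊕_ (eq (here refl)) (∑-cong-∈ L (eq ∘ there))

  ∑-cong : ∀ {I : Set} {f g : I → C} (L : List I) → (∀ i → f i ≡ g i) → ∑ L f ≡ ∑ L g
  ∑-cong L eq = ∑-cong-∈ L (λ {i} _ → eq i)

  ∑-0 : ∀ {I : Set} (L : List I) → ∑ L (λ _ → 0#) ≡ 0#
  ∑-0 []      = refl
  ∑-0 (i ∷ L) = trans (C.+-identityˡ _) (∑-0 L)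

  ∑-+ : ∀ {I : Set} (L : List I) (f g : I → C) → ∑ L (λ i → f i ⊕ g i) ≡ ∑ L f ⊕ ∑ L g
  ∑-+ []      f g = sym (C.+-identityˡ 0#)
  ∑-+ (i ∷ L) f g = trans (cong ((f i ⊕ g i) ⊕_) (∑-+ L f g)) (interchange (f i) (g i) _ _)

  ∑-*ˡ : ∀ {I : Set} (L : List I) (c : C) (f : I → C) → ∑ L (λ i → c ⊗ f i) ≡ c ⊗ ∑ L f
  ∑-*ˡ []      c f = sym (C.zeroʳ c)
  ∑-*ˡ (i ∷ L) c f = trans (cong ((c ⊗ f i) ⊕_) (∑-*ˡ L c f)) (sym (C.distribˡ c (f i) _))

  ∑-*ʳ : ∀ {I : Set} (L : List I) (f : I → C) (c : C) → ∑ L (λ i → f i ⊗ c) ≡ ∑ L f ⊗ c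
  ∑-*ʳ L f c = trans (∑-cong L (λ i → C.*-comm (f i) c)) (trans (∑-*ˡ L c f) (C.*-comm c _))

  ∑-swap : ∀ {I J : Set} (L : List I) (M : List J) (f : I → J → C) →
    ∑ L (λ i → ∑ M (f i)) ≡ ∑ M (λ j → ∑ L (λ i → f i j))
  ∑-swap []      M f = sym (∑-0 M)
  ∑-swap (i ∷ L) M f = trans (cong (∑ M (f i) ⊕_) (∑-swap L M f)) (sym (∑-+ M (f i) _))

  ∑-++ : ∀ {I : Set} (L M : List I) (f : I → C) → ∑ (L ++ M) f ≡ ∑ L f ⊕ ∑ M f
  ∑-++ []      M f = sym (C.+-identityˡ _)
  ∑-++ (i ∷ L) M f = trans (cong (f i ⊕_) (∑-++ L M f)) (sym (C.+-assoc (f i) _ _))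

  ∑-map : ∀ {I J : Set} (e : I → J) (L : List I) (f : J → C) → ∑ (map e L) f ≡ ∑ L (f ∘ e)
  ∑-map e []      f = refl
  ∑-map e (i ∷ L) f = cong (f (e i) ⊕_) (∑-map e L f)

  ∑-× : ∀ {I J : Set} (L : List I) (M : List J) (f : I × J → C) →
    ∑ (cartesianProduct L M) f ≡ ∑ L (λ i → ∑ M (λ j → f (i , j)))
  ∑-× []      M f = refl
  ∑-× (i ∷ L) M f = trans (∑-++ (map (i ,_) M) _ f) (cong₂ _⊕_ (∑-map (i ,_) M f) (∑-× L M f))

  ∑*∑ : ∀ {I J : Set} (L : List I) (M : List J) (f : I → C) (g : J → C) →
    ∑ L f ⊗ ∑ M g ≡ ∑ L (λ i → ∑ M (λ j → f i ⊗ g j))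
  ∑*∑ L M f g = trans (sym (∑-*ʳ L f (∑ M g))) (∑-cong L (λ i → sym (∑-*ˡ M (f i) g)))

  ∑-extract : ∀ {I J : Set} (L : List I) (M : List J) (g : I → J → C) (h : I → C) →
    ∑ L (λ i → ∑ M (g i) ⊗ h i) ≡ ∑ M (λ j → ∑ L (λ i → g i j ⊗ h i))
  ∑-extract L M g h = trans (∑-cong L (λ i → sym (∑-*ʳ M (g i) (h i)))) (∑-swap L M _)

open Summation +-*-isCommutativeSemiring
open Summation ℤ.+-*-isCommutativeSemiring using () renaming
  ( ∑ to ∑ᶻ; ∑-cong-∈ to ∑ᶻ-cong-∈; ∑-cong to ∑ᶻ-cong; ∑-0 to ∑ᶻ-0; ∑-+ to ∑ᶻ-+; ∑-*ˡ to ∑ᶻ-*ˡ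
  ; ∑-*ʳ to ∑ᶻ-*ʳ; ∑-swap to ∑ᶻ-swap; ∑-× to ∑ᶻ-×; ∑*∑ to ∑ᶻ*∑ᶻ)

∑-mono-∈ : ∀ {I : Set} {f g : I → ℕ} (L : List I) → (∀ {i} → i ∈ L → f i ≤ g i) → ∑ L f ≤ ∑ L g
∑-mono-∈ []      le = z≤n
∑-mono-∈ (i ∷ L) le = +-mono-≤ (le (here refl)) (∑-mono-∈ L (le ∘ there))

∑-mono : ∀ {I : Set} {f g : I → ℕ} (L : List I) → (∀ i → f i ≤ g i) → ∑ L f ≤ ∑ L g
∑-mono L le = ∑-mono-∈ L (λ {i} _ → le i)

∑-const : ∀ {I : Set} (L : List I) (c : ℕ) → ∑ L (λ _ → c) ≡ length L * c
∑-const []      c = refl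
∑-const (i ∷ L) c = cong (λ s → c + s) (∑-const L c)

∑-≤-const : ∀ {I : Set} {f : I → ℕ} (L : List I) (c : ℕ) → (∀ {i} → i ∈ L → f i ≤ c) → ∑ L f ≤ length L * c
∑-≤-const L c le = ≤-trans (∑-mono-∈ L le) (≤-reflexive (∑-const L c))

≤-∑ : ∀ {I : Set} {i : I} (L : List I) (f : I → ℕ) → i ∈ L → f i ≤ ∑ L f
≤-∑ (i ∷ L) f (here refl) = m≤m+n (f i) _
≤-∑ (j ∷ L) f (there i∈L) = ≤-trans (≤-∑ L f i∈L) (m≤n+m _ (f j))

+∑ : ∀ {I : Set} (L : List I) (f : I → ℕ) → + ∑ L f ≡ ∑ᶻ L (λ i → + f i)
+∑ []      f = refl
+∑ (i ∷ L) f = trans (ℤ.pos-+ (f i) (∑ L f)) (cong (λ s → + f i ℤ.+ s) (+∑ L f))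

∑ᶻ-mono-∈ : ∀ {I : Set} {f g : I → ℤ} (L : List I) → (∀ {i} → i ∈ L → f i ℤ.≤ g i) → ∑ᶻ L f ℤ.≤ ∑ᶻ L g
∑ᶻ-mono-∈ []      le = ℤ.≤-refl
∑ᶻ-mono-∈ (i ∷ L) le = ℤ.+-mono-≤ (le (here refl)) (∑ᶻ-mono-∈ L (le ∘ there))

∑ᶻ-mono : ∀ {I : Set} {f g : I → ℤ} (L : List I) → (∀ i → f i ℤ.≤ g i) → ∑ᶻ L f ℤ.≤ ∑ᶻ L g
∑ᶻ-mono L le = ∑ᶻ-mono-∈ L (λ {i} _ → le i)

i≤∣i∣ : ∀ i → i ℤ.≤ + ℤ.∣ i ∣
i≤∣i∣ (+ n)    = ℤ.≤-refl
i≤∣i∣ -[1+ n ] = ℤ.-≤+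

∑-split : ∀ {I : Set} {R : List I} {i} (f : I → ℕ) → i ∈ R →
  ∃[ R′ ] (∑ R f ≡ f i + ∑ R′ f × (∀ {j} → j ∈ R → j ≢ i → j ∈ R′))
∑-split {R = i ∷ R} f (here refl) = R , refl , λ
  { (here refl) j≢i → contradiction refl j≢i
  ; (there j∈R) _   → j∈R }
∑-split {R = k ∷ R} {i} f (there i∈R) with ∑-split f i∈R
... | R′ , eq , keeps = k ∷ R′ , trans (cong (λ s → f k + s) eq) (lemma (f k) (f i) (∑ R′ f)) , λ
  { (here refl) _   → here refl
  ; (there j∈R) j≢i → there (keeps j∈R j≢i) }
  where
  lemma : ∀ x y z → x + (y + z) ≡ y + (x + z)
  lemma = solve-∀

∑-injective-≤ : ∀ {I J : Set} {L : List I} {R : List J} (e : I → J) (g : J → ℕ) → Unique L →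
  (∀ {i i′} → i ∈ L → i′ ∈ L → e i ≡ e i′ → i ≡ i′) →
  (∀ {i} → i ∈ L → g (e i) ≡ 0 ⊎ e i ∈ R) → ∑ L (g ∘ e) ≤ ∑ R g
∑-injective-≤ {L = []} e g u inj cover = z≤n
∑-injective-≤ {L = i ∷ L} {R} e g (i∉L ∷ u) inj cover with cover (here refl)
... | inj₁ g≡0 = ≤-trans (≤-reflexive (cong (_+ ∑ L (g ∘ e)) g≡0))
  (∑-injective-≤ e g u (λ p q → inj (there p) (there q)) (cover ∘ there))
... | inj₂ ei∈R with ∑-split g ei∈R
...   | R′ , eq , keeps = ≤-trans (+-monoʳ-≤ (g (e i)) (∑-injective-≤ e g u (λ p q → inj (there p) (there q)) cover′))
                            (≤-reflexive (sym eq))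
  where
  cover′ : ∀ {j} → j ∈ L → g (e j) ≡ 0 ⊎ e j ∈ R′
  cover′ j∈L with cover (there j∈L)
  ... | inj₁ g≡0  = inj₁ g≡0
  ... | inj₂ ej∈R = inj₂ (keeps ej∈R (λ ej≡ei → All.lookup i∉L j∈L (sym (inj (there j∈L) (here refl) ej≡ei))))

∑-atMostOne : ∀ {I : Set} {L : List I} {f : I → ℕ} → Unique L → (∀ i → f i ≤ 1) →
  (∀ {i j} → i ∈ L → j ∈ L → f i ≢ 0 → f j ≢ 0 → i ≡ j) → ∑ L f ≤ 1
∑-atMostOne {L = []} u le uniq = z≤n
∑-atMostOne {L = i ∷ L} {f} (i∉L ∷ u) le uniq with f i ≟ 0
... | yes fi≡0 = ≤-trans (≤-reflexive (cong (_+ ∑ L f) fi≡0)) (∑-atMostOne u le (λ p q → uniq (there p) (there q)))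
... | no  fi≢0 = ≤-trans (+-mono-≤ (le i) (≤-reflexive rest)) ≤-refl
  where
  rest : ∑ L f ≡ 0
  rest = trans (∑-cong-∈ L zeros) (∑-0 L)
    where
    zeros : ∀ {j} → j ∈ L → f j ≡ 0
    zeros {j} j∈L with f j ≟ 0
    ... | yes fj≡0 = fj≡0
    ... | no  fj≢0 = contradiction (uniq (here refl) (there j∈L) fi≢0 fj≢0) (All.lookup i∉L j∈L)

δ : ℤ → ℤ → ℕ
δ x y with x ℤ.≟ y
... | yes _ = 1
... | no  _ = 0

δ-≤1 : ∀ x y → δ x y ≤ 1
δ-≤1 x y with x ℤ.≟ y
... | yes _ = ≤-refl
... | no  _ = z≤n

δ-refl : ∀ x → δ x x ≡ 1
δ-refl x with x ℤ.≟ x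
... | yes _  = refl
... | no x≢x = contradiction refl x≢x

δ-≡ : ∀ {x y} → x ≡ y → δ x y ≡ 1
δ-≡ {x} refl = δ-refl x

δ-≢ : ∀ {x y} → x ≢ y → δ x y ≡ 0
δ-≢ {x} {y} x≢y with x ℤ.≟ y
... | yes x≡y = contradiction x≡y x≢y
... | no  _   = refl

δ≢0⇒≡ : ∀ {x y} → δ x y ≢ 0 → x ≡ y
δ≢0⇒≡ {x} {y} δ≢0 with x ℤ.≟ y
... | yes x≡y = x≡y
... | no  _   = contradiction refl δ≢0

δ-mono : ∀ {x y u v} → (x ≡ y → u ≡ v) → δ x y ≤ δ u v
δ-mono {x} {y} imp with x ℤ.≟ y
... | yes x≡y = ≤-reflexive (sym (δ-≡ (imp x≡y)))
... | no  _   = z≤n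

δ-cong : ∀ {x y u v} → (x ≡ y → u ≡ v) → (u ≡ v → x ≡ y) → δ x y ≡ δ u v
δ-cong to from = ≤-antisym (δ-mono to) (δ-mono from)

∑-δ-≤1 : ∀ {L : List ℤ} → Unique L → ∀ c → ∑ L (δ c) ≤ 1
∑-δ-≤1 u c = ∑-atMostOne u (δ-≤1 c) (λ _ _ p q → trans (sym (δ≢0⇒≡ p)) (δ≢0⇒≡ q))

∑-δ-∈ : ∀ {L : List ℤ} → Unique L → ∀ {c} → c ∈ L → ∑ L (δ c) ≡ 1
∑-δ-∈ {L} u {c} c∈L = ≤-antisym (∑-δ-≤1 u c) (subst (_≤ ∑ L (δ c)) (δ-refl c) (≤-∑ L (δ c) c∈L))

∑-δ* : ∀ {L : List ℤ} → Unique L → ∀ {c} (g : ℤ → ℕ) → c ∈ L → ∑ L (λ x → δ c x * g x) ≡ g c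
∑-δ* {L} u {c} g c∈L = begin
  ∑ L (λ x → δ c x * g x)  ≡⟨ ∑-cong L swap-argument ⟩
  ∑ L (λ x → δ c x * g c)  ≡⟨ ∑-*ʳ L (δ c) (g c) ⟩
  ∑ L (δ c) * g c          ≡⟨ cong (_* g c) (∑-δ-∈ u c∈L) ⟩
  1 * g c                  ≡⟨ *-identityˡ (g c) ⟩
  g c                      ∎
  where
  open ≡-Reasoning
  swap-argument : ∀ x → δ c x * g x ≡ δ c x * g c
  swap-argument x with c ℤ.≟ x
  ... | yes refl = refl
  ... | no  _    = refl

sq : ℕ → ℕ
sq n = n * n

sqᶻ : ℤ → ℤ
sqᶻ i = i ℤ.* i

+sq∣_∣ : ∀ i → + sq ℤ.∣ i ∣ ≡ sqᶻ i
+sq∣ + n ∣      = ℤ.pos-* n n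
+sq∣ -[1+ n ] ∣ = refl

0≤sqᶻ : ∀ i → + 0 ℤ.≤ sqᶻ i
0≤sqᶻ i = subst (+ 0 ℤ.≤_) +sq∣ i ∣ (ℤ.+≤+ z≤n)

private
  2xy≤x²+y² : ∀ x y → (x ℤ.* y) ℤ.+ (x ℤ.* y) ℤ.≤ sqᶻ x ℤ.+ sqᶻ y
  2xy≤x²+y² x y = ℤ.0≤i-j⇒j≤i (subst (+ 0 ℤ.≤_) (lemma x y) (0≤sqᶻ (x ℤ.- y)))
    where
    lemma : ∀ x y → (x ℤ.- y) ℤ.* (x ℤ.- y) ≡ x ℤ.* x ℤ.+ y ℤ.* y ℤ.- (x ℤ.* y ℤ.+ x ℤ.* y)
    lemma = ℤ-Solver.solve-∀

cauchy-schwarz : ∀ {I : Set} (L : List I) (f g : I → ℤ) →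
  sqᶻ (∑ᶻ L (λ i → f i ℤ.* g i)) ℤ.≤ ∑ᶻ L (sqᶻ ∘ f) ℤ.* ∑ᶻ L (sqᶻ ∘ g)
cauchy-schwarz []      f g = ℤ.≤-refl
cauchy-schwarz (i ∷ L) f g = begin
  sqᶻ (x ℤ.* y ℤ.+ P)
    ≡⟨ expand x y P ⟩
  sqᶻ x ℤ.* sqᶻ y ℤ.+ (x ℤ.* y ℤ.* P ℤ.+ x ℤ.* y ℤ.* P) ℤ.+ sqᶻ P
    ≤⟨ ℤ.+-mono-≤ (ℤ.+-monoʳ-≤ (sqᶻ x ℤ.* sqᶻ y) cross) (cauchy-schwarz L f g) ⟩
  sqᶻ x ℤ.* sqᶻ y ℤ.+ (sqᶻ x ℤ.* G ℤ.+ sqᶻ y ℤ.* F) ℤ.+ F ℤ.* G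
    ≡⟨ collect (sqᶻ x) (sqᶻ y) F G ⟩
  (sqᶻ x ℤ.+ F) ℤ.* (sqᶻ y ℤ.+ G)
    ∎
  where
  open ℤ.≤-Reasoning
  x = f i
  y = g i
  P = ∑ᶻ L (λ j → f j ℤ.* g j)
  F = ∑ᶻ L (sqᶻ ∘ f)
  G = ∑ᶻ L (sqᶻ ∘ g)
  expand : ∀ x y P → (x ℤ.* y ℤ.+ P) ℤ.* (x ℤ.* y ℤ.+ P)
    ≡ x ℤ.* x ℤ.* (y ℤ.* y) ℤ.+ (x ℤ.* y ℤ.* P ℤ.+ x ℤ.* y ℤ.* P) ℤ.+ P ℤ.* P
  expand = ℤ-Solver.solve-∀
  collect : ∀ X Y F G → X ℤ.* Y ℤ.+ (X ℤ.* G ℤ.+ Y ℤ.* F) ℤ.+ F ℤ.* G ≡ (X ℤ.+ F) ℤ.* (Y ℤ.+ G)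
  collect = ℤ-Solver.solve-∀
  pair-term : ∀ x y p q → x ℤ.* y ℤ.* (p ℤ.* q) ≡ x ℤ.* q ℤ.* (y ℤ.* p)
  pair-term = ℤ-Solver.solve-∀
  square-term : ∀ x q → x ℤ.* q ℤ.* (x ℤ.* q) ≡ x ℤ.* x ℤ.* (q ℤ.* q)
  square-term = ℤ-Solver.solve-∀
  cross : x ℤ.* y ℤ.* P ℤ.+ x ℤ.* y ℤ.* P ℤ.≤ sqᶻ x ℤ.* G ℤ.+ sqᶻ y ℤ.* F
  cross = begin
    x ℤ.* y ℤ.* P ℤ.+ x ℤ.* y ℤ.* P
      ≡⟨ cong₂ ℤ._+_ (sym (∑ᶻ-*ˡ L (x ℤ.* y) (λ j → f j ℤ.* g j))) (sym (∑ᶻ-*ˡ L (x ℤ.* y) (λ j → f j ℤ.* g j))) ⟩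
    ∑ᶻ L (λ j → x ℤ.* y ℤ.* (f j ℤ.* g j)) ℤ.+ ∑ᶻ L (λ j → x ℤ.* y ℤ.* (f j ℤ.* g j))
      ≡⟨ ∑ᶻ-+ L (λ j → x ℤ.* y ℤ.* (f j ℤ.* g j)) (λ j → x ℤ.* y ℤ.* (f j ℤ.* g j)) ⟨
    ∑ᶻ L (λ j → x ℤ.* y ℤ.* (f j ℤ.* g j) ℤ.+ x ℤ.* y ℤ.* (f j ℤ.* g j))
      ≤⟨ ∑ᶻ-mono L (λ j → subst₂ ℤ._≤_
           (cong₂ ℤ._+_ (sym (pair-term x y (f j) (g j))) (sym (pair-term x y (f j) (g j))))
           (cong₂ ℤ._+_ (square-term x (g j)) (square-term y (f j)))
           (2xy≤x²+y² (x ℤ.* g j) (y ℤ.* f j))) ⟩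
    ∑ᶻ L (λ j → sqᶻ x ℤ.* sqᶻ (g j) ℤ.+ sqᶻ y ℤ.* sqᶻ (f j))
      ≡⟨ ∑ᶻ-+ L (λ j → sqᶻ x ℤ.* sqᶻ (g j)) (λ j → sqᶻ y ℤ.* sqᶻ (f j)) ⟩
    ∑ᶻ L (λ j → sqᶻ x ℤ.* sqᶻ (g j)) ℤ.+ ∑ᶻ L (λ j → sqᶻ y ℤ.* sqᶻ (f j))
      ≡⟨ cong₂ ℤ._+_ (∑ᶻ-*ˡ L (sqᶻ x) (sqᶻ ∘ g)) (∑ᶻ-*ˡ L (sqᶻ y) (sqᶻ ∘ f)) ⟩
    sqᶻ x ℤ.* G ℤ.+ sqᶻ y ℤ.* F
      ∎

cauchy-schwarz-abs : ∀ {I : Set} (L : List I) (f g : I → ℤ) →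
  sq ℤ.∣ ∑ᶻ L (λ i → f i ℤ.* g i) ∣ ≤ ∑ L (λ i → sq ℤ.∣ f i ∣) * ∑ L (λ i → sq ℤ.∣ g i ∣)
cauchy-schwarz-abs L f g = ℤ.drop‿+≤+ (subst₂ ℤ._≤_ (sym +sq∣ ∑ᶻ L (λ i → f i ℤ.* g i) ∣) rhs (cauchy-schwarz L f g))
  where
  squares : ∀ h → ∑ᶻ L (sqᶻ ∘ h) ≡ + ∑ L (λ i → sq ℤ.∣ h i ∣)
  squares h = sym (trans (+∑ L _) (∑ᶻ-cong L (λ i → +sq∣ h i ∣)))
  rhs : ∑ᶻ L (sqᶻ ∘ f) ℤ.* ∑ᶻ L (sqᶻ ∘ g) ≡ + (∑ L (λ i → sq ℤ.∣ f i ∣) * ∑ L (λ i → sq ℤ.∣ g i ∣))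
  rhs = trans (cong₂ ℤ._*_ (squares f) (squares g)) (sym (ℤ.pos-* (∑ L (λ i → sq ℤ.∣ f i ∣)) (∑ L (λ i → sq ℤ.∣ g i ∣))))

cauchy-schwarz-ℕ : ∀ {I : Set} (L : List I) (f g : I → ℕ) →
  sq (∑ L (λ i → f i * g i)) ≤ ∑ L (sq ∘ f) * ∑ L (sq ∘ g)
cauchy-schwarz-ℕ L f g = subst (λ z → sq z ≤ ∑ L (sq ∘ f) * ∑ L (sq ∘ g)) (cong ℤ.∣_∣ casts)
  (cauchy-schwarz-abs L (λ i → + f i) (λ i → + g i))
  where
  casts : ∑ᶻ L (λ i → + f i ℤ.* + g i) ≡ + ∑ L (λ i → f i * g i)
  casts = sym (trans (+∑ L _) (∑ᶻ-cong L (λ i → ℤ.pos-* (f i) (g i))))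

-- Representation counts of Sidon sets

≡-from : ∀ {p q x y} → p ≡ q → x ℤ.- y ≡ p ℤ.- q → x ≡ y
≡-from {p} {q} {x} {y} p≡q eq = ℤ.i-j≡0⇒i≡j x y (trans eq (ℤ.i≡j⇒i-j≡0 p≡q))

*-cancelˡ-≢0 : ∀ {i j k} → i ≢ + 0 → i ℤ.* j ≡ i ℤ.* k → j ≡ k
*-cancelˡ-≢0 {i} {j} {k} i≢0 = ℤ.*-cancelˡ-≡ i j k ⦃ ℤ.≢-nonZero i≢0 ⦄

Sidonᶻ : List ℤ → Set
Sidonᶻ A = ∀ {x y z w} → x ∈ A → y ∈ A → z ∈ A → w ∈ A →
  x ℤ.+ y ≡ z ℤ.+ w → (x ≡ z × y ≡ w) ⊎ (x ≡ w × y ≡ z)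

sidon-difference : ∀ {A} → Sidonᶻ A → ∀ {x x′ y y′} → x ∈ A → x′ ∈ A → y ∈ A → y′ ∈ A →
  x ≢ x′ → x ℤ.- x′ ≡ y ℤ.- y′ → x ≡ y × x′ ≡ y′
sidon-difference sidonA {x} {x′} {y} {y′} x∈ x′∈ y∈ y′∈ x≢x′ eq
  with sidonA x∈ y′∈ y∈ x′∈ (≡-from eq (lemma x x′ y y′))
  where
  lemma : ∀ x x′ y y′ → x ℤ.+ y′ ℤ.- (y ℤ.+ x′) ≡ x ℤ.- x′ ℤ.- (y ℤ.- y′)
  lemma = ℤ-Solver.solve-∀
... | inj₁ (x≡y , y′≡x′) = x≡y , sym y′≡x′
... | inj₂ (x≡x′ , _)    = contradiction x≡x′ x≢x′

form : ℤ → ℤ → ℤ × ℤ → ℤ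
form α β (x , y) = α ℤ.* x ℤ.+ β ℤ.* y

rep : List ℤ → ℤ → ℤ → ℤ → ℕ
rep A α β v = ∑ (cartesianProduct A A) (λ p → δ (form α β p) v)

∑-δδ-≤ : ∀ {R : List ℤ} → Unique R → ∀ (f : ℤ → ℤ) → (∀ {u v} → f u ≡ f v → u ≡ v) →
  ∀ c c′ → ∑ R (λ v → δ c (f v) * δ c′ (f v)) ≤ δ c c′
∑-δδ-≤ {R} uniqueR f inj c c′ with c ℤ.≟ c′
... | yes refl = ∑-atMostOne uniqueR (λ v → *-mono-≤ (δ-≤1 c (f v)) (δ-≤1 c (f v)))
        (λ {u} {v} _ _ p q → inj (trans (sym (at u p)) (at v q)))
  where
  at : ∀ v → δ c (f v) * δ c (f v) ≢ 0 → c ≡ f v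
  at v nz = δ≢0⇒≡ (λ eq → nz (cong (_* δ c (f v)) eq))
... | no c≢c′ = ≤-reflexive (trans (∑-cong R zeros) (∑-0 R))
  where
  zeros : ∀ v → δ c (f v) * δ c′ (f v) ≡ 0
  zeros v with c ℤ.≟ f v
  ... | no _ = refl
  ... | yes c≡fv with c′ ℤ.≟ f v
  ...   | no _      = refl
  ...   | yes c′≡fv = contradiction (trans c≡fv (sym c′≡fv)) c≢c′

∑-sq-≤ : ∀ {I : Set} {R : List ℤ} → Unique R → ∀ (f : ℤ → ℤ) → (∀ {u v} → f u ≡ f v → u ≡ v) →
  ∀ (L : List I) (c : I → ℤ) →
  ∑ R (λ v → sq (∑ L (λ i → δ (c i) (f v)))) ≤ ∑ L (λ i → ∑ L (λ j → δ (c i) (c j)))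
∑-sq-≤ {R = R} uniqueR f inj L c = begin
  ∑ R (λ v → sq (∑ L (λ i → δ (c i) (f v))))
    ≡⟨ ∑-cong R (λ v → ∑*∑ L L (λ i → δ (c i) (f v)) (λ i → δ (c i) (f v))) ⟩
  ∑ R (λ v → ∑ L (λ i → ∑ L (λ j → δ (c i) (f v) * δ (c j) (f v))))
    ≡⟨ ∑-swap R L _ ⟩
  ∑ L (λ i → ∑ R (λ v → ∑ L (λ j → δ (c i) (f v) * δ (c j) (f v))))
    ≡⟨ ∑-cong L (λ i → ∑-swap R L _) ⟩
  ∑ L (λ i → ∑ L (λ j → ∑ R (λ v → δ (c i) (f v) * δ (c j) (f v))))
    ≤⟨ ∑-mono L (λ i → ∑-mono L (λ j → ∑-δδ-≤ uniqueR f inj (c i) (c j))) ⟩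
  ∑ L (λ i → ∑ L (λ j → δ (c i) (c j)))
    ∎
  where open ≤-Reasoning

module _ {A : List ℤ} (uniqueA : Unique A) (sidonA : Sidonᶻ A) where

  private
    a : ℕ
    a = length A

  module _ {α β : ℤ} (α≢0 : α ≢ + 0) (β≢0 : β ≢ + 0) where

    private
      coincidences : ∀ {x x′} → x ∈ A → x′ ∈ A →
        ∑ A (λ y → ∑ A (λ y′ → δ (form α β (x , y)) (form α β (x′ , y′)))) ≤ δ x x′ * a + 1
      coincidences {x} {x′} x∈ x′∈ with x ℤ.≟ x′
      ... | yes refl = begin
        ∑ A (λ y → ∑ A (λ y′ → δ (form α β (x , y)) (form α β (x , y′))))
          ≤⟨ ∑-mono A (λ y → ∑-mono A (λ y′ → δ-mono (*-cancelˡ-≢0 β≢0 ∘ cancel y y′))) ⟩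
        ∑ A (λ y → ∑ A (δ y))
          ≤⟨ ∑-≤-const A 1 (λ {y} _ → ∑-δ-≤1 uniqueA y) ⟩
        a * 1
          ≡⟨ trans (*-identityʳ a) (sym (*-identityˡ a)) ⟩
        1 * a
          ≤⟨ m≤m+n _ 1 ⟩
        1 * a + 1
          ∎
        where
        open ≤-Reasoning
        cancel : ∀ y y′ → form α β (x , y) ≡ form α β (x , y′) → β ℤ.* y ≡ β ℤ.* y′
        cancel y y′ eq = ≡-from eq (lemma α β x y y′)
          where
          lemma : ∀ α β x y y′ →
            β ℤ.* y ℤ.- β ℤ.* y′ ≡ α ℤ.* x ℤ.+ β ℤ.* y ℤ.- (α ℤ.* x ℤ.+ β ℤ.* y′)
          lemma = ℤ-Solver.solve-∀
      ... | no x≢x′ = begin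
        ∑ A (λ y → ∑ A (λ y′ → δ (form α β (x , y)) (form α β (x′ , y′))))
          ≡⟨ ∑-× A A (λ (y , y′) → δ (form α β (x , y)) (form α β (x′ , y′))) ⟨
        ∑ (cartesianProduct A A) (λ (y , y′) → δ (form α β (x , y)) (form α β (x′ , y′)))
          ≤⟨ ∑-atMostOne (Unique.cartesianProduct⁺ uniqueA uniqueA) (λ _ → δ-≤1 _ _)
               (λ p∈ q∈ p≢0 q≢0 → unique-pair p∈ q∈ (δ≢0⇒≡ p≢0) (δ≢0⇒≡ q≢0)) ⟩
        1
          ∎
        where
        open ≤-Reasoning
        unique-pair : ∀ {y y′ z z′} → (y , y′) ∈ cartesianProduct A A → (z , z′) ∈ cartesianProduct A A →
          form α β (x , y) ≡ form α β (x′ , y′) → form α β (x , z) ≡ form α β (x′ , z′) →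
          (y , y′) ≡ (z , z′)
        unique-pair {y} {y′} {z} {z′} p∈ q∈ eq eq′
          with ∈-cartesianProduct⁻ A A p∈ | ∈-cartesianProduct⁻ A A q∈
        ... | y∈ , y′∈ | z∈ , z′∈ = cong₂ _,_ (proj₁ same) (proj₂ same)
          where
          lemma₁ : ∀ α β x x′ y y′ → β ℤ.* (y ℤ.- y′) ℤ.- α ℤ.* (x′ ℤ.- x)
            ≡ α ℤ.* x ℤ.+ β ℤ.* y ℤ.- (α ℤ.* x′ ℤ.+ β ℤ.* y′)
          lemma₁ = ℤ-Solver.solve-∀
          βy : β ℤ.* (y ℤ.- y′) ≡ α ℤ.* (x′ ℤ.- x)
          βy = ≡-from eq (lemma₁ α β x x′ y y′)
          βz : β ℤ.* (z ℤ.- z′) ≡ α ℤ.* (x′ ℤ.- x)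
          βz = ≡-from eq′ (lemma₁ α β x x′ z z′)
          lemma₂ : ∀ α β x x′ y → α ℤ.* x ℤ.- α ℤ.* x′
            ≡ α ℤ.* x ℤ.+ β ℤ.* y ℤ.- (α ℤ.* x′ ℤ.+ β ℤ.* y)
          lemma₂ = ℤ-Solver.solve-∀
          y≢y′ : y ≢ y′
          y≢y′ refl = x≢x′ (*-cancelˡ-≢0 α≢0 (≡-from eq (lemma₂ α β x x′ y)))
          same : y ≡ z × y′ ≡ z′
          same = sidon-difference sidonA y∈ y′∈ z∈ z′∈ y≢y′ (*-cancelˡ-≢0 β≢0 (trans βy (sym βz)))

    form-coincidences : ∑ (cartesianProduct A A) (λ p → ∑ (cartesianProduct A A) (λ q →
      δ (form α β p) (form α β q))) ≤ 2 * sq a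
    form-coincidences = begin
      ∑ AA (λ p → ∑ AA (λ q → δ (form α β p) (form α β q)))
        ≡⟨ ∑-× A A _ ⟩
      ∑ A (λ x → ∑ A (λ y → ∑ AA (λ q → δ (form α β (x , y)) (form α β q))))
        ≡⟨ ∑-cong A (λ x → ∑-cong A (λ y → ∑-× A A _)) ⟩
      ∑ A (λ x → ∑ A (λ y → ∑ A (λ x′ → ∑ A (λ y′ → δ (form α β (x , y)) (form α β (x′ , y′))))))
        ≡⟨ ∑-cong A (λ x → ∑-swap A A _) ⟩
      ∑ A (λ x → ∑ A (λ x′ → ∑ A (λ y → ∑ A (λ y′ → δ (form α β (x , y)) (form α β (x′ , y′))))))
        ≤⟨ ∑-mono-∈ A (λ x∈ → ∑-mono-∈ A (λ x′∈ → coincidences x∈ x′∈)) ⟩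
      ∑ A (λ x → ∑ A (λ x′ → δ x x′ * a + 1))
        ≡⟨ ∑-cong A (λ x → trans (∑-+ A _ _) (cong₂ _+_ (∑-*ʳ A (δ x) a) (∑-const A 1))) ⟩
      ∑ A (λ x → ∑ A (δ x) * a + a * 1)
        ≤⟨ ∑-≤-const A (a + a) (λ {x} _ → +-mono-≤ (≤-trans (*-monoˡ-≤ a (∑-δ-≤1 uniqueA x))
             (≤-reflexive (*-identityˡ a))) (≤-reflexive (*-identityʳ a))) ⟩
      a * (a + a)
        ≡⟨ double a ⟩
      2 * (a * a)
        ∎
      where
      open ≤-Reasoning
      AA = cartesianProduct A A
      double : ∀ n → n * (n + n) ≡ 2 * (n * n)
      double = solve-∀

    rep-energy : ∀ {R} → Unique R → (f : ℤ → ℤ) → (∀ {u v} → f u ≡ f v → u ≡ v) →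
      ∑ R (λ v → sq (rep A α β (f v))) ≤ 2 * sq a
    rep-energy uniqueR f inj = ≤-trans (∑-sq-≤ uniqueR f inj (cartesianProduct A A) (form α β)) form-coincidences

  rep-correlation : ∀ {α β α′ β′} → α ≢ + 0 → β ≢ + 0 → α′ ≢ + 0 → β′ ≢ + 0 →
    ∀ {R} → Unique R → (f g : ℤ → ℤ) → (∀ {u v} → f u ≡ f v → u ≡ v) → (∀ {u v} → g u ≡ g v → u ≡ v) →
    ∑ R (λ v → rep A α β (f v) * rep A α′ β′ (g v)) ≤ 2 * sq a
  rep-correlation {α} {β} {α′} {β′} α≢0 β≢0 α′≢0 β′≢0 {R} uniqueR f g f-inj g-inj = *-cancelˡ-≤ 2 (begin
    2 * ∑ R (λ v → rep A α β (f v) * rep A α′ β′ (g v))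
      ≡⟨ ∑-*ˡ R 2 _ ⟨
    ∑ R (λ v → 2 * (rep A α β (f v) * rep A α′ β′ (g v)))
      ≤⟨ ∑-mono R (λ v → 2mn≤m²+n² (rep A α β (f v)) (rep A α′ β′ (g v))) ⟩
    ∑ R (λ v → sq (rep A α β (f v)) + sq (rep A α′ β′ (g v)))
      ≡⟨ ∑-+ R _ _ ⟩
    ∑ R (λ v → sq (rep A α β (f v))) + ∑ R (λ v → sq (rep A α′ β′ (g v)))
      ≤⟨ +-mono-≤ (rep-energy α≢0 β≢0 uniqueR f f-inj) (rep-energy α′≢0 β′≢0 uniqueR g g-inj) ⟩
    2 * sq a + 2 * sq a
      ≡⟨ double (sq a) ⟩
    2 * (2 * sq a)
      ∎)
    where
    open ≤-Reasoning
    double : ∀ n → 2 * n + 2 * n ≡ 2 * (2 * n)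
    double = solve-∀
    2mn≤m²+n² : ∀ m n → 2 * (m * n) ≤ m * m + n * n
    2mn≤m²+n² m n with ≤-total m n
    ... | inj₁ m≤n with k , refl ← m≤n⇒∃[o]m+o≡n m≤n = ≤-trans (m≤m+n _ (k * k)) (≤-reflexive (lemma m k))
      where
      lemma : ∀ m k → 2 * (m * (m + k)) + k * k ≡ m * m + (m + k) * (m + k)
      lemma = solve-∀
    ... | inj₂ n≤m with k , refl ← m≤n⇒∃[o]m+o≡n n≤m = ≤-trans (m≤m+n _ (k * k)) (≤-reflexive (lemma n k))
      where
      lemma : ∀ n k → 2 * ((n + k) * n) + k * k ≡ (n + k) * (n + k) + n * n
      lemma = solve-∀

  form₄-solutions : ∀ {α β γ ε} → α ≢ + 0 → β ≢ + 0 → γ ≢ + 0 → ε ≢ + 0 →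
    ∑ (cartesianProduct A A) (λ p → ∑ (cartesianProduct A A) (λ q →
      δ (form α β p ℤ.+ form γ ε q) (+ 0))) ≤ 2 * sq a
  form₄-solutions {α} {β} {γ} {ε} α≢0 β≢0 γ≢0 ε≢0 = begin
    ∑ AA (λ p → ∑ AA (λ q → δ (form α β p ℤ.+ form γ ε q) (+ 0)))
      ≡⟨ ∑-cong AA (λ p → ∑-cong AA (λ q → δ-cong (λ eq → ≡-from eq (lemma₁ (form α β p) (form γ ε q)))
           (λ eq → ≡-from eq (lemma₂ (form α β p) (form γ ε q))))) ⟩
    ∑ AA (λ p → ∑ AA (λ q → δ (form γ ε q) (ℤ.- form α β p)))
      ≡⟨ ∑-cong-∈ AA (λ {p} p∈ → sym (∑-δ* uniqueR {form α β p} (rep A γ ε ∘ ℤ.-_) (∈-deduplicate⁺ ℤ._≟_ (∈-map⁺ (form α β) p∈)))) ⟩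
    ∑ AA (λ p → ∑ R (λ v → δ (form α β p) v * rep A γ ε (ℤ.- v)))
      ≡⟨ ∑-swap AA R _ ⟩
    ∑ R (λ v → ∑ AA (λ p → δ (form α β p) v * rep A γ ε (ℤ.- v)))
      ≡⟨ ∑-cong R (λ v → ∑-*ʳ AA _ _) ⟩
    ∑ R (λ v → rep A α β v * rep A γ ε (ℤ.- v))
      ≤⟨ rep-correlation α≢0 β≢0 γ≢0 ε≢0 uniqueR id ℤ.-_ id ℤ.neg-injective ⟩
    2 * sq a
      ∎
    where
    open ≤-Reasoning
    AA = cartesianProduct A A
    R = deduplicate ℤ._≟_ (map (form α β) AA)
    uniqueR : Unique R
    uniqueR = deduplicate-! (map (form α β) AA)
    lemma₁ : ∀ u v → v ℤ.- (ℤ.- u) ≡ u ℤ.+ v ℤ.- + 0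
    lemma₁ = ℤ-Solver.solve-∀
    lemma₂ : ∀ u v → u ℤ.+ v ℤ.- + 0 ≡ v ℤ.- (ℤ.- u)
    lemma₂ = ℤ-Solver.solve-∀

-- Pigeonhole and intervals

shift-injective : ∀ t {u v} → u ℤ.+ t ≡ v ℤ.+ t → u ≡ v
shift-injective t {u} {v} eq = ≡-from eq (lemma u v t)
  where
  lemma : ∀ u v t → u ℤ.- v ≡ u ℤ.+ t ℤ.- (v ℤ.+ t)
  lemma = ℤ-Solver.solve-∀

reflect-injective : ∀ c {u v} → c ℤ.- u ≡ c ℤ.- v → u ≡ v
reflect-injective c {u} {v} eq = ≡-from (sym eq) (lemma u v c)
  where
  lemma : ∀ u v c → u ℤ.- v ≡ c ℤ.- v ℤ.- (c ℤ.- u)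
  lemma = ℤ-Solver.solve-∀

module _ {X : Set} {P : X → Set} (P? : ∀ x → Dec (P x)) where

  length-filter-¬ : ∀ L → length L ≡ length (filter P? L) + length (filter (¬? ∘ P?) L)
  length-filter-¬ []      = refl
  length-filter-¬ (x ∷ L) with P? x
  ... | yes _ = cong suc (length-filter-¬ L)
  ... | no  _ = trans (cong suc (length-filter-¬ L)) (sym (+-suc _ _))

  ∑ᶻ-filter : ∀ L (f : X → ℤ) → ∑ᶻ L f ≡ ∑ᶻ (filter P? L) f ℤ.+ ∑ᶻ (filter (¬? ∘ P?) L) f
  ∑ᶻ-filter []      f = refl
  ∑ᶻ-filter (x ∷ L) f with P? x
  ... | yes _ = trans (cong (λ s → f x ℤ.+ s) (∑ᶻ-filter L f)) (sym (ℤ.+-assoc (f x) _ _))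
  ... | no  _ = trans (cong (λ s → f x ℤ.+ s) (∑ᶻ-filter L f))
    (lemma (f x) (∑ᶻ (filter P? L) f) (∑ᶻ (filter (¬? ∘ P?) L) f))
    where
    lemma : ∀ x y z → x ℤ.+ (y ℤ.+ z) ≡ y ℤ.+ (x ℤ.+ z)
    lemma = ℤ-Solver.solve-∀

  ∑-filter : ∀ L (f : X → ℕ) → ∑ L f ≡ ∑ (filter P? L) f + ∑ (filter (¬? ∘ P?) L) f
  ∑-filter []      f = refl
  ∑-filter (x ∷ L) f with P? x
  ... | yes _ = trans (cong (λ s → f x + s) (∑-filter L f)) (sym (+-assoc (f x) _ _))
  ... | no  _ = trans (cong (λ s → f x + s) (∑-filter L f))
    (lemma (f x) (∑ (filter P? L) f) (∑ (filter (¬? ∘ P?) L) f))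
    where
    lemma : ∀ x y z → x + (y + z) ≡ y + (x + z)
    lemma = solve-∀

length-filter-filter : ∀ {X : Set} {P Q : X → Set} (P? : ∀ x → Dec (P x)) (Q? : ∀ x → Dec (Q x)) L →
  length (filter P? (filter Q? L)) ≤ length (filter P? L)
length-filter-filter P? Q? []      = z≤n
length-filter-filter P? Q? (x ∷ L) with Q? x | length-filter-filter P? Q? L
... | no  _ | ih = ≤-trans ih (filter-∷ x)
  where
  filter-∷ : ∀ x → length (filter P? L) ≤ length (filter P? (x ∷ L))
  filter-∷ x with P? x
  ... | yes _ = n≤1+n _
  ... | no  _ = ≤-refl
... | yes _ | ih with P? x
...   | yes _ = s≤s ih
...   | no  _ = ih

pigeonhole : ∀ {X Y : Set} {R : Y → X → Set} (R? : ∀ y x → Dec (R y x)) y C L →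
  (∀ {x} → x ∈ L → ∃[ z ] (z ∈ y ∷ C × R z x)) →
  ∃[ z ] (z ∈ y ∷ C × length L ≤ suc (length C) * length (filter (R? z) L))
pigeonhole {R = R} R? y [] L cover = y , here refl , ≤-reflexive (sym (trans (*-identityˡ _)
  (cong length (filter-all (R? y) (All.tabulate λ x∈L → covered (cover x∈L))))))
  where
  covered : ∀ {x} → ∃[ z ] (z ∈ y ∷ [] × R z x) → R y x
  covered (_ , here refl , r) = r
pigeonhole {R = R} R? y (y′ ∷ C) L cover with pigeonhole R? y′ C (filter (¬? ∘ R? y) L) cover′
  where
  cover′ : ∀ {x} → x ∈ filter (¬? ∘ R? y) L → ∃[ z ] (z ∈ y′ ∷ C × R z x)
  cover′ x∈ with ∈-filter⁻ (¬? ∘ R? y) {xs = L} x∈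
  ... | x∈L , ¬r with cover x∈L
  ...   | _ , here refl , r = contradiction r ¬r
  ...   | z , there z∈ , r  = z , z∈ , r
... | z , z∈ , few with ≤-total (length (filter (R? y) L)) (length (filter (R? z) L))
...   | inj₁ y≤z = z , there z∈ , (begin
  length L                                                          ≡⟨ length-filter-¬ (R? y) L ⟩
  length (filter (R? y) L) + length (filter (¬? ∘ R? y) L)          ≤⟨ +-mono-≤ y≤z few ⟩
  ∣z∣ + suc (length C) * length (filter (R? z) (filter (¬? ∘ R? y) L))
    ≤⟨ +-monoʳ-≤ ∣z∣ (*-monoʳ-≤ (suc (length C)) (length-filter-filter (R? z) (¬? ∘ R? y) L)) ⟩
  ∣z∣ + suc (length C) * ∣z∣                                        ∎)
  where
  open ≤-Reasoning
  ∣z∣ = length (filter (R? z) L)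
...   | inj₂ z≤y = y , here refl , (begin
  length L                                                          ≡⟨ length-filter-¬ (R? y) L ⟩
  ∣y∣ + length (filter (¬? ∘ R? y) L)                               ≤⟨ +-monoʳ-≤ ∣y∣ few ⟩
  ∣y∣ + suc (length C) * length (filter (R? z) (filter (¬? ∘ R? y) L))
    ≤⟨ +-monoʳ-≤ ∣y∣ (*-monoʳ-≤ (suc (length C)) (≤-trans (length-filter-filter (R? z) (¬? ∘ R? y) L) z≤y)) ⟩
  ∣y∣ + suc (length C) * ∣y∣                                        ∎)
  where
  open ≤-Reasoning
  ∣y∣ = length (filter (R? y) L)

pigeonhole-colour : ∀ {X : Set} (c : X → ℕ) n L → (∀ {x} → x ∈ L → c x ≤ n) →
  ∃[ j ] length L ≤ suc n * length (filter (λ x → c x ≟ j) L)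
pigeonhole-colour c n L bounded with pigeonhole (λ j x → c x ≟ j) n (upTo n) L cover
  where
  cover : ∀ {x} → x ∈ L → ∃[ j ] (j ∈ n ∷ upTo n × c x ≡ j)
  cover {x} x∈L with m≤n⇒m<n∨m≡n (bounded x∈L)
  ... | inj₁ cx<n = c x , there (∈-upTo⁺ cx<n) , refl
  ... | inj₂ cx≡n = n , here refl , cx≡n
... | j , _ , le = j , subst (λ l → length L ≤ suc l * length (filter (λ x → c x ≟ j) L)) (length-upTo n) le

abstract
  interval : ℕ → List ℤ
  interval B = map (λ i → + i ℤ.- + B) (upTo (suc (B + B)))

  length-interval : ∀ B → length (interval B) ≡ suc (B + B)
  length-interval B = trans (length-map _ (upTo (suc (B + B)))) (length-upTo (suc (B + B)))

  interval-! : ∀ B → Unique (interval B)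
  interval-! B = Unique.map⁺ (λ {i} {j} eq → ℤ.+-injective (shift-injective (ℤ.- + B) {+ i} {+ j} eq))
    (Unique.upTo⁺ (suc (B + B)))

  ∈-interval : ∀ {B v} → ℤ.∣ v ∣ ≤ B → v ∈ interval B
  ∈-interval {B} { + n }      n≤B = subst (_∈ interval B) eq (∈-map⁺ (λ i → + i ℤ.- + B) (∈-upTo⁺ (s≤s (+-monoˡ-≤ B n≤B))))
    where
    cancel : ∀ n b → n ℤ.+ b ℤ.- b ≡ n
    cancel = ℤ-Solver.solve-∀
    eq : + (n + B) ℤ.- + B ≡ + n
    eq = trans (cong (λ s → s ℤ.- + B) (ℤ.pos-+ n B)) (cancel (+ n) (+ B))
  ∈-interval {B} { -[1+ n ] } n<B = subst (_∈ interval B) eq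
    (∈-map⁺ (λ i → + i ℤ.- + B) (∈-upTo⁺ (s≤s (≤-trans (m∸n≤m B (suc n)) (m≤m+n B B)))))
    where
    k : ℕ
    k = B ∸ suc n
    B≡ : B ≡ k + suc n
    B≡ = sym (m∸n+n≡m n<B)
    cancel : ∀ k n → k ℤ.- (k ℤ.+ n) ≡ ℤ.- n
    cancel = ℤ-Solver.solve-∀
    eq : + k ℤ.- + B ≡ -[1+ n ]
    eq = trans (cong (λ b → + k ℤ.- + b) B≡) (trans (cong (λ s → + k ℤ.- s) (ℤ.pos-+ k (suc n))) (cancel (+ k) (+ suc n)))

∑ᶻ-δ* : ∀ {L : List ℤ} → Unique L → ∀ {c} (g : ℤ → ℤ) → c ∈ L → ∑ᶻ L (λ x → + δ c x ℤ.* g x) ≡ g c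
∑ᶻ-δ* {L} u {c} g c∈L = begin
  ∑ᶻ L (λ x → + δ c x ℤ.* g x)    ≡⟨ ∑ᶻ-cong L swap-argument ⟩
  ∑ᶻ L (λ x → + δ c x ℤ.* g c)    ≡⟨ ∑ᶻ-*ʳ L (λ x → + δ c x) (g c) ⟩
  ∑ᶻ L (λ x → + δ c x) ℤ.* g c    ≡⟨ cong (ℤ._* g c) (trans (sym (+∑ L (δ c))) (cong (λ k → + k) (∑-δ-∈ u c∈L))) ⟩
  + 1 ℤ.* g c                     ≡⟨ ℤ.*-identityˡ (g c) ⟩
  g c                             ∎
  where
  open ≡-Reasoning
  swap-argument : ∀ x → + δ c x ℤ.* g x ≡ + δ c x ℤ.* g c
  swap-argument x with c ℤ.≟ x
  ... | yes refl = refl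
  ... | no  _    = refl

∑ᶻ-neg : ∀ {I : Set} (L : List I) (f : I → ℤ) → ∑ᶻ L (λ i → ℤ.- f i) ≡ ℤ.- ∑ᶻ L f
∑ᶻ-neg []      f = refl
∑ᶻ-neg (i ∷ L) f = trans (cong (λ s → ℤ.- f i ℤ.+ s) (∑ᶻ-neg L f)) (sym (ℤ.neg-distrib-+ (f i) (∑ᶻ L f)))

∑ᶻ-minus : ∀ {I : Set} (L : List I) (f g : I → ℤ) → ∑ᶻ L (λ i → f i ℤ.- g i) ≡ ∑ᶻ L f ℤ.- ∑ᶻ L g
∑ᶻ-minus L f g = trans (∑ᶻ-+ L f (λ i → ℤ.- g i)) (cong (λ s → ∑ᶻ L f ℤ.+ s) (∑ᶻ-neg L g))

∑ᶻ≡0 : ∀ {I : Set} (L : List I) {f : I → ℤ} → (∀ {i} → i ∈ L → f i ≡ + 0) → ∑ᶻ L f ≡ + 0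
∑ᶻ≡0 L zeros = trans (∑ᶻ-cong-∈ L zeros) (∑ᶻ-0 L)

∑∑-AllPairs-≤ : ∀ {I : Set} {L : List I} (f : I → I → ℕ) {c d} → (∀ i j → f i j ≡ f j i) →
  (∀ {i} → i ∈ L → f i i ≤ c) → AllPairs (λ i j → f i j ≤ d) L →
  ∑ L (λ i → ∑ L (f i)) ≤ length L * c + sq (length L) * d
∑∑-AllPairs-≤ {L = []} f sym-f diag [] = z≤n
∑∑-AllPairs-≤ {L = i ∷ L} f {c} {d} sym-f diag (off ∷ offs) = begin
  f i i + ∑ L (f i) + ∑ L (λ j → f j i + ∑ L (f j))
    ≡⟨ cong (λ s → f i i + ∑ L (f i) + s) (trans (∑-+ L (λ j → f j i) (λ j → ∑ L (f j)))
         (cong (_+ ∑ L (λ j → ∑ L (f j))) (∑-cong L (λ j → sym-f j i)))) ⟩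
  f i i + ∑ L (f i) + (∑ L (f i) + ∑ L (λ j → ∑ L (f j)))
    ≤⟨ +-mono-≤ (+-mono-≤ (diag (here refl)) row) (+-mono-≤ row (∑∑-AllPairs-≤ f sym-f (diag ∘ there) offs)) ⟩
  c + l * d + (l * d + (l * c + l * l * d))
    ≤⟨ m≤m+n _ d ⟩
  c + l * d + (l * d + (l * c + l * l * d)) + d
    ≡⟨ lemma l c d ⟩
  suc l * c + suc l * suc l * d
    ∎
  where
  open ≤-Reasoning
  l = length L
  row : ∑ L (f i) ≤ l * d
  row = ∑-≤-const L d (All.lookup off)
  lemma : ∀ l c d → c + l * d + (l * d + (l * c + l * l * d)) + d ≡ (1 + l) * c + (1 + l) * (1 + l) * d
  lemma = solve-∀

-- Counting solutions

1≤sum : ∀ {a₁ a₂ a₃ a₄} → 1 ≤ a₁ → 1 ≤ a₁ + a₂ + a₃ + a₄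
1≤sum {a₁} {a₂} {a₃} {a₄} 1≤a₁ =
  ≤-trans 1≤a₁ (≤-trans (m≤m+n a₁ a₂) (≤-trans (m≤m+n (a₁ + a₂) a₃) (m≤m+n (a₁ + a₂ + a₃) a₄)))

record SidonSystem : Set where
  field
    A         : List ℤ
    uniqueA   : Unique A
    sidonA    : Sidonᶻ A
    a₁ a₂ a₃ a₄ : ℕ
    1≤a₁      : 1 ≤ a₁
    1≤a₂      : 1 ≤ a₂
    1≤a₃      : 1 ≤ a₃
    1≤a₄      : 1 ≤ a₄
    P         : ℕ
    A-bounded : ∀ {x} → x ∈ A → ℤ.∣ x ∣ ≤ P

module Counting (𝒮 : SidonSystem) where

  open SidonSystem 𝒮 public

  a S : ℕ
  a = length A
  S = a₁ + a₂ + a₃ + a₄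

  σ : ℤ
  σ = ℤ.- + S

  AA : List (ℤ × ℤ)
  AA = cartesianProduct A A

  AA-! : Unique AA
  AA-! = Unique.cartesianProduct⁺ uniqueA uniqueA

  +≢0 : ∀ {n} → 1 ≤ n → + n ≢ + 0
  +≢0 (s≤s _) ()

  form₁₂ form₃₄ : ℤ × ℤ → ℤ
  form₁₂ = form (+ a₁) (+ a₂)
  form₃₄ = form (+ a₃) (+ a₄)

  solutions : ℤ → ℕ
  solutions m = ∑ AA (λ p → ∑ AA (λ r → ∑ A (λ z → δ (form₁₂ p ℤ.+ form₃₄ r ℤ.+ σ ℤ.* z) m)))

  q : ℤ → ℕ
  q = rep A (+ a₃) (+ a₄)

  1≤S : 1 ≤ S
  1≤S = 1≤sum 1≤a₁

  ∣σ∣≡S : ℤ.∣ σ ∣ ≡ S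
  ∣σ∣≡S = ℤ.∣-i∣≡∣i∣ (+ S)

  σ≢0 : σ ≢ + 0
  σ≢0 eq = +≢0 1≤S (ℤ.neg-injective eq)

  solutions-q : ∀ m → solutions m ≡ ∑ AA (λ p → ∑ A (λ z → q (m ℤ.- form₁₂ p ℤ.- σ ℤ.* z)))
  solutions-q m = ∑-cong AA (λ p → trans (∑-swap AA A _) (∑-cong A (λ z → ∑-cong AA (λ r →
    δ-cong (λ eq → ≡-from eq (lemma₁ (form₁₂ p) (form₃₄ r) (σ ℤ.* z) m))
           (λ eq → ≡-from eq (lemma₂ (form₁₂ p) (form₃₄ r) (σ ℤ.* z) m))))))
    where
    lemma₁ : ∀ u v w m → v ℤ.- (m ℤ.- u ℤ.- w) ≡ u ℤ.+ v ℤ.+ w ℤ.- m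
    lemma₁ = ℤ-Solver.solve-∀
    lemma₂ : ∀ u v w m → u ℤ.+ v ℤ.+ w ℤ.- m ≡ v ℤ.- (m ℤ.- u ℤ.- w)
    lemma₂ = ℤ-Solver.solve-∀

  form-bounded : ∀ b c {x y} → x ∈ A → y ∈ A → ℤ.∣ form (+ b) (+ c) (x , y) ∣ ≤ (b + c) * P
  form-bounded b c {x} {y} x∈ y∈ = begin
    ℤ.∣ + b ℤ.* x ℤ.+ + c ℤ.* y ∣             ≤⟨ ℤ.∣i+j∣≤∣i∣+∣j∣ (+ b ℤ.* x) (+ c ℤ.* y) ⟩
    ℤ.∣ + b ℤ.* x ∣ + ℤ.∣ + c ℤ.* y ∣         ≡⟨ cong₂ _+_ (ℤ.abs-* (+ b) x) (ℤ.abs-* (+ c) y) ⟩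
    b * ℤ.∣ x ∣ + c * ℤ.∣ y ∣
      ≤⟨ +-mono-≤ (*-monoʳ-≤ b (A-bounded x∈)) (*-monoʳ-≤ c (A-bounded y∈)) ⟩
    b * P + c * P                             ≡⟨ *-distribʳ-+ P b c ⟨
    (b + c) * P                               ∎
    where open ≤-Reasoning

  a₃+a₄≤S : a₃ + a₄ ≤ S
  a₃+a₄≤S = ≤-trans (m≤n+m (a₃ + a₄) (a₁ + a₂)) (≤-reflexive (sym (+-assoc (a₁ + a₂) a₃ a₄)))

  a₁+a₂≤S : a₁ + a₂ ≤ S
  a₁+a₂≤S = ≤-trans (m≤m+n (a₁ + a₂) a₃) (m≤m+n (a₁ + a₂ + a₃) a₄)

  P≤SP : P ≤ S * P
  P≤SP = ≤-trans (≤-reflexive (sym (*-identityˡ P))) (*-monoˡ-≤ P 1≤S)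

  q-support : ∀ {v} → S * P < ℤ.∣ v ∣ → q v ≡ 0
  q-support {v} large = trans (∑-cong-∈ AA zeros) (∑-0 AA)
    where
    zeros : ∀ {r} → r ∈ AA → δ (form₃₄ r) v ≡ 0
    zeros {x , y} r∈ with ∈-cartesianProduct⁻ A A r∈
    ... | x∈ , y∈ = δ-≢ (λ eq → <⇒≱ large (subst (λ u → ℤ.∣ u ∣ ≤ S * P) eq
      (≤-trans (form-bounded a₃ a₄ x∈ y∈) (*-monoˡ-≤ P a₃+a₄≤S))))

  R : List ℤ
  R = interval (3 * (S * P))

  R-! : Unique R
  R-! = interval-! (3 * (S * P))

  ρ : ℕ
  ρ = length R

  w : ℤ × ℤ → ℤ → ℤ
  w (t , t′) v = + q (v ℤ.+ t) ℤ.- + q (v ℤ.+ t′)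

  G : ℤ × ℤ → ℤ → ℤ
  G k u = ∑ᶻ A (λ z → w k (u ℤ.- σ ℤ.* z))

  V : ℤ × ℤ → ℕ
  V k = ∑ R (λ u → sq ℤ.∣ G k u ∣)

  Short : ℤ × ℤ → Set
  Short (t , t′) = ℤ.∣ t ∣ ≤ P × ℤ.∣ t′ ∣ ≤ P

  ∣v∣≤∣v+t∣+∣t∣ : ∀ v t → ℤ.∣ v ∣ ≤ ℤ.∣ v ℤ.+ t ∣ + ℤ.∣ t ∣
  ∣v∣≤∣v+t∣+∣t∣ v t = subst (λ u → ℤ.∣ u ∣ ≤ ℤ.∣ v ℤ.+ t ∣ + ℤ.∣ t ∣) (lemma v t) (ℤ.∣i-j∣≤∣i∣+∣j∣ (v ℤ.+ t) t)
    where
    lemma : ∀ v t → v ℤ.+ t ℤ.- t ≡ v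
    lemma = ℤ-Solver.solve-∀

  private
    lift-large : ∀ {B b} v t → ℤ.∣ t ∣ ≤ b → B + b < ℤ.∣ v ∣ → B < ℤ.∣ v ℤ.+ t ∣
    lift-large {B} {b} v t t≤b large = +-cancelʳ-< b B ℤ.∣ v ℤ.+ t ∣
      (≤-trans large (≤-trans (∣v∣≤∣v+t∣+∣t∣ v t) (+-monoʳ-≤ ℤ.∣ v ℤ.+ t ∣ t≤b)))

  w-support : ∀ k → Short k → ∀ v → S * P + P < ℤ.∣ v ∣ → w k v ≡ + 0
  w-support (t , t′) (t≤ , t′≤) v large = trans
    (cong₂ (λ x y → + x ℤ.- + y) (q-support (lift-large v t t≤ large)) (q-support (lift-large v t′ t′≤ large))) refl

  ∣σz∣≤SP : ∀ {z} → z ∈ A → ℤ.∣ ℤ.- (σ ℤ.* z) ∣ ≤ S * P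
  ∣σz∣≤SP {z} z∈ = begin
    ℤ.∣ ℤ.- (σ ℤ.* z) ∣    ≡⟨ ℤ.∣-i∣≡∣i∣ (σ ℤ.* z) ⟩
    ℤ.∣ σ ℤ.* z ∣          ≡⟨ ℤ.abs-* σ z ⟩
    ℤ.∣ σ ∣ * ℤ.∣ z ∣      ≡⟨ cong (_* ℤ.∣ z ∣) ∣σ∣≡S ⟩
    S * ℤ.∣ z ∣            ≤⟨ *-monoʳ-≤ S (A-bounded z∈) ⟩
    S * P                  ∎
    where open ≤-Reasoning

  private
    SP+P+SP≤3SP : S * P + P + S * P ≤ 3 * (S * P)
    SP+P+SP≤3SP = ≤-trans (+-monoˡ-≤ (S * P) (+-monoʳ-≤ (S * P) P≤SP)) (≤-reflexive (lemma (S * P)))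
      where
      lemma : ∀ x → x + x + x ≡ 3 * x
      lemma = solve-∀

  w-vanish : ∀ k → Short k → ∀ v → 3 * (S * P) < ℤ.∣ v ∣ → w k v ≡ + 0
  w-vanish k short v large = w-support k short v (≤-<-trans (≤-trans (m≤m+n _ (S * P)) SP+P+SP≤3SP) large)

  w-R : ∀ k → Short k → ∀ v → w k v ≡ + 0 ⊎ v ∈ R
  w-R k short v with ℤ.∣ v ∣ ≤? 3 * (S * P)
  ... | yes small = inj₂ (∈-interval small)
  ... | no ¬small = inj₁ (w-vanish k short v (≰⇒> ¬small))

  G-R : ∀ k → Short k → ∀ u → G k u ≡ + 0 ⊎ u ∈ R
  G-R k short u with ℤ.∣ u ∣ ≤? 3 * (S * P)
  ... | yes small = inj₂ (∈-interval small)
  ... | no ¬small = inj₁ (∑ᶻ≡0 A (λ {z} z∈ → w-support k short (u ℤ.- σ ℤ.* z)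
    (lift-large u (ℤ.- (σ ℤ.* z)) (∣σz∣≤SP z∈) (≤-<-trans SP+P+SP≤3SP (≰⇒> ¬small)))))

  solutions-difference : ∀ m t t′ → + solutions (m ℤ.+ t) ℤ.- + solutions (m ℤ.+ t′)
    ≡ ∑ᶻ AA (λ p → G (t , t′) (m ℤ.- form₁₂ p))
  solutions-difference m t t′ = begin
    + solutions (m ℤ.+ t) ℤ.- + solutions (m ℤ.+ t′)
      ≡⟨ cong₂ ℤ._-_ (as-sum t) (as-sum t′) ⟩
    ∑ᶻ AA (λ p → ∑ᶻ A (λ z → + f t p z)) ℤ.- ∑ᶻ AA (λ p → ∑ᶻ A (λ z → + f t′ p z))
      ≡⟨ ∑ᶻ-minus AA (λ p → ∑ᶻ A (λ z → + f t p z)) (λ p → ∑ᶻ A (λ z → + f t′ p z)) ⟨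
    ∑ᶻ AA (λ p → ∑ᶻ A (λ z → + f t p z) ℤ.- ∑ᶻ A (λ z → + f t′ p z))
      ≡⟨ ∑ᶻ-cong AA (λ p → ∑ᶻ-minus A (λ z → + f t p z) (λ z → + f t′ p z)) ⟨
    ∑ᶻ AA (λ p → G (t , t′) (m ℤ.- form₁₂ p))
      ∎
    where
    open ≡-Reasoning
    f : ℤ → ℤ × ℤ → ℤ → ℕ
    f t p z = q (m ℤ.- form₁₂ p ℤ.- σ ℤ.* z ℤ.+ t)
    lemma : ∀ m u v t → m ℤ.+ t ℤ.- u ℤ.- v ≡ m ℤ.- u ℤ.- v ℤ.+ t
    lemma = ℤ-Solver.solve-∀
    as-sum : ∀ t → + solutions (m ℤ.+ t) ≡ ∑ᶻ AA (λ p → ∑ᶻ A (λ z → + f t p z))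
    as-sum t = trans (cong (λ n → + n) (trans (solutions-q (m ℤ.+ t))
        (∑-cong AA (λ p → ∑-cong A (λ z → cong q (lemma m (form₁₂ p) (σ ℤ.* z) t))))))
      (trans (+∑ AA (λ p → ∑ A (f t p))) (∑ᶻ-cong AA (λ p → +∑ A (f t p))))

  private
    p : ℤ → ℕ
    p = rep A (+ a₁) (+ a₂)

    form∈R : ∀ {r} → r ∈ AA → form₁₂ r ∈ R
    form∈R {x , y} r∈ with ∈-cartesianProduct⁻ A A r∈
    ... | x∈ , y∈ = ∈-interval (≤-trans (form-bounded a₁ a₂ x∈ y∈) (≤-trans (*-monoˡ-≤ P a₁+a₂≤S) (m≤n*m (S * P) 3)))
    collect : ∀ m k → ∑ᶻ R (λ u → + p u ℤ.* G k (m ℤ.- u)) ≡ ∑ᶻ AA (λ r → G k (m ℤ.- form₁₂ r))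
    collect m k = begin
      ∑ᶻ R (λ u → + p u ℤ.* G k (m ℤ.- u))
        ≡⟨ ∑ᶻ-cong R (λ u → trans (cong (ℤ._* G k (m ℤ.- u)) (+∑ AA (λ r → δ (form₁₂ r) u)))
             (sym (∑ᶻ-*ʳ AA (λ r → + δ (form₁₂ r) u) (G k (m ℤ.- u))))) ⟩
      ∑ᶻ R (λ u → ∑ᶻ AA (λ r → + δ (form₁₂ r) u ℤ.* G k (m ℤ.- u)))
        ≡⟨ ∑ᶻ-swap R AA (λ u r → + δ (form₁₂ r) u ℤ.* G k (m ℤ.- u)) ⟩
      ∑ᶻ AA (λ r → ∑ᶻ R (λ u → + δ (form₁₂ r) u ℤ.* G k (m ℤ.- u)))
        ≡⟨ ∑ᶻ-cong-∈ AA (λ {r} r∈ → ∑ᶻ-δ* R-! (λ u → G k (m ℤ.- u)) (form∈R r∈)) ⟩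
      ∑ᶻ AA (λ r → G k (m ℤ.- form₁₂ r))
        ∎
      where open ≡-Reasoning

  solutions-shift-≤ : ∀ {t t′} → Short (t , t′) → ∀ m →
    sq ℤ.∣ + solutions (m ℤ.+ t) ℤ.- + solutions (m ℤ.+ t′) ∣ ≤ 2 * sq a * V (t , t′)
  solutions-shift-≤ {t} {t′} short m = begin
    sq ℤ.∣ + solutions (m ℤ.+ t) ℤ.- + solutions (m ℤ.+ t′) ∣
      ≡⟨ cong (λ i → sq ℤ.∣ i ∣) (trans (solutions-difference m t t′) (sym (collect m k))) ⟩
    sq ℤ.∣ ∑ᶻ R (λ u → + p u ℤ.* G k (m ℤ.- u)) ∣
      ≤⟨ cauchy-schwarz-abs R (λ u → + p u) (λ u → G k (m ℤ.- u)) ⟩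
    ∑ R (λ u → sq (p u)) * ∑ R (λ u → sq ℤ.∣ G k (m ℤ.- u) ∣)
      ≤⟨ *-mono-≤ (rep-energy uniqueA sidonA (+≢0 1≤a₁) (+≢0 1≤a₂) R-! id id)
           (∑-injective-≤ (λ u → m ℤ.- u) (λ u → sq ℤ.∣ G k u ∣) R-!
             (λ _ _ → reflect-injective m) (λ {u} _ → cover (m ℤ.- u))) ⟩
    2 * sq a * V k
      ∎
    where
    open ≤-Reasoning
    k = t , t′
    cover : ∀ u → sq ℤ.∣ G k u ∣ ≡ 0 ⊎ u ∈ R
    cover u with G-R k short u
    ... | inj₁ G≡0 = inj₁ (cong (λ i → sq ℤ.∣ i ∣) G≡0)
    ... | inj₂ u∈R = inj₂ u∈R

-- Correlations of translates

gram-identity : ∀ {K J : Set} (Ks : List K) (Js : List J) (W : K → J → ℤ) →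
  ∑ᶻ Js (λ v → ∑ᶻ Js (λ v′ → sqᶻ (∑ᶻ Ks (λ k → W k v ℤ.* W k v′))))
    ≡ ∑ᶻ Ks (λ k → ∑ᶻ Ks (λ l → sqᶻ (∑ᶻ Js (λ v → W k v ℤ.* W l v))))
gram-identity Ks Js W = begin
  ∑ᶻ Js (λ v → ∑ᶻ Js (λ v′ → sqᶻ (∑ᶻ Ks (λ k → W k v ℤ.* W k v′))))
    ≡⟨ ∑ᶻ-cong Js (λ v → ∑ᶻ-cong Js (λ v′ → ∑ᶻ*∑ᶻ Ks Ks (λ k → W k v ℤ.* W k v′) (λ k → W k v ℤ.* W k v′))) ⟩
  ∑ᶻ Js (λ v → ∑ᶻ Js (λ v′ → ∑ᶻ Ks (λ k → ∑ᶻ Ks (λ l → F k l v v′))))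
    ≡⟨ ∑ᶻ-cong Js (λ v → ∑ᶻ-swap Js Ks (λ v′ k → ∑ᶻ Ks (λ l → F k l v v′))) ⟩
  ∑ᶻ Js (λ v → ∑ᶻ Ks (λ k → ∑ᶻ Js (λ v′ → ∑ᶻ Ks (λ l → F k l v v′))))
    ≡⟨ ∑ᶻ-swap Js Ks (λ v k → ∑ᶻ Js (λ v′ → ∑ᶻ Ks (λ l → F k l v v′))) ⟩
  ∑ᶻ Ks (λ k → ∑ᶻ Js (λ v → ∑ᶻ Js (λ v′ → ∑ᶻ Ks (λ l → F k l v v′))))
    ≡⟨ ∑ᶻ-cong Ks (λ k → ∑ᶻ-cong Js (λ v → ∑ᶻ-swap Js Ks (λ v′ l → F k l v v′))) ⟩
  ∑ᶻ Ks (λ k → ∑ᶻ Js (λ v → ∑ᶻ Ks (λ l → ∑ᶻ Js (λ v′ → F k l v v′))))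
    ≡⟨ ∑ᶻ-cong Ks (λ k → ∑ᶻ-swap Js Ks (λ v l → ∑ᶻ Js (λ v′ → F k l v v′))) ⟩
  ∑ᶻ Ks (λ k → ∑ᶻ Ks (λ l → ∑ᶻ Js (λ v → ∑ᶻ Js (λ v′ → F k l v v′))))
    ≡⟨ ∑ᶻ-cong Ks (λ k → ∑ᶻ-cong Ks (λ l → trans
         (∑ᶻ-cong Js (λ v → ∑ᶻ-cong Js (λ v′ → regroup (W k v) (W k v′) (W l v) (W l v′))))
         (sym (∑ᶻ*∑ᶻ Js Js (λ v → W k v ℤ.* W l v) (λ v → W k v ℤ.* W l v))))) ⟩
  ∑ᶻ Ks (λ k → ∑ᶻ Ks (λ l → sqᶻ (∑ᶻ Js (λ v → W k v ℤ.* W l v))))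
    ∎
  where
  open ≡-Reasoning
  F = λ k l v v′ → W k v ℤ.* W k v′ ℤ.* (W l v ℤ.* W l v′)
  regroup : ∀ x y z t → x ℤ.* y ℤ.* (z ℤ.* t) ≡ x ℤ.* z ℤ.* (y ℤ.* t)
  regroup = ℤ-Solver.solve-∀

gram-identity-abs : ∀ {K J : Set} (Ks : List K) (Js : List J) (W : K → J → ℤ) →
  ∑ Js (λ v → ∑ Js (λ v′ → sq ℤ.∣ ∑ᶻ Ks (λ k → W k v ℤ.* W k v′) ∣))
    ≡ ∑ Ks (λ k → ∑ Ks (λ l → sq ℤ.∣ ∑ᶻ Js (λ v → W k v ℤ.* W l v) ∣))
gram-identity-abs Ks Js W = ℤ.+-injective (trans (cast Js (λ v v′ → ∑ᶻ Ks (λ k → W k v ℤ.* W k v′)))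
  (trans (gram-identity Ks Js W) (sym (cast Ks (λ k l → ∑ᶻ Js (λ v → W k v ℤ.* W l v))))))
  where
  cast : ∀ {I : Set} (L : List I) (f : I → I → ℤ) →
    + ∑ L (λ i → ∑ L (λ j → sq ℤ.∣ f i j ∣)) ≡ ∑ᶻ L (λ i → ∑ᶻ L (λ j → sqᶻ (f i j)))
  cast L f = trans (+∑ L (λ i → ∑ L (λ j → sq ℤ.∣ f i j ∣))) (∑ᶻ-cong L (λ i →
    trans (+∑ L (λ j → sq ℤ.∣ f i j ∣)) (∑ᶻ-cong L (λ j → +sq∣ f i j ∣))))

sq∣m-n∣≤m²+n² : ∀ m n → sq ℤ.∣ + m ℤ.- + n ∣ ≤ sq m + sq n
sq∣m-n∣≤m²+n² m n = ℤ.drop‿+≤+ (begin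
  + sq ℤ.∣ + m ℤ.- + n ∣                           ≡⟨ +sq∣ + m ℤ.- + n ∣ ⟩
  sqᶻ (+ m ℤ.- + n)
    ≤⟨ ℤ.i≤i+j (sqᶻ (+ m ℤ.- + n)) (+ m ℤ.* + n ℤ.+ + m ℤ.* + n) ⦃ positive ⦄ ⟩
  sqᶻ (+ m ℤ.- + n) ℤ.+ (+ m ℤ.* + n ℤ.+ + m ℤ.* + n)  ≡⟨ lemma (+ m) (+ n) ⟩
  + m ℤ.* + m ℤ.+ + n ℤ.* + n                      ≡⟨ cong₂ ℤ._+_ (sym (ℤ.pos-* m m)) (sym (ℤ.pos-* n n)) ⟩
  + sq m ℤ.+ + sq n                                ≡⟨ ℤ.pos-+ (sq m) (sq n) ⟨
  + (sq m + sq n)                                  ∎)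
  where
  open ℤ.≤-Reasoning
  lemma : ∀ x y → (x ℤ.- y) ℤ.* (x ℤ.- y) ℤ.+ (x ℤ.* y ℤ.+ x ℤ.* y) ≡ x ℤ.* x ℤ.+ y ℤ.* y
  lemma = ℤ-Solver.solve-∀
  positive : ℤ.NonNegative (+ m ℤ.* + n ℤ.+ + m ℤ.* + n)
  positive = subst ℤ.NonNegative (trans (ℤ.pos-+ (m * n) (m * n)) (cong₂ ℤ._+_ (ℤ.pos-* m n) (ℤ.pos-* m n))) _

square-square : ∀ {m n} → sq m ≤ sq n → m ≤ n
square-square {m} {n} le with m ≤? n
... | yes m≤n = m≤n
... | no ¬m≤n = contradiction le (<⇒≱ (*-mono-< (≰⇒> ¬m≤n) (≰⇒> ¬m≤n)))

module Correlation (𝒮 : SidonSystem) where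

  open Counting 𝒮 public

  +a₃≢0 : + a₃ ≢ + 0
  +a₃≢0 = +≢0 1≤a₃
  +a₄≢0 : + a₄ ≢ + 0
  +a₄≢0 = +≢0 1≤a₄

  γ : ℤ → ℤ → ℕ
  γ t u = ∑ R (λ v → q (v ℤ.+ t) * q (v ℤ.+ u))

  γ-≤ : ∀ t u → γ t u ≤ 2 * sq a
  γ-≤ t u = rep-correlation uniqueA sidonA +a₃≢0 +a₄≢0 +a₃≢0 +a₄≢0 R-!
    (λ v → v ℤ.+ t) (λ v → v ℤ.+ u) (shift-injective t) (shift-injective u)

  inner : ℤ × ℤ → ℤ × ℤ → ℤ
  inner k l = ∑ᶻ R (λ v → w k v ℤ.* w l v)

  norm-≤ : ∀ k → ∑ R (λ v → sq ℤ.∣ w k v ∣) ≤ 4 * sq a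
  norm-≤ (t , t′) = begin
    ∑ R (λ v → sq ℤ.∣ w (t , t′) v ∣)
      ≤⟨ ∑-mono R (λ v → sq∣m-n∣≤m²+n² (q (v ℤ.+ t)) (q (v ℤ.+ t′))) ⟩
    ∑ R (λ v → sq (q (v ℤ.+ t)) + sq (q (v ℤ.+ t′)))
      ≡⟨ ∑-+ R (λ v → sq (q (v ℤ.+ t))) (λ v → sq (q (v ℤ.+ t′))) ⟩
    ∑ R (λ v → sq (q (v ℤ.+ t))) + ∑ R (λ v → sq (q (v ℤ.+ t′)))
      ≤⟨ +-mono-≤ (energy t) (energy t′) ⟩
    2 * sq a + 2 * sq a
      ≡⟨ lemma (sq a) ⟩
    4 * sq a
      ∎
    where
    open ≤-Reasoning
    energy : ∀ t → ∑ R (λ v → sq (q (v ℤ.+ t))) ≤ 2 * sq a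
    energy t = rep-energy uniqueA sidonA +a₃≢0 +a₄≢0 R-! (λ v → v ℤ.+ t) (shift-injective t)
    lemma : ∀ x → 2 * x + 2 * x ≡ 4 * x
    lemma = solve-∀

  inner-≤ : ∀ k l → sq ℤ.∣ inner k l ∣ ≤ 16 * sq (sq a)
  inner-≤ k l = begin
    sq ℤ.∣ inner k l ∣                                              ≤⟨ cauchy-schwarz-abs R (w k) (w l) ⟩
    ∑ R (λ v → sq ℤ.∣ w k v ∣) * ∑ R (λ v → sq ℤ.∣ w l v ∣)         ≤⟨ *-mono-≤ (norm-≤ k) (norm-≤ l) ⟩
    4 * sq a * (4 * sq a)                                           ≡⟨ lemma (sq a) ⟩
    16 * sq (sq a)                                                  ∎
    where
    open ≤-Reasoning
    lemma : ∀ x → 4 * x * (4 * x) ≡ 16 * (x * x)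
    lemma = solve-∀

  inner-γ : ∀ t t′ u u′ → inner (t , t′) (u , u′)
    ≡ (+ γ t u ℤ.- + γ t u′) ℤ.- (+ γ t′ u ℤ.- + γ t′ u′)
  inner-γ t t′ u u′ = begin
    ∑ᶻ R (λ v → (x t v ℤ.- x t′ v) ℤ.* (x u v ℤ.- x u′ v))
      ≡⟨ ∑ᶻ-cong R (λ v → expand (x t v) (x t′ v) (x u v) (x u′ v)) ⟩
    ∑ᶻ R (λ v → (xx t u v ℤ.- xx t u′ v) ℤ.- (xx t′ u v ℤ.- xx t′ u′ v))
      ≡⟨ ∑ᶻ-minus R (λ v → xx t u v ℤ.- xx t u′ v) (λ v → xx t′ u v ℤ.- xx t′ u′ v) ⟩
    ∑ᶻ R (λ v → xx t u v ℤ.- xx t u′ v) ℤ.- ∑ᶻ R (λ v → xx t′ u v ℤ.- xx t′ u′ v)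
      ≡⟨ cong₂ ℤ._-_ (∑ᶻ-minus R (xx t u) (xx t u′)) (∑ᶻ-minus R (xx t′ u) (xx t′ u′)) ⟩
    (∑ᶻ R (xx t u) ℤ.- ∑ᶻ R (xx t u′)) ℤ.- (∑ᶻ R (xx t′ u) ℤ.- ∑ᶻ R (xx t′ u′))
      ≡⟨ cong₂ ℤ._-_ (cong₂ ℤ._-_ (sum t u) (sum t u′)) (cong₂ ℤ._-_ (sum t′ u) (sum t′ u′)) ⟩
    (+ γ t u ℤ.- + γ t u′) ℤ.- (+ γ t′ u ℤ.- + γ t′ u′)
      ∎
    where
    open ≡-Reasoning
    x : ℤ → ℤ → ℤ
    x t v = + q (v ℤ.+ t)
    xx : ℤ → ℤ → ℤ → ℤ
    xx t u v = x t v ℤ.* x u v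
    expand : ∀ a b c d → (a ℤ.- b) ℤ.* (c ℤ.- d) ≡ (a ℤ.* c ℤ.- a ℤ.* d) ℤ.- (b ℤ.* c ℤ.- b ℤ.* d)
    expand = ℤ-Solver.solve-∀
    sum : ∀ t u → ∑ᶻ R (xx t u) ≡ + γ t u
    sum t u = sym (trans (+∑ R (λ v → q (v ℤ.+ t) * q (v ℤ.+ u)))
      (∑ᶻ-cong R (λ v → ℤ.pos-* (q (v ℤ.+ t)) (q (v ℤ.+ u)))))

  inner-comm : ∀ k l → inner k l ≡ inner l k
  inner-comm k l = ∑ᶻ-cong R (λ v → ℤ.*-comm (w k v) (w l v))

  module _ (Ks : List (ℤ × ℤ)) (short : ∀ {k} → k ∈ Ks → Short k) where

    private
      _≟₂_ : ∀ (r : ℤ × ℤ) → Dec (proj₁ r ≡ proj₂ r)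
      _≟₂_ r = proj₁ r ℤ.≟ proj₂ r

      diagonal off-diagonal : List (ℤ × ℤ)
      diagonal     = filter _≟₂_ AA
      off-diagonal = filter (¬? ∘ _≟₂_) AA

      m : ℕ
      m = length Ks

      arg : ℤ → ℤ → ℤ
      arg u z = u ℤ.- σ ℤ.* z

      C : ℤ × ℤ → ℤ × ℤ → ℤ
      C k r = ∑ᶻ R (λ u → w k (arg u (proj₁ r)) ℤ.* w k (arg u (proj₂ r)))

      V-expand : ∀ k → + V k ≡ ∑ᶻ diagonal (C k) ℤ.+ ∑ᶻ off-diagonal (C k)
      V-expand k = begin
        + ∑ R (λ u → sq ℤ.∣ G k u ∣)
          ≡⟨ +∑ R (λ u → sq ℤ.∣ G k u ∣) ⟩
        ∑ᶻ R (λ u → + sq ℤ.∣ G k u ∣)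
          ≡⟨ ∑ᶻ-cong R (λ u → trans +sq∣ G k u ∣ (∑ᶻ*∑ᶻ A A (λ z → w k (arg u z)) (λ z → w k (arg u z)))) ⟩
        ∑ᶻ R (λ u → ∑ᶻ A (λ z → ∑ᶻ A (λ z′ → w k (arg u z) ℤ.* w k (arg u z′))))
          ≡⟨ ∑ᶻ-cong R (λ u → ∑ᶻ-× A A (λ r → w k (arg u (proj₁ r)) ℤ.* w k (arg u (proj₂ r)))) ⟨
        ∑ᶻ R (λ u → ∑ᶻ AA (λ r → w k (arg u (proj₁ r)) ℤ.* w k (arg u (proj₂ r))))
          ≡⟨ ∑ᶻ-swap R AA (λ u r → w k (arg u (proj₁ r)) ℤ.* w k (arg u (proj₂ r))) ⟩
        ∑ᶻ AA (C k)
          ≡⟨ ∑ᶻ-filter _≟₂_ AA (C k) ⟩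
        ∑ᶻ diagonal (C k) ℤ.+ ∑ᶻ off-diagonal (C k)
          ∎
        where open ≡-Reasoning

      w-cover : ∀ {k} → k ∈ Ks → ∀ v → sq ℤ.∣ w k v ∣ ≡ 0 ⊎ v ∈ R
      w-cover {k} k∈ v with w-R k (short k∈) v
      ... | inj₁ w≡0 = inj₁ (cong (λ i → sq ℤ.∣ i ∣) w≡0)
      ... | inj₂ v∈R = inj₂ v∈R

      diagonal-length : length diagonal ≤ a
      diagonal-length = begin
        length diagonal          ≡⟨ trans (sym (*-identityʳ _)) (sym (∑-const diagonal 1)) ⟩
        ∑ diagonal (λ _ → 1)     ≤⟨ ∑-injective-≤ proj₁ (λ _ → 1) (Unique.filter⁺ _≟₂_ AA-!) inj
                                      (λ r∈ → inj₂ (proj₁ (∈-cartesianProduct⁻ A A (proj₁ (∈-filter⁻ _≟₂_ {xs = AA} r∈))))) ⟩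
        ∑ A (λ _ → 1)            ≡⟨ trans (∑-const A 1) (*-identityʳ a) ⟩
        a                        ∎
        where
        open ≤-Reasoning
        inj : ∀ {r r′} → r ∈ diagonal → r′ ∈ diagonal → proj₁ r ≡ proj₁ r′ → r ≡ r′
        inj r∈ r′∈ eq with ∈-filter⁻ _≟₂_ {xs = AA} r∈ | ∈-filter⁻ _≟₂_ {xs = AA} r′∈
        ... | _ , refl | _ , refl = cong (λ z → z , z) eq

      diagonal-≤ : ∀ {k} → k ∈ Ks → ∑ᶻ diagonal (C k) ℤ.≤ + (a * (4 * sq a))
      diagonal-≤ {k} k∈ = subst (ℤ._≤ + (a * (4 * sq a))) (sym as-ℕ) (ℤ.+≤+ (≤-trans
        (∑-≤-const diagonal (4 * sq a) (λ {r} _ → ≤-trans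
          (∑-injective-≤ (λ u → arg u (proj₁ r)) (λ v → sq ℤ.∣ w k v ∣) R-!
            (λ _ _ → shift-injective (ℤ.- (σ ℤ.* proj₁ r))) (λ {u} _ → w-cover k∈ (arg u (proj₁ r))))
          (norm-≤ k)))
        (*-monoˡ-≤ (4 * sq a) diagonal-length)))
        where
        as-ℕ : ∑ᶻ diagonal (C k) ≡ + ∑ diagonal (λ r → ∑ R (λ u → sq ℤ.∣ w k (arg u (proj₁ r)) ∣))
        as-ℕ = sym (trans (+∑ diagonal (λ r → ∑ R (λ u → sq ℤ.∣ w k (arg u (proj₁ r)) ∣)))
          (∑ᶻ-cong-∈ diagonal (λ {r} r∈ → trans (+∑ R (λ u → sq ℤ.∣ w k (arg u (proj₁ r)) ∣))
            (∑ᶻ-cong R (λ u → trans +sq∣ w k (arg u (proj₁ r)) ∣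
              (cong (λ z → w k (arg u (proj₁ r)) ℤ.* w k (arg u z)) (proj₂ (∈-filter⁻ _≟₂_ {xs = AA} r∈))))))))

      index : List ((ℤ × ℤ) × ℤ)
      index = cartesianProduct off-diagonal R

      args : (ℤ × ℤ) × ℤ → ℤ × ℤ
      args (r , u) = arg u (proj₁ r) , arg u (proj₂ r)

      Y : ℤ × ℤ → ℤ
      Y (v , v′) = ∑ᶻ Ks (λ k → w k v ℤ.* w k v′)

      off : ℤ
      off = ∑ᶻ Ks (λ k → ∑ᶻ off-diagonal (C k))

      off-Y : off ≡ ∑ᶻ index (λ i → + 1 ℤ.* Y (args i))
      off-Y = begin
        ∑ᶻ Ks (λ k → ∑ᶻ off-diagonal (C k))
          ≡⟨ ∑ᶻ-cong Ks (λ k → ∑ᶻ-× off-diagonal R (λ i → f k i)) ⟨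
        ∑ᶻ Ks (λ k → ∑ᶻ index (f k))
          ≡⟨ ∑ᶻ-swap Ks index f ⟩
        ∑ᶻ index (λ i → Y (args i))
          ≡⟨ ∑ᶻ-cong index (λ i → ℤ.*-identityˡ (Y (args i))) ⟨
        ∑ᶻ index (λ i → + 1 ℤ.* Y (args i))
          ∎
        where
        open ≡-Reasoning
        f : ℤ × ℤ → (ℤ × ℤ) × ℤ → ℤ
        f k i = w k (proj₁ (args i)) ℤ.* w k (proj₂ (args i))

      -- The difference of the two arguments is a dilated difference of distinct elements
      -- of A, hence determines them.
      args-injective : ∀ {i j} → i ∈ index → j ∈ index → args i ≡ args j → i ≡ j
      args-injective {(z , z′) , u} {(y , y′) , v} i∈ j∈ eq = cong₂ _,_ (cong₂ _,_ (proj₁ same) (proj₂ same))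
        (shift-injective (ℤ.- (σ ℤ.* z)) (trans (cong proj₁ eq) (cong (λ x → v ℤ.- σ ℤ.* x) (sym (proj₁ same)))))
        where
        members : ∀ {r u} → (r , u) ∈ index → (proj₁ r ∈ A × proj₂ r ∈ A) × proj₁ r ≢ proj₂ r
        members {r} i∈ = let (r∈AA , distinct) = ∈-filter⁻ (¬? ∘ _≟₂_) {xs = AA} (proj₁ (∈-cartesianProduct⁻ off-diagonal R i∈))
          in ∈-cartesianProduct⁻ A A r∈AA , distinct
        lemma : ∀ s u z z′ → (u ℤ.- s ℤ.* z′) ℤ.- (u ℤ.- s ℤ.* z) ≡ s ℤ.* (z ℤ.- z′)
        lemma = ℤ-Solver.solve-∀
        differences : σ ℤ.* (z ℤ.- z′) ≡ σ ℤ.* (y ℤ.- y′)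
        differences = trans (sym (lemma σ u z z′)) (trans
          (cong₂ ℤ._-_ (cong proj₂ eq) (cong proj₁ eq)) (lemma σ v y y′))
        same : z ≡ y × z′ ≡ y′
        same = sidon-difference sidonA (proj₁ (proj₁ (members i∈))) (proj₂ (proj₁ (members i∈)))
          (proj₁ (proj₁ (members j∈))) (proj₂ (proj₁ (members j∈))) (proj₂ (members i∈)) (*-cancelˡ-≢0 σ≢0 differences)

      Y-cover : ∀ v → sq ℤ.∣ Y v ∣ ≡ 0 ⊎ v ∈ cartesianProduct R R
      Y-cover (v , v′) with ℤ.∣ v ∣ ≤? 3 * (S * P) | ℤ.∣ v′ ∣ ≤? 3 * (S * P)
      ... | yes v≤ | yes v′≤ = inj₂ (∈-cartesianProduct⁺ (∈-interval v≤) (∈-interval v′≤))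
      ... | no v≰ | _ = inj₁ (cong (λ i → sq ℤ.∣ i ∣) (∑ᶻ≡0 Ks (λ {k} k∈ → trans
            (cong (ℤ._* w k v′) (vanish k∈)) (ℤ.*-zeroˡ (w k v′)))))
        where
        vanish : ∀ {k} → k ∈ Ks → w k v ≡ + 0
        vanish {k} k∈ = w-vanish k (short k∈) v (≰⇒> v≰)
      ... | yes _ | no v′≰ = inj₁ (cong (λ i → sq ℤ.∣ i ∣) (∑ᶻ≡0 Ks (λ {k} k∈ → trans
            (cong (w k v ℤ.*_) (vanish k∈)) (ℤ.*-zeroʳ (w k v)))))
        where
        vanish : ∀ {k} → k ∈ Ks → w k v′ ≡ + 0
        vanish {k} k∈ = w-vanish k (short k∈) v′ (≰⇒> v′≰)

      off-≤ : sq ℤ.∣ off ∣ ≤ sq a * ρ * ∑ Ks (λ k → ∑ Ks (λ l → sq ℤ.∣ inner k l ∣))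
      off-≤ = begin
        sq ℤ.∣ off ∣
          ≡⟨ cong (λ i → sq ℤ.∣ i ∣) off-Y ⟩
        sq ℤ.∣ ∑ᶻ index (λ i → + 1 ℤ.* Y (args i)) ∣
          ≤⟨ cauchy-schwarz-abs index (λ _ → + 1) (Y ∘ args) ⟩
        ∑ index (λ _ → 1) * ∑ index (λ i → sq ℤ.∣ Y (args i) ∣)
          ≤⟨ *-mono-≤ count (∑-injective-≤ args (λ v → sq ℤ.∣ Y v ∣)
               (Unique.cartesianProduct⁺ (Unique.filter⁺ (¬? ∘ _≟₂_) AA-!) R-!) args-injective
               (λ {i} _ → Y-cover (args i))) ⟩
        sq a * ρ * ∑ (cartesianProduct R R) (λ v → sq ℤ.∣ Y v ∣)
          ≡⟨ cong (sq a * ρ *_) (trans (∑-× R R (λ v → sq ℤ.∣ Y v ∣)) (gram-identity-abs Ks R w)) ⟩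
        sq a * ρ * ∑ Ks (λ k → ∑ Ks (λ l → sq ℤ.∣ inner k l ∣))
          ∎
        where
        open ≤-Reasoning
        ∑-AA : ∑ AA (λ _ → 1) ≡ sq a
        ∑-AA = trans (∑-× A A (λ _ → 1)) (trans (∑-const A _) (cong (a *_) (trans (∑-const A 1) (*-identityʳ a))))
        count : ∑ index (λ _ → 1) ≤ sq a * ρ
        count = begin
          ∑ index (λ _ → 1)                       ≡⟨ ∑-× off-diagonal R (λ _ → 1) ⟩
          ∑ off-diagonal (λ _ → ∑ R (λ _ → 1))    ≡⟨ ∑-const off-diagonal _ ⟩
          length off-diagonal * ∑ R (λ _ → 1)
            ≡⟨ cong (length off-diagonal *_) (trans (∑-const R 1) (*-identityʳ ρ)) ⟩
          length off-diagonal * ρ                 ≤⟨ *-monoˡ-≤ ρ (length-filter (¬? ∘ _≟₂_) AA) ⟩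
          length AA * ρ
            ≡⟨ cong (_* ρ) (trans (sym (trans (∑-const AA 1) (*-identityʳ (length AA)))) ∑-AA) ⟩
          sq a * ρ                                ∎

    ∑V-≤ : ∃[ o ] (∑ Ks V ≤ m * (a * (4 * sq a)) + o ×
      sq o ≤ sq a * ρ * ∑ Ks (λ k → ∑ Ks (λ l → sq ℤ.∣ inner k l ∣)))
    ∑V-≤ = ℤ.∣ off ∣ , ℤ.drop‿+≤+ total , off-≤
      where
      open ℤ.≤-Reasoning
      diagonal-sum : + ∑ Ks V ≡ ∑ᶻ Ks (λ k → ∑ᶻ diagonal (C k)) ℤ.+ off
      diagonal-sum = trans (+∑ Ks V) (trans (∑ᶻ-cong Ks V-expand)
        (∑ᶻ-+ Ks (λ k → ∑ᶻ diagonal (C k)) (λ k → ∑ᶻ off-diagonal (C k))))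
      constant : ∑ᶻ Ks (λ _ → + (a * (4 * sq a))) ≡ + (m * (a * (4 * sq a)))
      constant = trans (sym (+∑ Ks (λ _ → a * (4 * sq a)))) (cong (λ n → + n) (∑-const Ks (a * (4 * sq a))))
      total : + ∑ Ks V ℤ.≤ + (m * (a * (4 * sq a)) + ℤ.∣ off ∣)
      total = begin
        + ∑ Ks V
          ≡⟨ diagonal-sum ⟩
        ∑ᶻ Ks (λ k → ∑ᶻ diagonal (C k)) ℤ.+ off
          ≤⟨ ℤ.+-mono-≤ (∑ᶻ-mono-∈ Ks (λ k∈ → diagonal-≤ k∈)) (i≤∣i∣ off) ⟩
        ∑ᶻ Ks (λ _ → + (a * (4 * sq a))) ℤ.+ + ℤ.∣ off ∣
          ≡⟨ cong (λ i → i ℤ.+ + ℤ.∣ off ∣) constant ⟩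
        + (m * (a * (4 * sq a))) ℤ.+ + ℤ.∣ off ∣
          ≡⟨ ℤ.pos-+ (m * (a * (4 * sq a))) ℤ.∣ off ∣ ⟨
        + (m * (a * (4 * sq a)) + ℤ.∣ off ∣)
          ∎

-- Total boundedness of translates

κ : ℕ → ℕ → ℕ
κ n zero    = 0
κ n (suc m) = suc (suc n * suc (suc n * κ n m))

-- When the colour approximates an inner product, the differences of the pairs found here are almost orthogonal.
end-homogeneous : ∀ {X : Set} {Bad : X → X → Set} (c : X → X → ℕ) n → (∀ t u → c t u ≤ n) →
  ∀ m L → κ n m ≤ length L → AllPairs Bad L → ∃[ Ks ] (length Ks ≡ m ×
    All (λ (t , t′) → t ∈ L × t′ ∈ L × Bad t t′) Ks ×
    AllPairs (λ (t , t′) (u , u′) → c t u ≡ c t u′ × c t′ u ≡ c t′ u′) Ks)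
end-homogeneous c n c≤n zero L _ _ = [] , refl , [] , []
end-homogeneous {X} {Bad} c n c≤n (suc m) (t ∷ L) (s≤s long) (bad ∷ bads)
  with pigeonhole-colour (c t) n L (λ {u} _ → c≤n t u)
... | j , many = second (filter (λ u → c t u ≟ j) L)
  (λ u∈ → ∈-filter⁻ (λ u → c t u ≟ j) {xs = L} u∈)
  (AllPairs.filter⁺ (λ u → c t u ≟ j) bads)
  (*-cancelˡ-≤ (suc n) (≤-trans long many))
  where
  second : ∀ M → (∀ {u} → u ∈ M → u ∈ L × c t u ≡ j) → AllPairs Bad M → suc (suc n * κ n m) ≤ length M → _
  second (t′ ∷ M) within (bad′ ∷ bads′) (s≤s long′) with pigeonhole-colour (c t′) n M (λ {u} _ → c≤n t′ u)
  ... | j′ , many′ with end-homogeneous {Bad = Bad} c n c≤n m (filter (λ u → c t′ u ≟ j′) M)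
        (*-cancelˡ-≤ (suc n) (≤-trans long′ many′)) (AllPairs.filter⁺ (λ u → c t′ u ≟ j′) bads′)
  ...   | Ks , lengthKs , inKs , pairs = (t , t′) ∷ Ks , cong suc lengthKs
        , (here refl , there (proj₁ (within (here refl))) , All.lookup bad (proj₁ (within (here refl))))
          ∷ All.map (λ (u∈ , u′∈ , b) → there (proj₁ (inside u∈)) , there (proj₁ (inside u′∈)) , b) inKs
        , All.map (λ (u∈ , u′∈ , _) → trans (proj₁ (proj₂ (inside u∈))) (sym (proj₁ (proj₂ (inside u′∈))))
                                    , trans (proj₂ (proj₂ (inside u∈))) (sym (proj₂ (proj₂ (inside u′∈))))) inKs
          ∷ pairs
    where
    inside : ∀ {u} → u ∈ filter (λ u → c t′ u ≟ j′) M → u ∈ L × c t u ≡ j × c t′ u ≡ j′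
    inside u∈ with ∈-filter⁻ (λ u → c t′ u ≟ j′) {xs = M} u∈
    ... | u∈M , eq′ with within (there u∈M)
    ...   | u∈L , eq = u∈L , eq , eq′

maximal-separated : ∀ {X : Set} {Close : X → X → Set} (close? : ∀ x y → Dec (Close x y)) (L : List X) →
  (∀ x → Close x x) → ∃[ C ] (AllPairs (λ x y → ¬ Close x y) C × (∀ {x} → x ∈ C → x ∈ L) ×
    (∀ {x} → x ∈ L → ∃[ y ] (y ∈ C × Close x y)))
maximal-separated close? [] _ = [] , [] , (λ ()) , λ ()
maximal-separated close? (x ∷ L) close-refl with maximal-separated close? L close-refl
... | C , separated , C⊆L , cover with any? (close? x) C
...   | yes close = C , separated , there ∘ C⊆L , λ
        { (here refl) → find close
        ; (there y∈L) → cover y∈L }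
...   | no apart = x ∷ C , All.¬Any⇒All¬ C apart ∷ separated , (λ { (here refl) → here refl ; (there y∈) → there (C⊆L y∈) }) , λ
        { (here refl) → x , here refl , close-refl x
        ; (there y∈L) → let (y , y∈C , close) = cover y∈L in y , there y∈C , close }

∣x-y∣≤ : ∀ {x y d} → x ≤ y + d → y ≤ x + d → ℤ.∣ + x ℤ.- + y ∣ ≤ d
∣x-y∣≤ {x} {y} {d} x≤ y≤ with ≤-total x y
... | inj₁ x≤y with k , refl ← m≤n⇒∃[o]m+o≡n x≤y = subst (_≤ d) (sym eq) (+-cancelˡ-≤ x k d y≤)
  where
  lemma : ∀ i j → i ℤ.- (i ℤ.+ j) ≡ ℤ.- j
  lemma = ℤ-Solver.solve-∀
  eq : ℤ.∣ + x ℤ.- + (x + k) ∣ ≡ k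
  eq = trans (cong ℤ.∣_∣ (trans (cong (λ i → + x ℤ.- i) (ℤ.pos-+ x k)) (lemma (+ x) (+ k)))) (ℤ.∣-i∣≡∣i∣ (+ k))
... | inj₂ y≤x with k , refl ← m≤n⇒∃[o]m+o≡n y≤x = subst (_≤ d) (sym eq) (+-cancelˡ-≤ y k d x≤)
  where
  lemma : ∀ i j → i ℤ.+ j ℤ.- i ≡ j
  lemma = ℤ-Solver.solve-∀
  eq : ℤ.∣ + (y + k) ℤ.- + y ∣ ≡ k
  eq = cong ℤ.∣_∣ (trans (cong (λ i → i ℤ.- + y) (ℤ.pos-+ y k)) (lemma (+ y) (+ k)))

same-quotient : ∀ x y d .⦃ _ : NonZero d ⦄ → x / d ≡ y / d → x ≤ y + d
same-quotient x y d eq = begin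
  x                      ≡⟨ m≡m%n+[m/n]*n x d ⟩
  x % d + x / d * d      ≤⟨ +-mono-≤ (<⇒≤ (m%n<n x d)) (≤-reflexive (cong (_* d) eq)) ⟩
  d + y / d * d          ≤⟨ +-monoʳ-≤ d (m/n*n≤m y d) ⟩
  d + y                  ≡⟨ +-comm d y ⟩
  y + d                  ∎
  where open ≤-Reasoning

abstract
  capacity : ℕ → ℕ → ℕ
  capacity C E = κ (2 * suc (80 * sq E * C)) (suc (80 * sq E * C))

module Compactness (𝒮 : SidonSystem) where

  open Correlation 𝒮 public

  inner-AllPairs : ∀ {H t t′ u u′} .⦃ _ : NonZero (sq a) ⦄ →
    H * γ t u / sq a ≡ H * γ t u′ / sq a × H * γ t′ u / sq a ≡ H * γ t′ u′ / sq a →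
    sq H * sq ℤ.∣ inner (t , t′) (u , u′) ∣ ≤ 4 * sq (sq a)
  inner-AllPairs {H} {t} {t′} {u} {u′} (eq , eq′) = begin
    sq H * sq ℤ.∣ inner (t , t′) (u , u′) ∣
      ≡⟨ square-* H ℤ.∣ inner (t , t′) (u , u′) ∣ ⟩
    sq (H * ℤ.∣ inner (t , t′) (u , u′) ∣)
      ≤⟨ *-mono-≤ bound bound ⟩
    sq (sq a + sq a)
      ≡⟨ lemma (sq a) ⟩
    4 * sq (sq a)
      ∎
    where
    open ≤-Reasoning
    square-* : ∀ x y → x * x * (y * y) ≡ x * y * (x * y)
    square-* = solve-∀
    lemma : ∀ x → (x + x) * (x + x) ≡ 4 * (x * x)
    lemma = solve-∀
    near : ∀ x y → H * x / sq a ≡ H * y / sq a → H * ℤ.∣ + x ℤ.- + y ∣ ≤ sq a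
    near x y eq = subst (_≤ sq a) scaled
      (∣x-y∣≤ (same-quotient (H * x) (H * y) (sq a) eq) (same-quotient (H * y) (H * x) (sq a) (sym eq)))
      where
      distribute : ∀ h x y → h ℤ.* x ℤ.- h ℤ.* y ≡ h ℤ.* (x ℤ.- y)
      distribute = ℤ-Solver.solve-∀
      scaled : ℤ.∣ + (H * x) ℤ.- + (H * y) ∣ ≡ H * ℤ.∣ + x ℤ.- + y ∣
      scaled = trans (cong ℤ.∣_∣ (trans (cong₂ ℤ._-_ (ℤ.pos-* H x) (ℤ.pos-* H y)) (distribute (+ H) (+ x) (+ y))))
        (ℤ.abs-* (+ H) (+ x ℤ.- + y))
    bound : H * ℤ.∣ inner (t , t′) (u , u′) ∣ ≤ sq a + sq a
    bound = begin
      H * ℤ.∣ inner (t , t′) (u , u′) ∣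
        ≡⟨ cong (λ i → H * ℤ.∣ i ∣) (inner-γ t t′ u u′) ⟩
      H * ℤ.∣ (+ γ t u ℤ.- + γ t u′) ℤ.- (+ γ t′ u ℤ.- + γ t′ u′) ∣
        ≤⟨ *-monoʳ-≤ H (ℤ.∣i-j∣≤∣i∣+∣j∣ (+ γ t u ℤ.- + γ t u′) (+ γ t′ u ℤ.- + γ t′ u′)) ⟩
      H * (ℤ.∣ + γ t u ℤ.- + γ t u′ ∣ + ℤ.∣ + γ t′ u ℤ.- + γ t′ u′ ∣)
        ≡⟨ *-distribˡ-+ H ℤ.∣ + γ t u ℤ.- + γ t u′ ∣ ℤ.∣ + γ t′ u ℤ.- + γ t′ u′ ∣ ⟩
      H * ℤ.∣ + γ t u ℤ.- + γ t u′ ∣ + H * ℤ.∣ + γ t′ u ℤ.- + γ t′ u′ ∣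
        ≤⟨ +-mono-≤ (near (γ t u) (γ t u′) eq) (near (γ t′ u) (γ t′ u′) eq′) ⟩
      sq a + sq a
        ∎

  Close : ℕ → ℤ → ℤ → Set
  Close E t t′ = E * V (t , t′) ≤ sq (sq a)

  private
    arithmetic : ∀ {m E C N o v} → 1 ≤ a → 1 ≤ m → 8 * E ≤ a → ρ ≤ C * sq a → m * sq (sq a) ≤ E * v →
      v ≤ m * (a * (4 * sq a)) + o → sq o ≤ sq a * ρ * N → N ≤ 20 * m * sq (sq a) → m ≤ 80 * sq E * C
    arithmetic {m} {E} {C} {N} {o} {v} 1≤a 1≤m 8E≤a ρ≤ m≤ v≤ o≤ N≤ = *-cancelʳ-≤ m (80 * sq E * C) X ⦃ X≢0 ⦄ (begin
      m * X
        ≡⟨ lemma₁ m (sq (sq a)) ⟩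
      sq (m * sq (sq a))
        ≤⟨ *-mono-≤ m≤2Eo m≤2Eo ⟩
      sq (2 * (E * o))
        ≡⟨ lemma₂ E o ⟩
      4 * sq E * sq o
        ≤⟨ *-monoʳ-≤ (4 * sq E) (≤-trans o≤ (*-mono-≤ (*-monoʳ-≤ (sq a) ρ≤) N≤)) ⟩
      4 * sq E * (sq a * (C * sq a) * (20 * m * sq (sq a)))
        ≡⟨ lemma₃ (sq E) C m (sq a) ⟩
      80 * sq E * C * X
        ∎)
      where
      open ≤-Reasoning
      X = m * (sq (sq a) * sq (sq a))
      X≢0 : NonZero X
      X≢0 = >-nonZero (*-mono-≤ 1≤m (*-mono-≤ a⁴ a⁴))
        where
        a⁴ : 1 ≤ sq (sq a)
        a⁴ = *-mono-≤ (*-mono-≤ 1≤a 1≤a) (*-mono-≤ 1≤a 1≤a)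
      lemma₁ : ∀ m x → m * (m * (x * x)) ≡ m * x * (m * x)
      lemma₁ = solve-∀
      lemma₂ : ∀ E o → 2 * (E * o) * (2 * (E * o)) ≡ 4 * (E * E) * (o * o)
      lemma₂ = solve-∀
      lemma₃ : ∀ e c m x → 4 * e * (x * (c * x) * (20 * m * (x * x))) ≡ 80 * e * c * (m * (x * x * (x * x)))
      lemma₃ = solve-∀
      lemma₄ : ∀ E m a o → 2 * (E * (m * (a * (4 * (a * a))) + o)) ≡ 8 * E * (m * (a * (a * a))) + 2 * (E * o)
      lemma₄ = solve-∀
      lemma₅ : ∀ m a → a * (m * (a * (a * a))) ≡ m * (a * a * (a * a))
      lemma₅ = solve-∀
      m≤2Eo : m * sq (sq a) ≤ 2 * (E * o)
      m≤2Eo = +-cancelˡ-≤ (m * sq (sq a)) _ _ (begin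
        m * sq (sq a) + m * sq (sq a)
          ≡⟨ cong (λ s → m * sq (sq a) + s) (+-identityʳ (m * sq (sq a))) ⟨
        2 * (m * sq (sq a))                           ≤⟨ *-monoʳ-≤ 2 (≤-trans m≤ (*-monoʳ-≤ E v≤)) ⟩
        2 * (E * (m * (a * (4 * sq a)) + o))          ≡⟨ lemma₄ E m a o ⟩
        8 * E * (m * (a * sq a)) + 2 * (E * o)
          ≤⟨ +-monoˡ-≤ (2 * (E * o)) (*-monoˡ-≤ (m * (a * sq a)) 8E≤a) ⟩
        a * (m * (a * sq a)) + 2 * (E * o)            ≡⟨ cong (_+ 2 * (E * o)) (lemma₅ m a) ⟩
        m * sq (sq a) + 2 * (E * o)                   ∎)

  separated-length-< : ∀ {C E} m → 80 * sq E * C < m → ρ ≤ C * sq a → 1 ≤ a → 8 * E ≤ a → ∀ L →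
    (∀ {t} → t ∈ L → ℤ.∣ t ∣ ≤ P) → AllPairs (λ t t′ → ¬ Close E t t′) L → length L < κ (2 * m) m
  separated-length-< {C} {E} m <m ρ≤ 1≤a 8E≤a L short separated with κ (2 * m) m ≤? length L
  ... | no ¬long = ≰⇒> ¬long
  ... | yes long = contradiction (arithmetic {m} {E} {C} {N} {proj₁ bound} {∑ Ks V} 1≤a (≤-trans (s≤s z≤n) <m) 8E≤a ρ≤ m≤
          (proj₁ (proj₂ bound)) (proj₂ (proj₂ bound)) N≤) (<⇒≱ <m)
    where
    open ≤-Reasoning
    instance
      a²≢0 : NonZero (sq a)
      a²≢0 = >-nonZero (*-mono-≤ 1≤a 1≤a)
      m≢0 : NonZero m
      m≢0 = >-nonZero (≤-trans (s≤s z≤n) <m)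
      m²≢0 : NonZero (sq m)
      m²≢0 = m*n≢0 m m
    colour : ℤ → ℤ → ℕ
    colour t u = m * γ t u / sq a
    colour-≤ : ∀ t u → colour t u ≤ 2 * m
    colour-≤ t u = begin
      m * γ t u / sq a            ≤⟨ /-monoˡ-≤ (sq a) (*-monoʳ-≤ m (γ-≤ t u)) ⟩
      m * (2 * sq a) / sq a       ≡⟨ cong (_/ sq a) (lemma m (sq a)) ⟩
      2 * m * sq a / sq a         ≡⟨ m*n/n≡m (2 * m) (sq a) ⟩
      2 * m                       ∎
      where
      lemma : ∀ m x → m * (2 * x) ≡ 2 * m * x
      lemma = solve-∀
    extracted = end-homogeneous colour (2 * m) colour-≤ m L long separated
    Ks = proj₁ extracted
    lengthKs : length Ks ≡ m
    lengthKs = proj₁ (proj₂ extracted)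
    inKs = proj₁ (proj₂ (proj₂ extracted))
    shortKs : ∀ {k} → k ∈ Ks → Short k
    shortKs k∈ = short (proj₁ (All.lookup inKs k∈)) , short (proj₁ (proj₂ (All.lookup inKs k∈)))
    N : ℕ
    N = ∑ Ks (λ k → ∑ Ks (λ l → sq ℤ.∣ inner k l ∣))
    bound : ∃[ o ] (∑ Ks V ≤ m * (a * (4 * sq a)) + o × sq o ≤ sq a * ρ * N)
    bound = subst (λ n → ∃[ o ] (∑ Ks V ≤ n * (a * (4 * sq a)) + o × sq o ≤ sq a * ρ * N)) lengthKs (∑V-≤ Ks shortKs)
    m≤ : m * sq (sq a) ≤ E * ∑ Ks V
    m≤ = begin
      m * sq (sq a)                ≡⟨ cong (_* sq (sq a)) lengthKs ⟨
      length Ks * sq (sq a)        ≡⟨ ∑-const Ks (sq (sq a)) ⟨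
      ∑ Ks (λ _ → sq (sq a))       ≤⟨ ∑-mono-∈ Ks (λ k∈ → <⇒≤ (≰⇒> (proj₂ (proj₂ (All.lookup inKs k∈))))) ⟩
      ∑ Ks (λ k → E * V k)         ≡⟨ ∑-*ˡ Ks E V ⟩
      E * ∑ Ks V                   ∎
    N≤ : N ≤ 20 * m * sq (sq a)
    N≤ = *-cancelˡ-≤ (sq m) (begin
      sq m * N
        ≡⟨ trans (∑-cong Ks (λ k → ∑-*ˡ Ks (sq m) (λ l → sq ℤ.∣ inner k l ∣)))
                 (∑-*ˡ Ks (sq m) (λ k → ∑ Ks (λ l → sq ℤ.∣ inner k l ∣))) ⟨
      ∑ Ks (λ k → ∑ Ks (λ l → sq m * sq ℤ.∣ inner k l ∣))
        ≤⟨ ∑∑-AllPairs-≤ (λ k l → sq m * sq ℤ.∣ inner k l ∣)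
             (λ k l → cong (λ i → sq m * sq ℤ.∣ i ∣) (inner-comm k l))
             (λ {k} _ → *-monoʳ-≤ (sq m) (inner-≤ k k))
             (AllPairs.map (inner-AllPairs {m}) (proj₂ (proj₂ (proj₂ extracted)))) ⟩
      length Ks * (sq m * (16 * sq (sq a))) + sq (length Ks) * (4 * sq (sq a))
        ≡⟨ cong (λ l → l * (sq m * (16 * sq (sq a))) + sq l * (4 * sq (sq a))) lengthKs ⟩
      m * (sq m * (16 * sq (sq a))) + sq m * (4 * sq (sq a))
        ≤⟨ +-monoʳ-≤ (m * (sq m * (16 * sq (sq a)))) (m≤m*n (sq m * (4 * sq (sq a))) m) ⟩
      m * (sq m * (16 * sq (sq a))) + sq m * (4 * sq (sq a)) * m
        ≡⟨ lemma m (sq (sq a)) ⟩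
      sq m * (20 * m * sq (sq a))
        ∎)
      where
      lemma : ∀ m x → m * (m * m * (16 * x)) + m * m * (4 * x) * m ≡ m * m * (20 * m * x)
      lemma = solve-∀

  abstract
    separated-length : ∀ {C E} → ρ ≤ C * sq a → 1 ≤ a → 8 * E ≤ a → ∀ L →
      (∀ {t} → t ∈ L → ℤ.∣ t ∣ ≤ P) → AllPairs (λ t t′ → ¬ Close E t t′) L → length L < capacity C E
    separated-length {C} {E} = separated-length-< {C} {E} (suc (80 * sq E * C)) ≤-refl

-- Almost periods

module AlmostPeriods (𝒮 : SidonSystem) where

  open Compactness 𝒮 public

  -- E is an inverse scale: the error allowed is (c / E) a³.
  record AP (c E : ℕ) (t : ℤ) : Set where
    constructor almost-period
    field bound : ∀ m → E * ℤ.∣ + solutions (m ℤ.+ t) ℤ.- + solutions m ∣ ≤ c * (a * sq a)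
  open AP

  AP-weaken : ∀ {c c′ E E′ t} → c ≤ c′ → E ≤ E′ → AP c E′ t → AP c′ E t
  AP-weaken c≤c′ E≤E′ ap = almost-period λ m → ≤-trans (*-monoˡ-≤ _ E≤E′) (≤-trans (bound ap m) (*-monoˡ-≤ (a * sq a) c≤c′))

  AP-reduce : ∀ c .⦃ _ : NonZero c ⦄ {E t} → AP c (c * E) t → AP 1 E t
  AP-reduce c {E} {t} ap = almost-period λ m → *-cancelˡ-≤ c (≤-trans (≤-reflexive (sym (*-assoc c E _)))
    (≤-trans (bound ap m) (≤-reflexive (cong (c *_) (sym (*-identityˡ (a * sq a)))))))

  AP-+ : ∀ {c d E t u} → AP c E t → AP d E u → AP (c + d) E (t ℤ.+ u)
  AP-+ {c} {d} {E} {t} {u} apt apu = almost-period bounded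
    where
    open ≤-Reasoning
    telescope : ∀ x y z → x ℤ.- z ≡ (y ℤ.- z) ℤ.+ (x ℤ.- y)
    telescope = ℤ-Solver.solve-∀
    bounded : ∀ m → E * ℤ.∣ + solutions (m ℤ.+ (t ℤ.+ u)) ℤ.- + solutions m ∣ ≤ (c + d) * (a * sq a)
    bounded m = begin
      E * ℤ.∣ + s₂ ℤ.- + s₀ ∣
        ≡⟨ cong (λ i → E * ℤ.∣ i ∣) (telescope (+ s₂) (+ s₁) (+ s₀)) ⟩
      E * ℤ.∣ (+ s₁ ℤ.- + s₀) ℤ.+ (+ s₂ ℤ.- + s₁) ∣
        ≤⟨ *-monoʳ-≤ E (ℤ.∣i+j∣≤∣i∣+∣j∣ (+ s₁ ℤ.- + s₀) (+ s₂ ℤ.- + s₁)) ⟩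
      E * (ℤ.∣ + s₁ ℤ.- + s₀ ∣ + ℤ.∣ + s₂ ℤ.- + s₁ ∣)
        ≡⟨ *-distribˡ-+ E _ _ ⟩
      E * ℤ.∣ + s₁ ℤ.- + s₀ ∣ + E * ℤ.∣ + s₂ ℤ.- + s₁ ∣
        ≤⟨ +-mono-≤ (bound apt m) (subst (λ i → E * ℤ.∣ + solutions i ℤ.- + s₁ ∣ ≤ d * (a * sq a))
             (ℤ.+-assoc m t u) (bound apu (m ℤ.+ t))) ⟩
      c * (a * sq a) + d * (a * sq a)
        ≡⟨ *-distribʳ-+ (a * sq a) c d ⟨
      (c + d) * (a * sq a)
        ∎
      where
      s₀ = solutions m
      s₁ = solutions (m ℤ.+ t)
      s₂ = solutions (m ℤ.+ (t ℤ.+ u))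

  AP-neg : ∀ {c E t} → AP c E t → AP c E (ℤ.- t)
  AP-neg {c} {E} {t} ap = almost-period λ m → subst (λ n → E * n ≤ c * (a * sq a)) (eq m) (bound ap (m ℤ.- t))
    where
    lemma : ∀ m t → m ℤ.- t ℤ.+ t ≡ m
    lemma = ℤ-Solver.solve-∀
    eq : ∀ m → ℤ.∣ + solutions (m ℤ.- t ℤ.+ t) ℤ.- + solutions (m ℤ.- t) ∣ ≡ ℤ.∣ + solutions (m ℤ.- t) ℤ.- + solutions m ∣
    eq m = trans (cong (λ i → ℤ.∣ + solutions i ℤ.- + solutions (m ℤ.- t) ∣) (lemma m t))
      (ℤ.∣i-j∣≡∣j-i∣ (+ solutions m) (+ solutions (m ℤ.- t)))

  AP-* : ∀ {c E t} b → AP c E t → AP (b * c) E (+ b ℤ.* t)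
  AP-* {c} {E} {t} zero    ap = almost-period λ m → ≤-reflexive (trans (cong (E *_) (eq m)) (*-zeroʳ E))
    where
    lemma : ∀ m t → m ℤ.+ + 0 ℤ.* t ≡ m
    lemma = ℤ-Solver.solve-∀
    eq : ∀ m → ℤ.∣ + solutions (m ℤ.+ + 0 ℤ.* t) ℤ.- + solutions m ∣ ≡ 0
    eq m = cong ℤ.∣_∣ (ℤ.i≡j⇒i-j≡0 (cong (λ i → + solutions i) (lemma m t)))
  AP-* {c} {E} {t} (suc b) ap = subst (AP (c + b * c) E) (sym (ℤ.suc-* (+ b) t)) (AP-+ ap (AP-* b ap))

  close⇒AP : ∀ {E t t′} → Short (t , t′) → Close (2 * sq E) t t′ → AP 1 E (t ℤ.- t′)
  close⇒AP {E} {t} {t′} short close = almost-period λ m → ≤-trans (square-square (begin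
    sq (E * D m)
      ≡⟨ lemma₁ E (D m) ⟩
    sq E * sq (D m)
      ≤⟨ *-monoʳ-≤ (sq E) (subst (λ d → sq d ≤ 2 * sq a * V (t , t′)) (D≡ m) (solutions-shift-≤ short (m ℤ.- t′))) ⟩
    sq E * (2 * sq a * V (t , t′))
      ≡⟨ lemma₂ (sq E) (sq a) (V (t , t′)) ⟩
    sq a * (2 * sq E * V (t , t′))
      ≤⟨ *-monoʳ-≤ (sq a) close ⟩
    sq a * sq (sq a)
      ≡⟨ lemma₃ a ⟩
    sq (a * sq a)
      ∎)) (≤-reflexive (sym (*-identityˡ (a * sq a))))
    where
    open ≤-Reasoning
    D : ℤ → ℕ
    D m = ℤ.∣ + solutions (m ℤ.+ (t ℤ.- t′)) ℤ.- + solutions m ∣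
    shift₁ : ∀ m t t′ → m ℤ.- t′ ℤ.+ t ≡ m ℤ.+ (t ℤ.- t′)
    shift₁ = ℤ-Solver.solve-∀
    shift₂ : ∀ m t′ → m ℤ.- t′ ℤ.+ t′ ≡ m
    shift₂ = ℤ-Solver.solve-∀
    D≡ : ∀ m → ℤ.∣ + solutions (m ℤ.- t′ ℤ.+ t) ℤ.- + solutions (m ℤ.- t′ ℤ.+ t′) ∣ ≡ D m
    D≡ m = cong₂ (λ i j → ℤ.∣ + solutions i ℤ.- + solutions j ∣) (shift₁ m t t′) (shift₂ m t′)
    lemma₁ : ∀ x y → x * y * (x * y) ≡ x * x * (y * y)
    lemma₁ = solve-∀
    lemma₂ : ∀ e x v → e * (2 * x * v) ≡ x * (2 * e * v)
    lemma₂ = solve-∀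
    lemma₃ : ∀ x → x * x * (x * x * (x * x)) ≡ x * (x * x) * (x * (x * x))
    lemma₃ = solve-∀

  close-refl : ∀ E t → Close E t t
  close-refl E t = ≤-trans (≤-reflexive (trans (cong (E *_) V≡0) (*-zeroʳ E))) z≤n
    where
    V≡0 : V (t , t) ≡ 0
    V≡0 = trans (∑-cong R (λ u → cong (λ i → sq ℤ.∣ i ∣) (∑ᶻ≡0 A (λ {z} _ → ℤ.+-inverseʳ (+ q (u ℤ.- σ ℤ.* z ℤ.+ t)))))) (∑-0 R)

  ManyAlmostPeriods : ℕ → ℕ → ℕ → Set
  ManyAlmostPeriods K E W =
    ∃[ T ] (Unique T × (∀ {t} → t ∈ T → ℤ.∣ t ∣ ≤ W × AP 1 E t) × W ≤ K * length T)

  almost-periods : ∀ {C E} W → ρ ≤ C * sq a → 1 ≤ a → 8 * (2 * sq E) ≤ a → W ≤ P →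
    ManyAlmostPeriods (capacity C (2 * sq E)) E W
  almost-periods zero _ _ _ _ = [] , [] , (λ ()) , z≤n
  almost-periods {C} {E} (suc W) ρ≤ 1≤a E≤a W≤P = result separated
    where
    E′ : ℕ
    E′ = 2 * sq E
    L : List ℤ
    L = map (λ i → + i) (upTo (suc W))
    close? : ∀ t t′ → Dec (Close E′ t t′)
    close? t t′ = E′ * V (t , t′) ≤? sq (sq a)
    separated = maximal-separated close? L (close-refl E′)
    in-range : ∀ {t} → t ∈ L → ∃[ i ] (t ≡ + i × i ≤ suc W)
    in-range t∈ with ∈-map⁻ (λ i → + i) t∈
    ... | i , i∈ , t≡ = i , t≡ , <⇒≤ (∈-upTo⁻ i∈)
    short : ∀ {t} → t ∈ L → ℤ.∣ t ∣ ≤ P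
    short t∈ with in-range t∈
    ... | i , refl , i≤ = ≤-trans i≤ W≤P
    length-L : length L ≡ suc W
    length-L = trans (length-map (λ i → + i) (upTo (suc W))) (length-upTo (suc W))
    result : ∃[ Cs ] (AllPairs (λ x y → ¬ Close E′ x y) Cs × (∀ {x} → x ∈ Cs → x ∈ L) ×
      (∀ {x} → x ∈ L → ∃[ y ] (y ∈ Cs × Close E′ x y))) → ManyAlmostPeriods (capacity C E′) E (suc W)
    result ([] , _ , _ , cover) with cover (∈-map⁺ (λ i → + i) (∈-upTo⁺ (s≤s z≤n)))
    ... | _ , () , _
    result (y ∷ Cs , apart , Cs⊆L , cover) with pigeonhole (λ z x → close? x z) y Cs L cover
    ... | t₀ , t₀∈ , many = map (ℤ._- t₀) T₀
      , Unique.map⁺ (shift-injective (ℤ.- t₀)) (Unique.filter⁺ (λ x → close? x t₀) (Unique.map⁺ ℤ.+-injective (Unique.upTo⁺ (suc W))))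
      , properties
      , (begin
        suc W                                               ≡⟨ length-L ⟨
        length L                                            ≤⟨ many ⟩
        length (y ∷ Cs) * length T₀
          ≤⟨ *-monoˡ-≤ (length T₀) (<⇒≤ (separated-length ρ≤ 1≤a E≤a (y ∷ Cs) (short ∘ Cs⊆L) apart)) ⟩
        capacity C E′ * length T₀                           ≡⟨ cong (capacity C E′ *_) (length-map (ℤ._- t₀) T₀) ⟨
        capacity C E′ * length (map (ℤ._- t₀) T₀)           ∎)
      where
      open ≤-Reasoning
      T₀ = filter (λ x → close? x t₀) L
      properties : ∀ {t} → t ∈ map (ℤ._- t₀) T₀ → ℤ.∣ t ∣ ≤ suc W × AP 1 E t
      properties t∈ with ∈-map⁻ (ℤ._- t₀) t∈
      ... | u , u∈T₀ , refl = bounded , close⇒AP {E} (short u∈L , short (Cs⊆L t₀∈)) (proj₂ (∈-filter⁻ (λ x → close? x t₀) {xs = L} u∈T₀))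
        where
        u∈L = proj₁ (∈-filter⁻ (λ x → close? x t₀) {xs = L} u∈T₀)
        bounded : ℤ.∣ u ℤ.- t₀ ∣ ≤ suc W
        bounded with in-range u∈L | in-range (Cs⊆L t₀∈)
        ... | i , refl , i≤ | j , eq , j≤ = subst (λ v → ℤ.∣ + i ℤ.- v ∣ ≤ suc W) (sym eq)
          (∣x-y∣≤ (≤-trans i≤ (m≤n+m _ j)) (≤-trans j≤ (m≤n+m _ i)))

-- Energy decrement

parallelogram : ∀ x y → sq (x + y) + sq ∣ x - y ∣ ≡ 2 * sq x + 2 * sq y
parallelogram x y with ≤-total x y
... | inj₁ x≤y with k , refl ← m≤n⇒∃[o]m+o≡n x≤y =
  trans (cong (λ d → sq (x + (x + k)) + sq d) (∣m-m+n∣≡n x k)) (lemma x k)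
  where
  lemma : ∀ x k → (x + (x + k)) * (x + (x + k)) + k * k ≡ 2 * (x * x) + 2 * ((x + k) * (x + k))
  lemma = solve-∀
... | inj₂ y≤x with k , refl ← m≤n⇒∃[o]m+o≡n y≤x =
  trans (cong (λ d → sq (y + k + y) + sq d) (∣m+n-m∣≡n y k)) (lemma y k)
  where
  ∣m+n-m∣≡n : ∀ m n → ∣ m + n - m ∣ ≡ n
  ∣m+n-m∣≡n m n = trans (∣-∣-comm (m + n) m) (∣m-m+n∣≡n m n)
  lemma : ∀ y k → (y + k + y) * (y + k + y) + k * k ≡ 2 * ((y + k) * (y + k)) + 2 * (y * y)
  lemma = solve-∀

module Smoothing (𝒮 : SidonSystem) where

  open AlmostPeriods 𝒮 public

  χ : ℤ → ℕ
  χ y = ∑ A (λ z → δ z y)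

  χ-≤1 : ∀ y → χ y ≤ 1
  χ-≤1 y = ∑-atMostOne uniqueA (λ z → δ-≤1 z y) (λ _ _ p q → trans (δ≢0⇒≡ p) (sym (δ≢0⇒≡ q)))

  χ-∉ : ∀ {y} → (∀ {z} → z ∈ A → z ≢ y) → χ y ≡ 0
  χ-∉ y∉A = trans (∑-cong-∈ A (λ z∈ → δ-≢ (y∉A z∈))) (∑-0 A)

  χ≢0⇒∈ : ∀ {y} → χ y ≢ 0 → y ∈ A
  χ≢0⇒∈ {y} χ≢0 with any? (y ℤ.≟_) A
  ... | yes y∈A = y∈A
  ... | no  y∉A = contradiction (χ-∉ (λ z∈ z≡y → y∉A (lose z∈ (sym z≡y)))) χ≢0

  F : List ℤ → ℤ → ℕ
  F ν x = ∑ ν (λ t → χ (x ℤ.+ t))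

  F-translate : ∀ ν d x → F (map (ℤ._+ d) ν) x ≡ F ν (x ℤ.+ d)
  F-translate ν d x = trans (∑-map (ℤ._+ d) ν (λ t → χ (x ℤ.+ t))) (∑-cong ν (λ t → cong χ (lemma x t d)))
    where
    lemma : ∀ x t d → x ℤ.+ (t ℤ.+ d) ≡ x ℤ.+ d ℤ.+ t
    lemma = ℤ-Solver.solve-∀

  module Window (B : ℕ) where

    I : List ℤ
    I = interval B

    Supported : List ℤ → Set
    Supported ν = ∀ {t} → t ∈ ν → P + ℤ.∣ t ∣ ≤ B

    energy : List ℤ → ℕ
    energy ν = ∑ I (λ x → sq (F ν x))

    variation : List ℤ → ℤ → ℕ
    variation ν d = ∑ I (λ x → sq ∣ F ν x - F ν (x ℤ.+ d) ∣)

    F-cover : ∀ {ν} → Supported ν → ∀ y → F ν y ≡ 0 ⊎ y ∈ I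
    F-cover {ν} supported y with ℤ.∣ y ∣ ≤? B
    ... | yes small = inj₂ (∈-interval small)
    ... | no ¬small = inj₁ (trans (∑-cong-∈ ν (λ {t} t∈ → χ-∉ (λ z∈ z≡ → ¬small
      (≤-trans (∣v∣≤∣v+t∣+∣t∣ y t) (≤-trans (+-monoˡ-≤ ℤ.∣ t ∣ (subst (λ u → ℤ.∣ u ∣ ≤ P) z≡ (A-bounded z∈))) (supported t∈))))))
      (∑-0 ν))

    energy-step : ∀ {ν} d → Supported ν → energy (ν ++ map (ℤ._+ d) ν) + variation ν d ≤ 4 * energy ν
    energy-step {ν} d supported = begin
      energy (ν ++ map (ℤ._+ d) ν) + variation ν d
        ≡⟨ cong (_+ variation ν d) (∑-cong I (λ x → cong sq (trans (∑-++ ν (map (ℤ._+ d) ν) (λ t → χ (x ℤ.+ t)))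
             (cong (λ s → F ν x + s) (F-translate ν d x))))) ⟩
      ∑ I (λ x → sq (F ν x + F ν (x ℤ.+ d))) + variation ν d
        ≡⟨ ∑-+ I (λ x → sq (F ν x + F ν (x ℤ.+ d))) (λ x → sq ∣ F ν x - F ν (x ℤ.+ d) ∣) ⟨
      ∑ I (λ x → sq (F ν x + F ν (x ℤ.+ d)) + sq ∣ F ν x - F ν (x ℤ.+ d) ∣)
        ≡⟨ ∑-cong I (λ x → parallelogram (F ν x) (F ν (x ℤ.+ d))) ⟩
      ∑ I (λ x → 2 * sq (F ν x) + 2 * sq (F ν (x ℤ.+ d)))
        ≡⟨ trans (∑-+ I (λ x → 2 * sq (F ν x)) (λ x → 2 * sq (F ν (x ℤ.+ d))))
             (cong₂ _+_ (∑-*ˡ I 2 (λ x → sq (F ν x))) (∑-*ˡ I 2 (λ x → sq (F ν (x ℤ.+ d))))) ⟩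
      2 * energy ν + 2 * ∑ I (λ x → sq (F ν (x ℤ.+ d)))
        ≤⟨ +-monoʳ-≤ (2 * energy ν) (*-monoʳ-≤ 2 (∑-injective-≤ (ℤ._+ d) (λ x → sq (F ν x)) (interval-! B)
             (λ _ _ → shift-injective d) (λ {x} _ → cover (x ℤ.+ d)))) ⟩
      2 * energy ν + 2 * energy ν
        ≡⟨ lemma (energy ν) ⟩
      4 * energy ν
        ∎
      where
      open ≤-Reasoning
      cover : ∀ y → sq (F ν y) ≡ 0 ⊎ y ∈ I
      cover y with F-cover supported y
      ... | inj₁ F≡0 = inj₁ (cong sq F≡0)
      ... | inj₂ y∈I = inj₂ y∈I
      lemma : ∀ x → 2 * x + 2 * x ≡ 4 * x
      lemma = solve-∀

    mass : ∀ {ν} → Supported ν → ∑ I (F ν) ≡ a * length ν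
    mass {ν} supported = begin
      ∑ I (λ x → ∑ ν (λ t → ∑ A (λ z → δ z (x ℤ.+ t))))
        ≡⟨ ∑-swap I ν _ ⟩
      ∑ ν (λ t → ∑ I (λ x → ∑ A (λ z → δ z (x ℤ.+ t))))
        ≡⟨ ∑-cong ν (λ t → ∑-swap I A _) ⟩
      ∑ ν (λ t → ∑ A (λ z → ∑ I (λ x → δ z (x ℤ.+ t))))
        ≡⟨ ∑-cong-∈ ν (λ t∈ → ∑-cong-∈ A (λ z∈ → one t∈ z∈)) ⟩
      ∑ ν (λ t → ∑ A (λ z → 1))
        ≡⟨ trans (∑-const ν (∑ A (λ z → 1))) (cong (length ν *_) (trans (∑-const A 1) (*-identityʳ a))) ⟩
      length ν * a
        ≡⟨ *-comm (length ν) a ⟩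
      a * length ν
        ∎
      where
      open ≡-Reasoning
      lemma₁ : ∀ z x t → z ℤ.- t ℤ.- x ≡ z ℤ.- (x ℤ.+ t)
      lemma₁ = ℤ-Solver.solve-∀
      lemma₂ : ∀ z x t → z ℤ.- (x ℤ.+ t) ≡ z ℤ.- t ℤ.- x
      lemma₂ = ℤ-Solver.solve-∀
      one : ∀ {t z} → t ∈ ν → z ∈ A → ∑ I (λ x → δ z (x ℤ.+ t)) ≡ 1
      one {t} {z} t∈ z∈ = trans (∑-cong I (λ x → δ-cong {z} {x ℤ.+ t} {z ℤ.- t} {x} (λ eq → ≡-from eq (lemma₁ z x t)) (λ eq → ≡-from eq (lemma₂ z x t))))
        (∑-δ-∈ (interval-! B) (∈-interval (≤-trans (ℤ.∣i-j∣≤∣i∣+∣j∣ z t)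
          (≤-trans (+-monoˡ-≤ ℤ.∣ t ∣ (A-bounded z∈)) (supported t∈)))))

    initial-energy : ∀ {ν} → Unique ν → a ≤ length ν → energy ν ≤ 2 * sq (length ν)
    initial-energy {ν} uniqueν a≤L = begin
      ∑ I (λ x → sq (F ν x))
        ≡⟨ ∑-cong I (λ x → ∑*∑ ν ν (λ t → χ (x ℤ.+ t)) (λ t → χ (x ℤ.+ t))) ⟩
      ∑ I (λ x → ∑ ν (λ t → ∑ ν (λ t′ → χ (x ℤ.+ t) * χ (x ℤ.+ t′))))
        ≡⟨ trans (∑-swap I ν _) (∑-cong ν (λ t → ∑-swap I ν _)) ⟩
      ∑ ν (λ t → ∑ ν (λ t′ → ∑ I (λ x → χ (x ℤ.+ t) * χ (x ℤ.+ t′))))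
        ≤⟨ ∑-mono ν (λ t → ∑-mono ν (λ t′ → coincidences t t′)) ⟩
      ∑ ν (λ t → ∑ ν (λ t′ → δ t t′ * a + 1))
        ≡⟨ ∑-cong ν (λ t → trans (∑-+ ν (λ t′ → δ t t′ * a) (λ _ → 1)) (cong₂ _+_ (∑-*ʳ ν (δ t) a) (∑-const ν 1))) ⟩
      ∑ ν (λ t → ∑ ν (δ t) * a + length ν * 1)
        ≤⟨ ∑-≤-const ν (1 * a + length ν * 1) (λ {t} _ → +-monoˡ-≤ (length ν * 1) (*-monoˡ-≤ a (∑-δ-≤1 uniqueν t))) ⟩
      length ν * (1 * a + length ν * 1)
        ≤⟨ *-monoʳ-≤ (length ν) (+-monoˡ-≤ (length ν * 1) (*-monoʳ-≤ 1 a≤L)) ⟩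
      length ν * (1 * length ν + length ν * 1)
        ≡⟨ lemma (length ν) ⟩
      2 * sq (length ν)
        ∎
      where
      open ≤-Reasoning
      lemma : ∀ l → l * (1 * l + l * 1) ≡ 2 * (l * l)
      lemma = solve-∀
      coincidences : ∀ t t′ → ∑ I (λ x → χ (x ℤ.+ t) * χ (x ℤ.+ t′)) ≤ δ t t′ * a + 1
      coincidences t t′ with t ℤ.≟ t′
      ... | yes refl = begin
        ∑ I (λ x → χ (x ℤ.+ t) * χ (x ℤ.+ t))
          ≤⟨ ∑-mono I (λ x → ≤-trans (*-monoʳ-≤ (χ (x ℤ.+ t)) (χ-≤1 (x ℤ.+ t))) (≤-reflexive (*-identityʳ _))) ⟩
        ∑ I (λ x → ∑ A (λ z → δ z (x ℤ.+ t)))          ≡⟨ ∑-swap I A _ ⟩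
        ∑ A (λ z → ∑ I (λ x → δ z (x ℤ.+ t)))
          ≤⟨ ∑-≤-const A 1 (λ {z} _ → ∑-atMostOne (interval-! B) (λ x → δ-≤1 z (x ℤ.+ t))
                                                            (λ _ _ p q → shift-injective t (trans (sym (δ≢0⇒≡ p)) (δ≢0⇒≡ q)))) ⟩
        a * 1                                          ≡⟨ trans (*-identityʳ a) (sym (*-identityˡ a)) ⟩
        1 * a                                          ≤⟨ m≤m+n (1 * a) 1 ⟩
        1 * a + 1                                      ∎
      ... | no t≢t′ = ∑-atMostOne (interval-! B) (λ x → *-mono-≤ (χ-≤1 (x ℤ.+ t)) (χ-≤1 (x ℤ.+ t′))) same
        where
        cancel : ∀ t t′ x → t ℤ.- t′ ≡ x ℤ.+ t ℤ.- (x ℤ.+ t′)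
        cancel = ℤ-Solver.solve-∀
        both : ∀ x → χ (x ℤ.+ t) * χ (x ℤ.+ t′) ≢ 0 → x ℤ.+ t ∈ A × x ℤ.+ t′ ∈ A
        both x nz = χ≢0⇒∈ (λ eq → nz (cong (_* χ (x ℤ.+ t′)) eq))
                  , χ≢0⇒∈ (λ eq → nz (trans (cong (χ (x ℤ.+ t) *_) eq) (*-zeroʳ (χ (x ℤ.+ t)))))
        same : ∀ {x y} → x ∈ I → y ∈ I → χ (x ℤ.+ t) * χ (x ℤ.+ t′) ≢ 0 → χ (y ℤ.+ t) * χ (y ℤ.+ t′) ≢ 0 → x ≡ y
        same {x} {y} _ _ nzx nzy = shift-injective t (proj₁ (sidon-difference sidonA
          (proj₁ (both x nzx)) (proj₂ (both x nzx)) (proj₁ (both y nzy)) (proj₂ (both y nzy))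
          (λ eq → t≢t′ (≡-from eq (cancel t t′ x))) (trans (sym (cancel t t′ x)) (cancel t t′ y))))

𝟙 : ∀ {X : Set} → Dec X → ℕ
𝟙 (yes _) = 1
𝟙 (no _)  = 0

module Decrement (𝒮 : SidonSystem) (B M Q : ℕ) (scale : ℕ → ℕ) (D : ℕ → List ℤ) where

  open Smoothing 𝒮 public
  open Window B public

  record Regular : Set where
    field
      ν           : List ℤ
      j           : ℕ
      j<8Q        : j < 8 * Q
      nonempty    : 1 ≤ length ν
      supported   : Supported ν
      energy-≤    : energy ν ≤ 2 * sq (length ν)
      fine        : ∀ {t} → t ∈ ν → AP 1 (scale (suc j)) t
      invariant   : ∀ {d} → d ∈ D j → Q * variation ν d ≤ sq (length ν)

  module _ (scale-≤ : ∀ j → 2 * scale j ≤ scale (suc j))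
           (D-period : ∀ {j d} → j < 8 * Q → d ∈ D j → AP 1 (2 * scale j) d)
           (D-short  : ∀ {j d} → j < 8 * Q → d ∈ D j → ℤ.∣ d ∣ ≤ M) where

    private
      2-1 : ∀ {E t d} → AP 1 (2 * E) t → AP 1 (2 * E) d → AP 1 E (t ℤ.+ d)
      2-1 apt apd = AP-reduce 2 (AP-+ apt apd)

      split : ∀ {ν d t} → t ∈ ν ++ map (ℤ._+ d) ν → t ∈ ν ⊎ ∃[ u ] (u ∈ ν × t ≡ u ℤ.+ d)
      split {ν} {d} t∈ with ∈-++⁻ ν t∈
      ... | inj₁ t∈ν = inj₁ t∈ν
      ... | inj₂ t∈′ with ∈-map⁻ (ℤ._+ d) t∈′
      ...   | u , u∈ , eq = inj₂ (u , u∈ , eq)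

      double-length : ∀ ν d → length (ν ++ map (ℤ._+ d) ν) ≡ 2 * length ν
      double-length ν d = trans (length-++ ν) (cong (λ l → length ν + l) (trans (length-map (ℤ._+ d) ν) (sym (+-identityʳ (length ν)))))

    -- If some shift in D j changes F ν too much, averaging ν with its translate lowers the
    -- normalised energy by 1 / 4Q; this can happen fewer than 8Q times.
    decrement : ∀ j → suc j ≤ 8 * Q → 1 ≤ Q → ∀ ν → 1 ≤ length ν → 4 * Q * energy ν ≤ suc j * sq (length ν) →
      (∀ {t} → t ∈ ν → AP 1 (scale (suc j)) t) → (∀ {t} → t ∈ ν → P + ℤ.∣ t ∣ + suc j * M ≤ B) → Regular
    decrement j j<8Q 1≤Q ν nonempty small fine supported
      with any? (λ d → suc (sq (length ν)) ≤? Q * variation ν d) (D j)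
    ... | no ¬any = record
      { ν = ν ; j = j ; j<8Q = j<8Q ; nonempty = nonempty
      ; supported = λ t∈ → ≤-trans (m≤m+n _ (suc j * M)) (supported t∈)
      ; energy-≤ = *-cancelˡ-≤ (4 * Q) ⦃ >-nonZero (*-mono-≤ {1} {4} (s≤s z≤n) 1≤Q) ⦄
          (≤-trans small (≤-trans (*-monoˡ-≤ (sq (length ν)) j<8Q) (≤-reflexive (lemma Q (sq (length ν))))))
      ; fine = fine
      ; invariant = λ d∈ → ≮⇒≥ (λ large → ¬any (lose d∈ large)) }
      where
      lemma : ∀ q l → 8 * q * l ≡ 4 * q * (2 * l)
      lemma = solve-∀
    ... | yes some with find some
    ...   | d , d∈ , large = next j j<8Q d∈ small fine supported
      where
      open ≤-Reasoning
      ν′ = ν ++ map (ℤ._+ d) ν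
      l² = sq (length ν)
      supported₀ : ∀ {n} → (∀ {t} → t ∈ ν → P + ℤ.∣ t ∣ + n ≤ B) → Supported ν
      supported₀ {n} supp t∈ = ≤-trans (m≤m+n _ n) (supp t∈)
      drop : ∀ j → 4 * Q * energy ν ≤ suc j * l² → Supported ν → 4 * Q * energy ν′ + 4 * suc l² ≤ 4 * (suc j * l²)
      drop j small supp = begin
        4 * Q * energy ν′ + 4 * suc l²                       ≤⟨ +-monoʳ-≤ (4 * Q * energy ν′) (*-monoʳ-≤ 4 large) ⟩
        4 * Q * energy ν′ + 4 * (Q * variation ν d)          ≡⟨ lemma₁ Q (energy ν′) (variation ν d) ⟩
        4 * Q * (energy ν′ + variation ν d)                  ≤⟨ *-monoʳ-≤ (4 * Q) (energy-step d supp) ⟩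
        4 * Q * (4 * energy ν)                               ≡⟨ lemma₂ Q (energy ν) ⟩
        4 * (4 * Q * energy ν)                               ≤⟨ *-monoʳ-≤ 4 small ⟩
        4 * (suc j * l²)                                     ∎
        where
        lemma₁ : ∀ q e v → 4 * q * e + 4 * (q * v) ≡ 4 * q * (e + v)
        lemma₁ = solve-∀
        lemma₂ : ∀ q e → 4 * q * (4 * e) ≡ 4 * (4 * q * e)
        lemma₂ = solve-∀
      next : ∀ j → suc j ≤ 8 * Q → d ∈ D j → 4 * Q * energy ν ≤ suc j * l² →
        (∀ {t} → t ∈ ν → AP 1 (scale (suc j)) t) → (∀ {t} → t ∈ ν → P + ℤ.∣ t ∣ + suc j * M ≤ B) → Regular
      next zero j<8Q d∈ small fine supported = contradiction (begin
        4 * l² + 4                          ≡⟨ lemma l² ⟩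
        4 * suc l²                          ≤⟨ m≤n+m (4 * suc l²) (4 * Q * energy ν′) ⟩
        4 * Q * energy ν′ + 4 * suc l²      ≤⟨ drop zero small (supported₀ supported) ⟩
        4 * (1 * l²)                        ≡⟨ cong (4 *_) (*-identityˡ l²) ⟩
        4 * l²                              ∎) (<⇒≱ (m<m+n (4 * l²) (s≤s z≤n)))
        where
        lemma : ∀ l → 4 * l + 4 ≡ 4 * (1 + l)
        lemma = solve-∀
      next (suc j) j<8Q d∈ small fine supported = decrement j (≤-trans (n≤1+n _) j<8Q) 1≤Q ν′
        (≤-trans nonempty (≤-trans (m≤m+n _ _) (≤-reflexive (sym (double-length ν d)))))
        (+-cancelʳ-≤ (4 * suc l²) _ _ (begin
          4 * Q * energy ν′ + 4 * suc l²              ≤⟨ drop (suc j) small (supported₀ supported) ⟩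
          4 * (suc (suc j) * l²)                      ≤⟨ m≤m+n _ 4 ⟩
          4 * (suc (suc j) * l²) + 4                  ≡⟨ lemma j (length ν) ⟩
          suc j * sq (2 * length ν) + 4 * suc l²
            ≡⟨ cong (λ l → suc j * sq l + 4 * suc l²) (double-length ν d) ⟨
          suc j * sq (length ν′) + 4 * suc l²         ∎))
        fine′ supported′
        where
        lemma : ∀ j l → 4 * ((2 + j) * (l * l)) + 4 ≡ (1 + j) * (2 * l * (2 * l)) + 4 * (1 + l * l)
        lemma = solve-∀
        fine′ : ∀ {t} → t ∈ ν′ → AP 1 (scale (suc j)) t
        fine′ t∈ with split t∈
        ... | inj₁ t∈ν = AP-weaken ≤-refl (≤-trans (m≤n*m (scale (suc j)) 2) (scale-≤ (suc j))) (fine t∈ν)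
        ... | inj₂ (u , u∈ , refl) = 2-1 (AP-weaken ≤-refl (scale-≤ (suc j)) (fine u∈)) (D-period j<8Q d∈)
        supported′ : ∀ {t} → t ∈ ν′ → P + ℤ.∣ t ∣ + suc j * M ≤ B
        supported′ {t} t∈ with split t∈
        ... | inj₁ t∈ν = ≤-trans (+-monoʳ-≤ (P + ℤ.∣ t ∣) (m≤n+m (suc j * M) M)) (supported t∈ν)
        ... | inj₂ (u , u∈ , refl) = begin
          P + ℤ.∣ u ℤ.+ d ∣ + suc j * M
            ≤⟨ +-monoˡ-≤ (suc j * M) (+-monoʳ-≤ P (≤-trans (ℤ.∣i+j∣≤∣i∣+∣j∣ u d) (+-monoʳ-≤ ℤ.∣ u ∣ (D-short j<8Q d∈)))) ⟩
          P + (ℤ.∣ u ∣ + M) + suc j * M             ≡⟨ regroup P ℤ.∣ u ∣ M (suc j * M) ⟩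
          P + ℤ.∣ u ∣ + (M + suc j * M)             ≤⟨ supported u∈ ⟩
          B                                         ∎
          where
          regroup : ∀ p u m k → p + (u + m) + k ≡ p + u + (m + k)
          regroup = solve-∀

-- Level sets

module LevelSet (𝒮 : SidonSystem) (B : ℕ) where

  open Smoothing 𝒮 public
  open Window B public

  ρI : ℕ
  ρI = length I

  module _ {C : ℕ} (1≤a : 1 ≤ a) (ρI≤ : ρI ≤ C * sq a) {ν : List ℤ}
           (nonempty : 1 ≤ length ν) (supported : Supported ν) (energy-≤ : energy ν ≤ 2 * sq (length ν)) where

    private
      L b : ℕ
      L = length ν
      b = a * L

      f : ℤ → ℕ
      f = F ν

      1≤b : 1 ≤ b
      1≤b = *-mono-≤ 1≤a nonempty

      1≤ρI : 1 ≤ ρI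
      1≤ρI = ≤-trans (s≤s z≤n) (≤-reflexive (sym (length-interval B)))

      instance
        a²≢0 : NonZero (sq a)
        a²≢0 = >-nonZero (*-mono-≤ 1≤a 1≤a)
        L²≢0 : NonZero (sq L)
        L²≢0 = >-nonZero (*-mono-≤ nonempty nonempty)
        ρI≢0 : NonZero ρI
        ρI≢0 = >-nonZero 1≤ρI

      large? : ∀ x → Dec (b ≤ 2 * ρI * f x)
      large? x = b ≤? 2 * ρI * f x

      X : ℤ → ℕ
      X x = 𝟙 (large? x)

      sq-𝟙 : ∀ {S : Set} (d : Dec S) → sq (𝟙 d) ≡ 𝟙 d
      sq-𝟙 (yes _) = refl
      sq-𝟙 (no _)  = refl

    level-set-size : sq a ≤ 8 * ∑ I X
    level-set-size = *-cancelʳ-≤ (sq a) (8 * ∑ I X) (sq L) (begin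
      sq a * sq L
        ≡⟨ lemma₁ a L ⟩
      sq b
        ≤⟨ *-mono-≤ b≤2∑ b≤2∑ ⟩
      sq (2 * ∑ I (λ x → f x * X x))
        ≡⟨ lemma₂ (∑ I (λ x → f x * X x)) ⟩
      4 * sq (∑ I (λ x → f x * X x))
        ≤⟨ *-monoʳ-≤ 4 (cauchy-schwarz-ℕ I f X) ⟩
      4 * (energy ν * ∑ I (λ x → sq (X x)))
        ≡⟨ cong (λ s → 4 * (energy ν * s)) (∑-cong I (λ x → sq-𝟙 (large? x))) ⟩
      4 * (energy ν * ∑ I X)
        ≤⟨ *-monoʳ-≤ 4 (*-monoˡ-≤ (∑ I X) energy-≤) ⟩
      4 * (2 * sq L * ∑ I X)
        ≡⟨ lemma₃ (sq L) (∑ I X) ⟩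
      8 * ∑ I X * sq L
        ∎)
      where
      open ≤-Reasoning
      lemma₁ : ∀ x y → x * x * (y * y) ≡ x * y * (x * y)
      lemma₁ = solve-∀
      lemma₂ : ∀ x → 2 * x * (2 * x) ≡ 4 * (x * x)
      lemma₂ = solve-∀
      lemma₃ : ∀ l x → 4 * (2 * l * x) ≡ 8 * x * l
      lemma₃ = solve-∀
      lemma₄ : ∀ p s → 2 * p * s ≡ p * (2 * s)
      lemma₄ = solve-∀
      lemma₅ : ∀ r b → 2 * r * b ≡ r * b + r * b
      lemma₅ = solve-∀
      pointwise : ∀ x → 2 * ρI * f x ≤ 2 * ρI * (f x * X x) + b
      pointwise x with large? x
      ... | yes _    = ≤-trans (≤-reflexive (cong (2 * ρI *_) (sym (*-identityʳ (f x))))) (m≤m+n _ b)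
      ... | no small = ≤-trans (<⇒≤ (≰⇒> small)) (m≤n+m b _)
      b≤2∑ : b ≤ 2 * ∑ I (λ x → f x * X x)
      b≤2∑ = *-cancelˡ-≤ ρI (+-cancelʳ-≤ (ρI * b) _ _ (begin
        ρI * b + ρI * b                                       ≡⟨ lemma₅ ρI b ⟨
        2 * ρI * b                                            ≡⟨ cong (2 * ρI *_) (mass supported) ⟨
        2 * ρI * ∑ I f                                        ≡⟨ ∑-*ˡ I (2 * ρI) f ⟨
        ∑ I (λ x → 2 * ρI * f x)                              ≤⟨ ∑-mono I pointwise ⟩
        ∑ I (λ x → 2 * ρI * (f x * X x) + b)                  ≡⟨ ∑-+ I (λ x → 2 * ρI * (f x * X x)) (λ _ → b) ⟩
        ∑ I (λ x → 2 * ρI * (f x * X x)) + ∑ I (λ _ → b)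
          ≡⟨ cong₂ _+_ (∑-*ˡ I (2 * ρI) (λ x → f x * X x)) (∑-const I b) ⟩
        2 * ρI * ∑ I (λ x → f x * X x) + ρI * b
          ≡⟨ cong (_+ ρI * b) (lemma₄ ρI (∑ I (λ x → f x * X x))) ⟩
        ρI * (2 * ∑ I (λ x → f x * X x)) + ρI * b             ∎))

    module _ (d₁ d₂ d₃ d₄ : ℤ) where

      fiveFold : ℤ → ℕ
      fiveFold x = f x * (f (x ℤ.+ d₁) * (f (x ℤ.+ d₂) * (f (x ℤ.+ d₃) * f (x ℤ.+ d₄))))

      private
        stays? : ∀ x d → Dec (b ≤ 4 * ρI * f (x ℤ.+ d))
        stays? x d = b ≤? 4 * ρI * f (x ℤ.+ d)

        good? : ∀ x → Dec (b ≤ 2 * ρI * f x × b ≤ 4 * ρI * f (x ℤ.+ d₁) × b ≤ 4 * ρI * f (x ℤ.+ d₂) ×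
                           b ≤ 4 * ρI * f (x ℤ.+ d₃) × b ≤ 4 * ρI * f (x ℤ.+ d₄))
        good? x = large? x ×-dec stays? x d₁ ×-dec stays? x d₂ ×-dec stays? x d₃ ×-dec stays? x d₄

        good : ℤ → ℕ
        good x = 𝟙 (good? x)

        jump : ℤ → ℤ → ℕ
        jump x d = sq ∣ f x - f (x ℤ.+ d) ∣

        drops : ∀ x d → b ≤ 2 * ρI * f x → ¬ (b ≤ 4 * ρI * f (x ℤ.+ d)) → sq b ≤ 16 * sq ρI * jump x d
        drops x d large small = begin
          sq b                                        ≤⟨ *-mono-≤ b≤ b≤ ⟩
          sq (4 * ρI * ∣ f x - f (x ℤ.+ d) ∣)         ≡⟨ lemma₂ ρI ∣ f x - f (x ℤ.+ d) ∣ ⟩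
          16 * sq ρI * jump x d                       ∎
          where
          open ≤-Reasoning
          lemma₁ : ∀ p y → 2 * (2 * p * y) ≡ 4 * p * y
          lemma₁ = solve-∀
          lemma₂ : ∀ p y → 4 * p * y * (4 * p * y) ≡ 16 * (p * p) * (y * y)
          lemma₂ = solve-∀
          b≤ : b ≤ 4 * ρI * ∣ f x - f (x ℤ.+ d) ∣
          b≤ = +-cancelʳ-≤ (4 * ρI * f (x ℤ.+ d)) _ _ (begin
            b + 4 * ρI * f (x ℤ.+ d)                                            ≤⟨ +-monoʳ-≤ b (<⇒≤ (≰⇒> small)) ⟩
            b + b
              ≡⟨ cong (λ s → b + s) (sym (+-identityʳ b)) ⟩
            2 * b                                                               ≤⟨ *-monoʳ-≤ 2 large ⟩
            2 * (2 * ρI * f x)                                                  ≡⟨ lemma₁ ρI (f x) ⟩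
            4 * ρI * f x
              ≤⟨ *-monoʳ-≤ (4 * ρI) (m≤n+∣m-n∣ (f x) (f (x ℤ.+ d))) ⟩
            4 * ρI * (f (x ℤ.+ d) + ∣ f x - f (x ℤ.+ d) ∣)
              ≡⟨ *-distribˡ-+ (4 * ρI) (f (x ℤ.+ d)) _ ⟩
            4 * ρI * f (x ℤ.+ d) + 4 * ρI * ∣ f x - f (x ℤ.+ d) ∣
              ≡⟨ +-comm (4 * ρI * f (x ℤ.+ d)) _ ⟩
            4 * ρI * ∣ f x - f (x ℤ.+ d) ∣ + 4 * ρI * f (x ℤ.+ d)               ∎)

        jumps : ℤ → ℕ
        jumps x = jump x d₁ + (jump x d₂ + (jump x d₃ + jump x d₄))

        bad : ∀ x d → b ≤ 2 * ρI * f x → ¬ (b ≤ 4 * ρI * f (x ℤ.+ d)) → jump x d ≤ jumps x →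
          sq b * 1 ≤ sq b * 0 + 16 * sq ρI * jumps x
        bad x d large small le = ≤-trans (≤-reflexive (*-identityʳ (sq b))) (≤-trans (drops x d large small)
          (≤-trans (*-monoʳ-≤ (16 * sq ρI) le) (m≤n+m _ (sq b * 0))))

        level-set-≤ : ∀ x → sq b * X x ≤ sq b * good x + 16 * sq ρI * jumps x
        level-set-≤ x with large? x
        ... | no _ = ≤-trans (≤-reflexive (*-zeroʳ (sq b))) z≤n
        ... | yes large with stays? x d₁ | stays? x d₂ | stays? x d₃ | stays? x d₄
        ...   | yes _ | yes _ | yes _ | yes _ = m≤m+n (sq b * 1) _
        ...   | no s  | _     | _     | _     = bad x d₁ large s (m≤m+n _ _)
        ...   | yes _ | no s  | _     | _     = bad x d₂ large s (≤-trans (m≤m+n _ _) (m≤n+m _ (jump x d₁)))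
        ...   | yes _ | yes _ | no s  | _     = bad x d₃ large s (≤-trans (m≤m+n _ _) (≤-trans (m≤n+m _ (jump x d₂)) (m≤n+m _ (jump x d₁))))
        ...   | yes _ | yes _ | yes _ | no s  = bad x d₄ large s (≤-trans (m≤n+m _ (jump x d₃)) (≤-trans (m≤n+m _ (jump x d₂)) (m≤n+m _ (jump x d₁))))

        good-fiveFold : ∀ x → (b * (b * (b * (b * b)))) * good x ≤ (4 * ρI) ^ 5 * fiveFold x
        good-fiveFold x with good? x
        ... | no _ = ≤-trans (≤-reflexive (*-zeroʳ (b * (b * (b * (b * b)))))) z≤n
        ... | yes (large , s₁ , s₂ , s₃ , s₄) = begin
          b * (b * (b * (b * b))) * 1
            ≡⟨ *-identityʳ _ ⟩
          b * (b * (b * (b * b)))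
            ≤⟨ *-mono-≤ (≤-trans large (*-monoˡ-≤ (f x) (*-monoˡ-≤ ρI {2} {4} (s≤s (s≤s z≤n)))))
                 (*-mono-≤ s₁ (*-mono-≤ s₂ (*-mono-≤ s₃ s₄))) ⟩
          r * f x * (r * f (x ℤ.+ d₁) * (r * f (x ℤ.+ d₂) * (r * f (x ℤ.+ d₃) * (r * f (x ℤ.+ d₄)))))
            ≡⟨ lemma r (f x) (f (x ℤ.+ d₁)) (f (x ℤ.+ d₂)) (f (x ℤ.+ d₃)) (f (x ℤ.+ d₄)) ⟩
          r ^ 5 * fiveFold x
            ∎
          where
          open ≤-Reasoning
          r = 4 * ρI
          lemma : ∀ r u v w y z → r * u * (r * v * (r * w * (r * y * (r * z))))
            ≡ r * (r * (r * (r * (r * 1)))) * (u * (v * (w * (y * z))))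
          lemma = solve-∀

      fiveFold-sum : ∀ {Q} → Q ≡ 1024 * sq C → 1 ≤ C →
        Q * variation ν d₁ ≤ sq L → Q * variation ν d₂ ≤ sq L →
        Q * variation ν d₃ ≤ sq L → Q * variation ν d₄ ≤ sq L →
        sq a * (b * (b * (b * (b * b)))) ≤ 16 * ((4 * ρI) ^ 5 * ∑ I fiveFold)
      fiveFold-sum {Q} Q≡ 1≤C v₁ v₂ v₃ v₄ = begin
        sq a * β                           ≤⟨ *-monoˡ-≤ β many-good ⟩
        16 * ∑ I good * β                  ≡⟨ lemma₁ (∑ I good) β ⟩
        16 * (β * ∑ I good)                ≡⟨ cong (16 *_) (∑-*ˡ I β good) ⟨
        16 * ∑ I (λ x → β * good x)        ≤⟨ *-monoʳ-≤ 16 (∑-mono I good-fiveFold) ⟩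
        16 * ∑ I (λ x → (4 * ρI) ^ 5 * fiveFold x)
                                           ≡⟨ cong (16 *_) (∑-*ˡ I ((4 * ρI) ^ 5) fiveFold) ⟩
        16 * ((4 * ρI) ^ 5 * ∑ I fiveFold)  ∎
        where
        open ≤-Reasoning
        β = b * (b * (b * (b * b)))
        lemma₁ : ∀ g β → 16 * g * β ≡ 16 * (β * g)
        lemma₁ = solve-∀
        lemma₂ : ∀ q u v w y → q * u + (q * v + (q * w + q * y)) ≡ q * (u + (v + (w + y)))
        lemma₂ = solve-∀
        lemma₃ : ∀ l → l + (l + (l + l)) ≡ 4 * l
        lemma₃ = solve-∀
        1≤Q : 1 ≤ Q
        1≤Q = subst (1 ≤_) (sym Q≡) (*-mono-≤ {1} {1024} (s≤s z≤n) (*-mono-≤ 1≤C 1≤C))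
        vs : ℕ
        vs = variation ν d₁ + (variation ν d₂ + (variation ν d₃ + variation ν d₄))
        ∑jumps : ∑ I jumps ≡ vs
        ∑jumps = trans (∑-+ I (λ x → jump x d₁) _) (cong (λ s → variation ν d₁ + s)
          (trans (∑-+ I (λ x → jump x d₂) _) (cong (λ s → variation ν d₂ + s) (∑-+ I (λ x → jump x d₃) (λ x → jump x d₄)))))
        Q-vs : Q * vs ≤ 4 * sq L
        Q-vs = begin
          Q * vs                            ≡⟨ lemma₂ Q _ _ _ _ ⟨
          Q * variation ν d₁ + (Q * variation ν d₂ + (Q * variation ν d₃ + Q * variation ν d₄))
                                            ≤⟨ +-mono-≤ v₁ (+-mono-≤ v₂ (+-mono-≤ v₃ v₄)) ⟩
          sq L + (sq L + (sq L + sq L))     ≡⟨ lemma₃ (sq L) ⟩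
          4 * sq L                          ∎
        summed : sq b * ∑ I X ≤ sq b * ∑ I good + 16 * sq ρI * vs
        summed = begin
          sq b * ∑ I X                                                  ≡⟨ ∑-*ˡ I (sq b) X ⟨
          ∑ I (λ x → sq b * X x)                                        ≤⟨ ∑-mono I level-set-≤ ⟩
          ∑ I (λ x → sq b * good x + 16 * sq ρI * jumps x)              ≡⟨ ∑-+ I _ _ ⟩
          ∑ I (λ x → sq b * good x) + ∑ I (λ x → 16 * sq ρI * jumps x)  ≡⟨ cong₂ _+_ (∑-*ˡ I (sq b) good)
                                                                             (trans (∑-*ˡ I (16 * sq ρI) jumps) (cong (16 * sq ρI *_) ∑jumps)) ⟩
          sq b * ∑ I good + 16 * sq ρI * vs                             ∎
        scaled : Q * ∑ I X ≤ Q * ∑ I good + 64 * sq C * sq a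
        scaled = *-cancelʳ-≤ _ _ (sq a) (*-cancelʳ-≤ _ _ (sq L) (begin
          Q * ∑ I X * sq a * sq L                                  ≡⟨ lemma₄ Q (∑ I X) a L ⟩
          Q * (sq b * ∑ I X)                                       ≤⟨ *-monoʳ-≤ Q summed ⟩
          Q * (sq b * ∑ I good + 16 * sq ρI * vs)                  ≡⟨ lemma₅ Q a L (∑ I good) (sq ρI) vs ⟩
          Q * ∑ I good * sq a * sq L + 16 * sq ρI * (Q * vs)
            ≤⟨ +-monoʳ-≤ _ (*-mono-≤ (*-monoʳ-≤ 16 (*-mono-≤ ρI≤ ρI≤)) Q-vs) ⟩
          Q * ∑ I good * sq a * sq L + 16 * sq (C * sq a) * (4 * sq L)
                                                                   ≡⟨ lemma₆ (Q * ∑ I good) C (sq a) (sq L) ⟩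
          (Q * ∑ I good + 64 * sq C * sq a) * sq a * sq L          ∎))
          where
          lemma₄ : ∀ q x a l → q * x * (a * a) * (l * l) ≡ q * (a * l * (a * l) * x)
          lemma₄ = solve-∀
          lemma₅ : ∀ q a l g r v → q * (a * l * (a * l) * g + 16 * r * v) ≡ q * g * (a * a) * (l * l) + 16 * r * (q * v)
          lemma₅ = solve-∀
          lemma₆ : ∀ g c a l → g * a * l + 16 * (c * a * (c * a)) * (4 * l) ≡ (g + 64 * (c * c) * a) * a * l
          lemma₆ = solve-∀
        many-good : sq a ≤ 16 * ∑ I good
        many-good = *-cancelˡ-≤ Q ⦃ >-nonZero 1≤Q ⦄ (+-cancelʳ-≤ (Q * sq a) _ _ (begin
          Q * sq a + Q * sq a                           ≡⟨ lemma₇ Q (sq a) ⟩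
          Q * (2 * sq a)                                ≤⟨ *-monoʳ-≤ Q (*-monoʳ-≤ 2 level-set-size) ⟩
          Q * (2 * (8 * ∑ I X))                         ≡⟨ lemma₈ Q (∑ I X) ⟩
          16 * (Q * ∑ I X)                              ≤⟨ *-monoʳ-≤ 16 scaled ⟩
          16 * (Q * ∑ I good + 64 * sq C * sq a)        ≡⟨ lemma₉ Q (∑ I good) (sq C) (sq a) ⟩
          Q * (16 * ∑ I good) + 1024 * sq C * sq a      ≡⟨ cong (λ q → Q * (16 * ∑ I good) + q * sq a) (sym Q≡) ⟩
          Q * (16 * ∑ I good) + Q * sq a                ∎))
          where
          lemma₇ : ∀ q x → q * x + q * x ≡ q * (2 * x)
          lemma₇ = solve-∀
          lemma₈ : ∀ q x → q * (2 * (8 * x)) ≡ 16 * (q * x)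
          lemma₈ = solve-∀
          lemma₉ : ∀ q g c x → 16 * (q * g + 64 * c * x) ≡ q * (16 * g) + 1024 * c * x
          lemma₉ = solve-∀

-- From the smoothed count to solutions

∑-product₅ : ∀ {I J : Set} (L : List I) (M : List J) (g₀ g₁ g₂ g₃ g₄ : I → J → ℕ) →
  ∑ L (λ i → ∑ M (g₀ i) * (∑ M (g₁ i) * (∑ M (g₂ i) * (∑ M (g₃ i) * ∑ M (g₄ i)))))
    ≡ ∑ M (λ j₀ → ∑ M (λ j₁ → ∑ M (λ j₂ → ∑ M (λ j₃ → ∑ M (λ j₄ → ∑ L (λ i →
        g₄ i j₄ * (g₃ i j₃ * (g₂ i j₂ * (g₁ i j₁ * g₀ i j₀)))))))))
∑-product₅ L M g₀ g₁ g₂ g₃ g₄ =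
  trans (∑-extract L M g₀ (λ i → G₁ i * (G₂ i * (G₃ i * G₄ i)))) (∑-cong M λ j₀ →
  trans (∑-cong L (λ i → swap₁ (g₀ i j₀) (G₁ i) (G₂ i * (G₃ i * G₄ i))))
  (trans (∑-extract L M g₁ (λ i → g₀ i j₀ * (G₂ i * (G₃ i * G₄ i)))) (∑-cong M λ j₁ →
  trans (∑-cong L (λ i → swap₂ (g₁ i j₁) (g₀ i j₀) (G₂ i) (G₃ i * G₄ i)))
  (trans (∑-extract L M g₂ (λ i → g₁ i j₁ * (g₀ i j₀ * (G₃ i * G₄ i)))) (∑-cong M λ j₂ →
  trans (∑-cong L (λ i → swap₃ (g₂ i j₂) (g₁ i j₁) (g₀ i j₀) (G₃ i) (G₄ i)))
  (trans (∑-extract L M g₃ (λ i → g₂ i j₂ * (g₁ i j₁ * (g₀ i j₀ * G₄ i)))) (∑-cong M λ j₃ →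
  trans (∑-cong L (λ i → swap₄ (g₃ i j₃) (g₂ i j₂) (g₁ i j₁) (g₀ i j₀) (G₄ i)))
  (∑-extract L M g₄ (λ i → g₃ i j₃ * (g₂ i j₂ * (g₁ i j₁ * g₀ i j₀)))))))))))
  where
  G₁ = λ i → ∑ M (g₁ i)
  G₂ = λ i → ∑ M (g₂ i)
  G₃ = λ i → ∑ M (g₃ i)
  G₄ = λ i → ∑ M (g₄ i)
  swap₁ : ∀ x g r → x * (g * r) ≡ g * (x * r)
  swap₁ = solve-∀
  swap₂ : ∀ x y g r → x * (y * (g * r)) ≡ g * (x * (y * r))
  swap₂ = solve-∀
  swap₃ : ∀ x y z g r → x * (y * (z * (g * r))) ≡ g * (x * (y * (z * r)))
  swap₃ = solve-∀
  swap₄ : ∀ x y z u g → x * (y * (z * (u * g))) ≡ g * (x * (y * (z * u)))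
  swap₄ = solve-∀

factors≢0 : ∀ {x y} → x * y ≢ 0 → x ≢ 0 × y ≢ 0
factors≢0 {x} {y} nz = (λ x≡0 → nz (cong (_* y) x≡0)) , (λ y≡0 → nz (trans (cong (x *_) y≡0) (*-zeroʳ x)))

∑-atMostOne-δ : ∀ {I : Set} {L : List I} {f : I → ℕ} {u v} → Unique L → (∀ i → f i ≤ 1) →
  (∀ {i j} → f i ≢ 0 → f j ≢ 0 → i ≡ j) → (∀ {i} → f i ≢ 0 → u ≡ v) → ∑ L f ≤ δ u v
∑-atMostOne-δ {L = L} {f} {u} {v} unique le uniq implied with u ℤ.≟ v
... | yes _  = ∑-atMostOne unique le (λ _ _ → uniq)
... | no u≢v = ≤-reflexive (trans (∑-cong L zeros) (∑-0 L))
  where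
  zeros : ∀ i → f i ≡ 0
  zeros i with f i ≟ 0
  ... | yes f≡0 = f≡0
  ... | no  f≢0 = contradiction (implied f≢0) u≢v

module Transfer (𝒮 : SidonSystem) (B : ℕ) where

  open LevelSet 𝒮 B public

  -- The shifts below satisfy a₁ shift₄ + a₂ shift₃ + a₃ shift₂ + a₄ shift₁ = 0.
  shift₁ : ℤ → ℤ
  shift₁ t₃ = ℤ.- (+ a₃ ℤ.* t₃)
  shift₂ shift₃ : ℤ → ℤ → ℤ
  shift₂ t₂ t₃ = + a₄ ℤ.* t₃ ℤ.- + a₂ ℤ.* t₂
  shift₃ t₁ t₂ = + a₃ ℤ.* t₂ ℤ.- + a₁ ℤ.* t₁
  shift₄ : ℤ → ℤ
  shift₄ t₁ = + a₂ ℤ.* t₁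

  Index : Set
  Index = ℤ × ℤ × ℤ × ℤ

  y₀ y₁ y₂ y₃ y₄ : Index → ℤ
  y₀ (t₁ , t₂ , t₃ , x) = x
  y₁ (t₁ , t₂ , t₃ , x) = x ℤ.+ shift₁ t₃
  y₂ (t₁ , t₂ , t₃ , x) = x ℤ.+ shift₂ t₂ t₃
  y₃ (t₁ , t₂ , t₃ , x) = x ℤ.+ shift₃ t₁ t₂
  y₄ (t₁ , t₂ , t₃ , x) = x ℤ.+ shift₄ t₁

  value : ℤ → ℤ → ℤ → ℤ → ℤ → ℤ
  value z₀ z₁ z₂ z₃ z₄ = form₁₂ (z₄ , z₃) ℤ.+ form₃₄ (z₂ , z₁) ℤ.+ σ ℤ.* z₀

  value-shifts : ∀ i τ₀ τ₁ τ₂ τ₃ τ₄ →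
    value (y₀ i ℤ.+ τ₀) (y₁ i ℤ.+ τ₁) (y₂ i ℤ.+ τ₂) (y₃ i ℤ.+ τ₃) (y₄ i ℤ.+ τ₄) ≡ value τ₀ τ₁ τ₂ τ₃ τ₄
  value-shifts (t₁ , t₂ , t₃ , x) τ₀ τ₁ τ₂ τ₃ τ₄ = begin
    form₁₂ (x ℤ.+ shift₄ t₁ ℤ.+ τ₄ , x ℤ.+ shift₃ t₁ t₂ ℤ.+ τ₃)
      ℤ.+ form₃₄ (x ℤ.+ shift₂ t₂ t₃ ℤ.+ τ₂ , x ℤ.+ shift₁ t₃ ℤ.+ τ₁) ℤ.+ σ ℤ.* (x ℤ.+ τ₀)
      ≡⟨ lemma (+ a₁) (+ a₂) (+ a₃) (+ a₄) σ t₁ t₂ t₃ x τ₀ τ₁ τ₂ τ₃ τ₄ ⟩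
    (+ a₁ ℤ.+ + a₂ ℤ.+ + a₃ ℤ.+ + a₄ ℤ.+ σ) ℤ.* x ℤ.+ value τ₀ τ₁ τ₂ τ₃ τ₄
      ≡⟨ cong (λ s → s ℤ.* x ℤ.+ value τ₀ τ₁ τ₂ τ₃ τ₄) total ⟩
    + 0 ℤ.* x ℤ.+ value τ₀ τ₁ τ₂ τ₃ τ₄
      ≡⟨ cong (ℤ._+ value τ₀ τ₁ τ₂ τ₃ τ₄) (ℤ.*-zeroˡ x) ⟩
    + 0 ℤ.+ value τ₀ τ₁ τ₂ τ₃ τ₄
      ≡⟨ ℤ.+-identityˡ (value τ₀ τ₁ τ₂ τ₃ τ₄) ⟩
    value τ₀ τ₁ τ₂ τ₃ τ₄
      ∎
    where
    open ≡-Reasoning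
    total : + a₁ ℤ.+ + a₂ ℤ.+ + a₃ ℤ.+ + a₄ ℤ.+ σ ≡ + 0
    total = ℤ.+-inverseʳ (+ S)
    lemma : ∀ b₁ b₂ b₃ b₄ s t₁ t₂ t₃ x τ₀ τ₁ τ₂ τ₃ τ₄ →
      b₁ ℤ.* (x ℤ.+ b₂ ℤ.* t₁ ℤ.+ τ₄) ℤ.+ b₂ ℤ.* (x ℤ.+ (b₃ ℤ.* t₂ ℤ.- b₁ ℤ.* t₁) ℤ.+ τ₃)
        ℤ.+ (b₃ ℤ.* (x ℤ.+ (b₄ ℤ.* t₃ ℤ.- b₂ ℤ.* t₂) ℤ.+ τ₂) ℤ.+ b₄ ℤ.* (x ℤ.+ (ℤ.- (b₃ ℤ.* t₃)) ℤ.+ τ₁))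
        ℤ.+ s ℤ.* (x ℤ.+ τ₀)
      ≡ (b₁ ℤ.+ b₂ ℤ.+ b₃ ℤ.+ b₄ ℤ.+ s) ℤ.* x
        ℤ.+ (b₁ ℤ.* τ₄ ℤ.+ b₂ ℤ.* τ₃ ℤ.+ (b₃ ℤ.* τ₂ ℤ.+ b₄ ℤ.* τ₁) ℤ.+ s ℤ.* τ₀)
    lemma = ℤ-Solver.solve-∀

  positions-injective : ∀ {i j} → y₀ i ≡ y₀ j → y₁ i ≡ y₁ j → y₂ i ≡ y₂ j → y₄ i ≡ y₄ j → i ≡ j
  positions-injective {t₁ , t₂ , t₃ , x} {u₁ , u₂ , u₃ , .x} refl e₁ e₂ e₄ = cong₂ _,_ t₁≡ (cong₂ _,_ t₂≡ (cong (_, x) t₃≡))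
    where
    cancel : ∀ {u v} → x ℤ.+ u ≡ x ℤ.+ v → u ≡ v
    cancel {u} {v} eq = ≡-from eq (lemma x u v)
      where
      lemma : ∀ x u v → u ℤ.- v ≡ x ℤ.+ u ℤ.- (x ℤ.+ v)
      lemma = ℤ-Solver.solve-∀
    t₁≡ : t₁ ≡ u₁
    t₁≡ = *-cancelˡ-≢0 (+≢0 1≤a₂) (cancel e₄)
    t₃≡ : t₃ ≡ u₃
    t₃≡ = *-cancelˡ-≢0 (+≢0 1≤a₃) (ℤ.neg-injective (cancel e₁))
    t₂≡ : t₂ ≡ u₂
    t₂≡ = *-cancelˡ-≢0 (+≢0 1≤a₂) (reflect-injective (+ a₄ ℤ.* t₃)
      (trans (cancel e₂) (cong (λ t → + a₄ ℤ.* t ℤ.- + a₂ ℤ.* u₂) (sym t₃≡))))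

  module _ {T : List ℤ} (uniqueT : Unique T) (ν : List ℤ) where

    index : List Index
    index = cartesianProduct T (cartesianProduct T (cartesianProduct T I))

    index-! : Unique index
    index-! = Unique.cartesianProduct⁺ uniqueT (Unique.cartesianProduct⁺ uniqueT (Unique.cartesianProduct⁺ uniqueT (interval-! B)))

    private
      at : (Index → ℤ) → ℤ → Index → ℤ → ℕ
      at y τ i z = δ z (y i ℤ.+ τ)

      fibre : ∀ τ₀ τ₁ τ₂ τ₃ τ₄ z₀ z₁ z₂ z₃ z₄ →
        ∑ index (λ i → at y₀ τ₀ i z₀ * (at y₁ τ₁ i z₁ * (at y₂ τ₂ i z₂ * (at y₃ τ₃ i z₃ * at y₄ τ₄ i z₄))))
          ≤ δ (value z₀ z₁ z₂ z₃ z₄) (value τ₀ τ₁ τ₂ τ₃ τ₄)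
      fibre τ₀ τ₁ τ₂ τ₃ τ₄ z₀ z₁ z₂ z₃ z₄ = ∑-atMostOne-δ index-!
        (λ i → *-mono-≤ (δ-≤1 z₀ (y₀ i ℤ.+ τ₀)) (*-mono-≤ (δ-≤1 z₁ (y₁ i ℤ.+ τ₁)) (*-mono-≤ (δ-≤1 z₂ (y₂ i ℤ.+ τ₂))
          (*-mono-≤ (δ-≤1 z₃ (y₃ i ℤ.+ τ₃)) (δ-≤1 z₄ (y₄ i ℤ.+ τ₄))))))
        (λ {i} {j} nz nz′ → let (p₀ , p₁ , p₂ , _ , p₄) = equations i nz
                                (q₀ , q₁ , q₂ , _ , q₄) = equations j nz′ in
          positions-injective {i} {j} (same p₀ q₀) (same p₁ q₁) (same p₂ q₂) (same p₄ q₄))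
        (λ {i} nz → let (p₀ , p₁ , p₂ , p₃ , p₄) = equations i nz in
          trans (substituted i p₀ p₁ p₂ p₃ p₄) (value-shifts i τ₀ τ₁ τ₂ τ₃ τ₄))
        where
        same : ∀ {z u v τ} → z ≡ u ℤ.+ τ → z ≡ v ℤ.+ τ → u ≡ v
        same {τ = τ} p q = shift-injective τ (trans (sym p) q)
        equations : ∀ i → at y₀ τ₀ i z₀ * (at y₁ τ₁ i z₁ * (at y₂ τ₂ i z₂ * (at y₃ τ₃ i z₃ * at y₄ τ₄ i z₄))) ≢ 0 →
          z₀ ≡ y₀ i ℤ.+ τ₀ × z₁ ≡ y₁ i ℤ.+ τ₁ × z₂ ≡ y₂ i ℤ.+ τ₂ × z₃ ≡ y₃ i ℤ.+ τ₃ × z₄ ≡ y₄ i ℤ.+ τ₄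
        equations i nz =
          let (n₀ , r₀) = factors≢0 {at y₀ τ₀ i z₀} nz
              (n₁ , r₁) = factors≢0 {at y₁ τ₁ i z₁} r₀
              (n₂ , r₂) = factors≢0 {at y₂ τ₂ i z₂} r₁
              (n₃ , n₄) = factors≢0 {at y₃ τ₃ i z₃} r₂
          in δ≢0⇒≡ n₀ , δ≢0⇒≡ n₁ , δ≢0⇒≡ n₂ , δ≢0⇒≡ n₃ , δ≢0⇒≡ n₄
        substituted : ∀ i → z₀ ≡ y₀ i ℤ.+ τ₀ → z₁ ≡ y₁ i ℤ.+ τ₁ → z₂ ≡ y₂ i ℤ.+ τ₂ → z₃ ≡ y₃ i ℤ.+ τ₃ → z₄ ≡ y₄ i ℤ.+ τ₄ →
          value z₀ z₁ z₂ z₃ z₄ ≡ value (y₀ i ℤ.+ τ₀) (y₁ i ℤ.+ τ₁) (y₂ i ℤ.+ τ₂) (y₃ i ℤ.+ τ₃) (y₄ i ℤ.+ τ₄)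
        substituted i refl refl refl refl refl = refl

    five-fold-≤ :
      ∑ index (λ i → F ν (y₀ i) * (F ν (y₁ i) * (F ν (y₂ i) * (F ν (y₃ i) * F ν (y₄ i)))))
        ≤ ∑ ν (λ τ₀ → ∑ ν (λ τ₁ → ∑ ν (λ τ₂ → ∑ ν (λ τ₃ → ∑ ν (λ τ₄ → solutions (value τ₀ τ₁ τ₂ τ₃ τ₄))))))
    five-fold-≤ = ≤-trans
      (≤-reflexive (∑-product₅ index ν (λ i τ → χ (y₀ i ℤ.+ τ)) (λ i τ → χ (y₁ i ℤ.+ τ)) (λ i τ → χ (y₂ i ℤ.+ τ))
        (λ i τ → χ (y₃ i ℤ.+ τ)) (λ i τ → χ (y₄ i ℤ.+ τ))))
      (∑-mono ν λ τ₀ → ∑-mono ν λ τ₁ → ∑-mono ν λ τ₂ → ∑-mono ν λ τ₃ → ∑-mono ν λ τ₄ → begin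
        ∑ index (λ i → χ (y₄ i ℤ.+ τ₄) * (χ (y₃ i ℤ.+ τ₃) * (χ (y₂ i ℤ.+ τ₂) * (χ (y₁ i ℤ.+ τ₁) * χ (y₀ i ℤ.+ τ₀)))))
          ≡⟨ ∑-product₅ index A (at y₄ τ₄) (at y₃ τ₃) (at y₂ τ₂) (at y₁ τ₁) (at y₀ τ₀) ⟩
        ∑ A (λ z₄ → ∑ A (λ z₃ → ∑ A (λ z₂ → ∑ A (λ z₁ → ∑ A (λ z₀ → ∑ index (λ i →
          at y₀ τ₀ i z₀ * (at y₁ τ₁ i z₁ * (at y₂ τ₂ i z₂ * (at y₃ τ₃ i z₃ * at y₄ τ₄ i z₄)))))))))
          ≤⟨ (∑-mono A λ z₄ → ∑-mono A λ z₃ → ∑-mono A λ z₂ → ∑-mono A λ z₁ → ∑-mono A λ z₀ →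
               fibre τ₀ τ₁ τ₂ τ₃ τ₄ z₀ z₁ z₂ z₃ z₄) ⟩
        ∑ A (λ z₄ → ∑ A (λ z₃ → ∑ A (λ z₂ → ∑ A (λ z₁ → ∑ A (λ z₀ → δ (value z₀ z₁ z₂ z₃ z₄) (value τ₀ τ₁ τ₂ τ₃ τ₄))))))
          ≡⟨ trans (∑-× A A _) (∑-cong A (λ z₄ → ∑-cong A (λ z₃ → ∑-× A A _))) ⟨
        solutions (value τ₀ τ₁ τ₂ τ₃ τ₄)
          ∎)
      where open ≤-Reasoning

    module _ {E : ℕ} (fine : ∀ {t} → t ∈ ν → AP 1 E t) where

      private
        AP-value : ∀ {τ₀ τ₁ τ₂ τ₃ τ₄} → τ₀ ∈ ν → τ₁ ∈ ν → τ₂ ∈ ν → τ₃ ∈ ν → τ₄ ∈ ν → AP (2 * S) E (value τ₀ τ₁ τ₂ τ₃ τ₄)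
        AP-value {τ₀} τ₀∈ τ₁∈ τ₂∈ τ₃∈ τ₄∈ = AP-weaken (≤-reflexive (lemma a₁ a₂ a₃ a₄)) ≤-refl
          (AP-+ (AP-+ (AP-+ (AP-* a₁ (fine τ₄∈)) (AP-* a₂ (fine τ₃∈))) (AP-+ (AP-* a₃ (fine τ₂∈)) (AP-* a₄ (fine τ₁∈))))
            (subst (AP (S * 1) E) (ℤ.neg-distribˡ-* (+ S) τ₀) (AP-neg (AP-* S (fine τ₀∈)))))
          where
          lemma : ∀ b₁ b₂ b₃ b₄ → b₁ * 1 + b₂ * 1 + (b₃ * 1 + b₄ * 1) + (b₁ + b₂ + b₃ + b₄) * 1 ≡ 2 * (b₁ + b₂ + b₃ + b₄)
          lemma = solve-∀

        shifted-count : ∀ m → AP (2 * S) E m → E * solutions m ≤ E * solutions (+ 0) + 2 * S * (a * sq a)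
        shifted-count m ap = begin
          E * solutions m
            ≤⟨ *-monoʳ-≤ E (x≤y+∣x-y∣ (solutions m) (solutions (+ 0))) ⟩
          E * (solutions (+ 0) + ℤ.∣ + solutions m ℤ.- + solutions (+ 0) ∣)
            ≡⟨ *-distribˡ-+ E (solutions (+ 0)) _ ⟩
          E * solutions (+ 0) + E * ℤ.∣ + solutions m ℤ.- + solutions (+ 0) ∣
            ≤⟨ +-monoʳ-≤ (E * solutions (+ 0)) (subst (λ n → E * ℤ.∣ + solutions n ℤ.- + solutions (+ 0) ∣ ≤ 2 * S * (a * sq a))
                 (ℤ.+-identityˡ m) (AP.bound ap (+ 0))) ⟩
          E * solutions (+ 0) + 2 * S * (a * sq a)
            ∎
          where
          open ≤-Reasoning
          lemma : ∀ x y → y ℤ.+ (x ℤ.- y) ≡ x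
          lemma = ℤ-Solver.solve-∀
          x≤y+∣x-y∣ : ∀ x y → x ≤ y + ℤ.∣ + x ℤ.- + y ∣
          x≤y+∣x-y∣ x y = subst (_≤ y + ℤ.∣ + x ℤ.- + y ∣) (cong ℤ.∣_∣ (lemma (+ x) (+ y))) (ℤ.∣i+j∣≤∣i∣+∣j∣ (+ y) (+ x ℤ.- + y))

      five-fold-fine : E * ∑ index (λ i → F ν (y₀ i) * (F ν (y₁ i) * (F ν (y₂ i) * (F ν (y₃ i) * F ν (y₄ i)))))
        ≤ length ν * (length ν * (length ν * (length ν * (length ν * (E * solutions (+ 0) + 2 * S * (a * sq a))))))
      five-fold-fine = ≤-trans (*-monoʳ-≤ E five-fold-≤) (
        pull (λ {τ₀} τ₀∈ → pull (λ {τ₁} τ₁∈ → pull (λ {τ₂} τ₂∈ → pull (λ {τ₃} τ₃∈ → pull (λ {τ₄} τ₄∈ →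
          shifted-count (value τ₀ τ₁ τ₂ τ₃ τ₄) (AP-value τ₀∈ τ₁∈ τ₂∈ τ₃∈ τ₄∈)))))))
        where
        pull : ∀ {f : ℤ → ℕ} {c} → (∀ {τ} → τ ∈ ν → E * f τ ≤ c) → E * ∑ ν f ≤ length ν * c
        pull {f} {c} le = ≤-trans (≤-reflexive (sym (∑-*ˡ ν E f))) (∑-≤-const ν c le)

-- Degenerate solutions

module Degenerate (𝒮 : SidonSystem) where

  open Counting 𝒮

  private
    Tuple : Set
    Tuple = (ℤ × ℤ) × (ℤ × ℤ) × ℤ

    tuples : List Tuple
    tuples = cartesianProduct AA (cartesianProduct AA A)

    evaluate : Tuple → ℤ
    evaluate (p , r , z) = form₁₂ p ℤ.+ form₃₄ r ℤ.+ σ ℤ.* z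

    tuples-! : Unique tuples
    tuples-! = Unique.cartesianProduct⁺ AA-! (Unique.cartesianProduct⁺ AA-! uniqueA)

    solution? : ∀ i → Dec (evaluate i ≡ + 0)
    solution? i = evaluate i ℤ.≟ + 0

    solution-list : List Tuple
    solution-list = filter solution? tuples

    solutions-length : solutions (+ 0) ≤ length solution-list
    solutions-length = begin
      ∑ AA (λ p → ∑ AA (λ r → ∑ A (λ z → δ (evaluate (p , r , z)) (+ 0))))
        ≡⟨ trans (∑-× AA (cartesianProduct AA A) _) (∑-cong AA (λ p → ∑-× AA A _)) ⟨
      ∑ tuples (λ i → δ (evaluate i) (+ 0))
        ≡⟨ ∑-filter solution? tuples (λ i → δ (evaluate i) (+ 0)) ⟩
      ∑ solution-list (λ i → δ (evaluate i) (+ 0)) + ∑ (filter (¬? ∘ solution?) tuples) (λ i → δ (evaluate i) (+ 0))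
        ≤⟨ +-mono-≤ (∑-≤-const solution-list 1 (λ {i} _ → δ-≤1 (evaluate i) (+ 0)))
             (≤-reflexive (trans (∑-cong-∈ (filter (¬? ∘ solution?) tuples)
               (λ i∈ → δ-≢ (proj₂ (∈-filter⁻ (¬? ∘ solution?) {xs = tuples} i∈)))) (∑-0 (filter (¬? ∘ solution?) tuples)))) ⟩
      length solution-list * 1 + 0
        ≡⟨ trans (+-identityʳ _) (*-identityʳ _) ⟩
      length solution-list
        ∎
      where open ≤-Reasoning

    data Position : Set where
      p₁ p₂ p₃ p₄ p₅ : Position

    at : Position → Tuple → ℤ
    at p₁ = proj₁ ∘ proj₁
    at p₂ = proj₂ ∘ proj₁
    at p₃ = proj₁ ∘ proj₁ ∘ proj₂
    at p₄ = proj₂ ∘ proj₁ ∘ proj₂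
    at p₅ = proj₂ ∘ proj₂

    coefficient : Position → ℤ
    coefficient p₁ = + a₁
    coefficient p₂ = + a₂
    coefficient p₃ = + a₃
    coefficient p₄ = + a₄
    coefficient p₅ = σ

    coefficient≢0 : ∀ n → coefficient n ≢ + 0
    coefficient≢0 p₁ = +≢0 1≤a₁
    coefficient≢0 p₂ = +≢0 1≤a₂
    coefficient≢0 p₃ = +≢0 1≤a₃
    coefficient≢0 p₄ = +≢0 1≤a₄
    coefficient≢0 p₅ = σ≢0

    term : Position → Tuple → ℤ
    term n x = coefficient n ℤ.* at n x

    at-∈ : ∀ {x} → x ∈ tuples → ∀ n → at n x ∈ A
    at-∈ x∈ n with ∈-cartesianProduct⁻ AA (cartesianProduct AA A) x∈
    ... | p∈ , rz∈ with ∈-cartesianProduct⁻ AA A rz∈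
    at-∈ x∈ p₁ | p∈ , rz∈ | r∈ , z∈ = proj₁ (∈-cartesianProduct⁻ A A p∈)
    at-∈ x∈ p₂ | p∈ , rz∈ | r∈ , z∈ = proj₂ (∈-cartesianProduct⁻ A A p∈)
    at-∈ x∈ p₃ | p∈ , rz∈ | r∈ , z∈ = proj₁ (∈-cartesianProduct⁻ A A r∈)
    at-∈ x∈ p₄ | p∈ , rz∈ | r∈ , z∈ = proj₂ (∈-cartesianProduct⁻ A A r∈)
    at-∈ x∈ p₅ | p∈ , rz∈ | r∈ , z∈ = z∈

    -- Solutions with equal variables at i and j are solutions of a four-variable equation in the
    -- variables at i, k, l and m.
    record Coincidence : Set where
      field
        i j k l m : Position

      Equal : Tuple → Set
      Equal x = at i x ≡ at j x

      equal? : ∀ x → Dec (Equal x)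
      equal? x = at i x ℤ.≟ at j x

      drop : Tuple → (ℤ × ℤ) × (ℤ × ℤ)
      drop x = (at i x , at k x) , (at l x , at m x)

      field
        sum≢0     : coefficient i ℤ.+ coefficient j ≢ + 0
        reorder   : ∀ x → evaluate x ≡ term i x ℤ.+ term j x ℤ.+ term k x ℤ.+ (term l x ℤ.+ term m x)
        injective : ∀ x y → Equal x → Equal y → drop x ≡ drop y → x ≡ y

    module _ (c : Coincidence) where
      open Coincidence c

      private
        c₁ : ℤ
        c₁ = coefficient i ℤ.+ coefficient j

        g : (ℤ × ℤ) × (ℤ × ℤ) → ℕ
        g (p , r) = δ (form c₁ (coefficient k) p ℤ.+ form (coefficient l) (coefficient m) r) (+ 0)

        drop-solution : ∀ {x} → evaluate x ≡ + 0 → Equal x → g (drop x) ≡ 1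
        drop-solution {x} vanishes same = δ-≡ (trans (sym (trans (reorder x)
          (cong (λ s → s ℤ.+ term k x ℤ.+ (term l x ℤ.+ term m x)) merge))) vanishes)
          where
          merge : term i x ℤ.+ term j x ≡ c₁ ℤ.* at i x
          merge = trans (cong (λ y → term i x ℤ.+ coefficient j ℤ.* y) (sym same))
            (sym (ℤ.*-distribʳ-+ (at i x) (coefficient i) (coefficient j)))

      coincidence-length : length (filter equal? solution-list) ≤ 2 * sq a
      coincidence-length = begin
        length Ls
          ≡⟨ trans (sym (*-identityʳ _)) (sym (∑-const Ls 1)) ⟩
        ∑ Ls (λ _ → 1)
          ≡⟨ ∑-cong-∈ Ls (λ x∈ → sym (drop-solution (proj₁ (proj₂ (members x∈))) (proj₂ (proj₂ (members x∈))))) ⟩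
        ∑ Ls (g ∘ drop)
          ≤⟨ ∑-injective-≤ drop g (Unique.filter⁺ equal? (Unique.filter⁺ solution? tuples-!))
               (λ {x} {y} x∈ y∈ → injective x y (proj₂ (proj₂ (members x∈))) (proj₂ (proj₂ (members y∈))))
               (λ x∈ → inj₂ (in-AAAA (at-∈ (proj₁ (members x∈))))) ⟩
        ∑ (cartesianProduct AA AA) g
          ≡⟨ ∑-× AA AA g ⟩
        ∑ AA (λ p → ∑ AA (λ r → g (p , r)))
          ≤⟨ form₄-solutions uniqueA sidonA sum≢0 (coefficient≢0 k) (coefficient≢0 l) (coefficient≢0 m) ⟩
        2 * sq a
          ∎
        where
        open ≤-Reasoning
        Ls = filter equal? solution-list
        in-AAAA : ∀ {x} → (∀ n → at n x ∈ A) → drop x ∈ cartesianProduct AA AA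
        in-AAAA at∈ = ∈-cartesianProduct⁺ (∈-cartesianProduct⁺ (at∈ i) (at∈ k)) (∈-cartesianProduct⁺ (at∈ l) (at∈ m))
        members : ∀ {x} → x ∈ Ls → x ∈ tuples × evaluate x ≡ + 0 × Equal x
        members x∈ = let (x∈sol , same) = ∈-filter⁻ equal? {xs = solution-list} x∈
                         (x∈tup , vanishes) = ∈-filter⁻ solution? {xs = tuples} x∈sol
          in x∈tup , vanishes , same

    +≢0′ : ∀ {b c} → 1 ≤ b → + b ℤ.+ + c ≢ + 0
    +≢0′ 1≤b = +≢0 (≤-trans 1≤b (m≤m+n _ _))

    +σ≢0 : ∀ {b} → b < S → + b ℤ.+ σ ≢ + 0
    +σ≢0 {b} b<S eq = <⇒≢ b<S (ℤ.+-injective (ℤ.i-j≡0⇒i≡j (+ b) (+ S) eq))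

    a₁<S : a₁ < S
    a₁<S = ≤-trans (≤-trans (≤-reflexive (+-comm 1 a₁)) (+-monoʳ-≤ a₁ 1≤a₂)) a₁+a₂≤S
    a₂<S : a₂ < S
    a₂<S = ≤-trans (+-monoˡ-≤ a₂ 1≤a₁) a₁+a₂≤S
    a₃<S : a₃ < S
    a₃<S = ≤-trans (≤-trans (≤-reflexive (+-comm 1 a₃)) (+-monoʳ-≤ a₃ 1≤a₄)) a₃+a₄≤S
    a₄<S : a₄ < S
    a₄<S = ≤-trans (+-monoˡ-≤ a₄ 1≤a₃) a₃+a₄≤S

    coincidence₁₂ coincidence₁₃ coincidence₁₄ coincidence₁₅ coincidence₂₃
      coincidence₂₄ coincidence₂₅ coincidence₃₄ coincidence₃₅ coincidence₄₅ : Coincidence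
    coincidence₁₂ = record
      { i = p₁ ; j = p₂ ; k = p₃ ; l = p₄ ; m = p₅ ; sum≢0 = +≢0′ 1≤a₁
      ; reorder = λ x → lemma (term p₁ x) (term p₂ x) (term p₃ x) (term p₄ x) (term p₅ x)
      ; injective = λ { _ _ refl refl refl → refl } }
      where
      lemma : ∀ y₁ y₂ y₃ y₄ y₅ → y₁ ℤ.+ y₂ ℤ.+ (y₃ ℤ.+ y₄) ℤ.+ y₅ ≡ y₁ ℤ.+ y₂ ℤ.+ y₃ ℤ.+ (y₄ ℤ.+ y₅)
      lemma = ℤ-Solver.solve-∀
    coincidence₁₃ = record
      { i = p₁ ; j = p₃ ; k = p₂ ; l = p₄ ; m = p₅ ; sum≢0 = +≢0′ 1≤a₁
      ; reorder = λ x → lemma (term p₁ x) (term p₂ x) (term p₃ x) (term p₄ x) (term p₅ x)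
      ; injective = λ { _ _ refl refl refl → refl } }
      where
      lemma : ∀ y₁ y₂ y₃ y₄ y₅ → y₁ ℤ.+ y₂ ℤ.+ (y₃ ℤ.+ y₄) ℤ.+ y₅ ≡ y₁ ℤ.+ y₃ ℤ.+ y₂ ℤ.+ (y₄ ℤ.+ y₅)
      lemma = ℤ-Solver.solve-∀
    coincidence₁₄ = record
      { i = p₁ ; j = p₄ ; k = p₂ ; l = p₃ ; m = p₅ ; sum≢0 = +≢0′ 1≤a₁
      ; reorder = λ x → lemma (term p₁ x) (term p₂ x) (term p₃ x) (term p₄ x) (term p₅ x)
      ; injective = λ { _ _ refl refl refl → refl } }
      where
      lemma : ∀ y₁ y₂ y₃ y₄ y₅ → y₁ ℤ.+ y₂ ℤ.+ (y₃ ℤ.+ y₄) ℤ.+ y₅ ≡ y₁ ℤ.+ y₄ ℤ.+ y₂ ℤ.+ (y₃ ℤ.+ y₅)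
      lemma = ℤ-Solver.solve-∀
    coincidence₁₅ = record
      { i = p₁ ; j = p₅ ; k = p₂ ; l = p₃ ; m = p₄ ; sum≢0 = +σ≢0 a₁<S
      ; reorder = λ x → lemma (term p₁ x) (term p₂ x) (term p₃ x) (term p₄ x) (term p₅ x)
      ; injective = λ { _ _ refl refl refl → refl } }
      where
      lemma : ∀ y₁ y₂ y₃ y₄ y₅ → y₁ ℤ.+ y₂ ℤ.+ (y₃ ℤ.+ y₄) ℤ.+ y₅ ≡ y₁ ℤ.+ y₅ ℤ.+ y₂ ℤ.+ (y₃ ℤ.+ y₄)
      lemma = ℤ-Solver.solve-∀
    coincidence₂₃ = record
      { i = p₂ ; j = p₃ ; k = p₁ ; l = p₄ ; m = p₅ ; sum≢0 = +≢0′ 1≤a₂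
      ; reorder = λ x → lemma (term p₁ x) (term p₂ x) (term p₃ x) (term p₄ x) (term p₅ x)
      ; injective = λ { _ _ refl refl refl → refl } }
      where
      lemma : ∀ y₁ y₂ y₃ y₄ y₅ → y₁ ℤ.+ y₂ ℤ.+ (y₃ ℤ.+ y₄) ℤ.+ y₅ ≡ y₂ ℤ.+ y₃ ℤ.+ y₁ ℤ.+ (y₄ ℤ.+ y₅)
      lemma = ℤ-Solver.solve-∀
    coincidence₂₄ = record
      { i = p₂ ; j = p₄ ; k = p₁ ; l = p₃ ; m = p₅ ; sum≢0 = +≢0′ 1≤a₂
      ; reorder = λ x → lemma (term p₁ x) (term p₂ x) (term p₃ x) (term p₄ x) (term p₅ x)
      ; injective = λ { _ _ refl refl refl → refl } }
      where
      lemma : ∀ y₁ y₂ y₃ y₄ y₅ → y₁ ℤ.+ y₂ ℤ.+ (y₃ ℤ.+ y₄) ℤ.+ y₅ ≡ y₂ ℤ.+ y₄ ℤ.+ y₁ ℤ.+ (y₃ ℤ.+ y₅)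
      lemma = ℤ-Solver.solve-∀
    coincidence₂₅ = record
      { i = p₂ ; j = p₅ ; k = p₁ ; l = p₃ ; m = p₄ ; sum≢0 = +σ≢0 a₂<S
      ; reorder = λ x → lemma (term p₁ x) (term p₂ x) (term p₃ x) (term p₄ x) (term p₅ x)
      ; injective = λ { _ _ refl refl refl → refl } }
      where
      lemma : ∀ y₁ y₂ y₃ y₄ y₅ → y₁ ℤ.+ y₂ ℤ.+ (y₃ ℤ.+ y₄) ℤ.+ y₅ ≡ y₂ ℤ.+ y₅ ℤ.+ y₁ ℤ.+ (y₃ ℤ.+ y₄)
      lemma = ℤ-Solver.solve-∀
    coincidence₃₄ = record
      { i = p₃ ; j = p₄ ; k = p₁ ; l = p₂ ; m = p₅ ; sum≢0 = +≢0′ 1≤a₃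
      ; reorder = λ x → lemma (term p₁ x) (term p₂ x) (term p₃ x) (term p₄ x) (term p₅ x)
      ; injective = λ { _ _ refl refl refl → refl } }
      where
      lemma : ∀ y₁ y₂ y₃ y₄ y₅ → y₁ ℤ.+ y₂ ℤ.+ (y₃ ℤ.+ y₄) ℤ.+ y₅ ≡ y₃ ℤ.+ y₄ ℤ.+ y₁ ℤ.+ (y₂ ℤ.+ y₅)
      lemma = ℤ-Solver.solve-∀
    coincidence₃₅ = record
      { i = p₃ ; j = p₅ ; k = p₁ ; l = p₂ ; m = p₄ ; sum≢0 = +σ≢0 a₃<S
      ; reorder = λ x → lemma (term p₁ x) (term p₂ x) (term p₃ x) (term p₄ x) (term p₅ x)
      ; injective = λ { _ _ refl refl refl → refl } }
      where
      lemma : ∀ y₁ y₂ y₃ y₄ y₅ → y₁ ℤ.+ y₂ ℤ.+ (y₃ ℤ.+ y₄) ℤ.+ y₅ ≡ y₃ ℤ.+ y₅ ℤ.+ y₁ ℤ.+ (y₂ ℤ.+ y₄)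
      lemma = ℤ-Solver.solve-∀
    coincidence₄₅ = record
      { i = p₄ ; j = p₅ ; k = p₁ ; l = p₂ ; m = p₃ ; sum≢0 = +σ≢0 a₄<S
      ; reorder = λ x → lemma (term p₁ x) (term p₂ x) (term p₃ x) (term p₄ x) (term p₅ x)
      ; injective = λ { _ _ refl refl refl → refl } }
      where
      lemma : ∀ y₁ y₂ y₃ y₄ y₅ → y₁ ℤ.+ y₂ ℤ.+ (y₃ ℤ.+ y₄) ℤ.+ y₅ ≡ y₄ ℤ.+ y₅ ℤ.+ y₁ ℤ.+ (y₂ ℤ.+ y₃)
      lemma = ℤ-Solver.solve-∀

    coincidences : List Coincidence
    coincidences = coincidence₁₃ ∷ coincidence₁₄ ∷ coincidence₁₅ ∷ coincidence₂₃
      ∷ coincidence₂₄ ∷ coincidence₂₅ ∷ coincidence₃₄ ∷ coincidence₃₅ ∷ coincidence₄₅ ∷ []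

  NoDistinctSolutionᶻ : Set
  NoDistinctSolutionᶻ = ∀ {x₁ x₂ x₃ x₄ x₅} → x₁ ∈ A → x₂ ∈ A → x₃ ∈ A → x₄ ∈ A → x₅ ∈ A →
    x₁ ≢ x₂ → x₁ ≢ x₃ → x₁ ≢ x₄ → x₁ ≢ x₅ → x₂ ≢ x₃ → x₂ ≢ x₄ → x₂ ≢ x₅ → x₃ ≢ x₄ → x₃ ≢ x₅ → x₄ ≢ x₅ →
    form₁₂ (x₁ , x₂) ℤ.+ form₃₄ (x₃ , x₄) ℤ.+ σ ℤ.* x₅ ≢ + 0

  few-solutions : NoDistinctSolutionᶻ → solutions (+ 0) ≤ 20 * sq a
  few-solutions none = conclude (pigeonhole Coincidence.equal? coincidence₁₂ coincidences solution-list cover)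
    where
    lemma : ∀ x → 10 * (2 * x) ≡ 20 * x
    lemma = solve-∀
    Covered : Tuple → Set
    Covered i = ∃[ c ] (c ∈ coincidence₁₂ ∷ coincidences × Coincidence.Equal c i)
    distinct : ∀ {i} → (∀ n → at n i ∈ A) → evaluate i ≡ + 0 → ¬ Any (λ c → Coincidence.Equal c i) (coincidence₁₂ ∷ coincidences) → ⊥
    distinct at∈ vanishes ¬some = none (at∈ p₁) (at∈ p₂) (at∈ p₃) (at∈ p₄) (at∈ p₅)
      (λ eq → ¬some (here eq))
      (λ eq → ¬some (there (here eq)))
      (λ eq → ¬some (there (there (here eq))))
      (λ eq → ¬some (there (there (there (here eq)))))
      (λ eq → ¬some (there (there (there (there (here eq))))))
      (λ eq → ¬some (there (there (there (there (there (here eq)))))))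
      (λ eq → ¬some (there (there (there (there (there (there (here eq))))))))
      (λ eq → ¬some (there (there (there (there (there (there (there (here eq)))))))))
      (λ eq → ¬some (there (there (there (there (there (there (there (there (here eq))))))))))
      (λ eq → ¬some (there (there (there (there (there (there (there (there (there (here eq)))))))))))
      vanishes
    cover : ∀ {i} → i ∈ solution-list → Covered i
    cover {i} i∈ = decide (any? (λ c → Coincidence.equal? c i) (coincidence₁₂ ∷ coincidences))
      where
      decide : Dec (Any (λ c → Coincidence.Equal c i) (coincidence₁₂ ∷ coincidences)) → Covered i
      decide (yes some) = find some
      decide (no ¬some) = let (i∈tuples , vanishes) = ∈-filter⁻ solution? {xs = tuples} i∈
        in ⊥-elim (distinct (at-∈ i∈tuples) vanishes ¬some)
    conclude : ∃[ c ] (c ∈ coincidence₁₂ ∷ coincidences ×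
      length solution-list ≤ suc (length coincidences) * length (filter (Coincidence.equal? c) solution-list)) → _
    conclude (c , _ , many) = ≤-trans solutions-length (≤-trans many (≤-trans (*-monoʳ-≤ 10 (coincidence-length c))
      (≤-reflexive (lemma (sq a)))))

-- The upper bound

^-distribʳ-* : ∀ n x y → (x * y) ^ n ≡ x ^ n * y ^ n
^-distribʳ-* zero    x y = refl
^-distribʳ-* (suc n) x y = trans (cong (x * y *_) (^-distribʳ-* n x y)) (lemma x y (x ^ n) (y ^ n))
  where
  lemma : ∀ x y u v → x * y * (u * v) ≡ x * u * (y * v)
  lemma = solve-∀

-- The parameters compare as a³ E ≲ c (E s + 2 S a³) with E ≥ 4 S c, so s ≤ 20 a² bounds a.
final-comparison : ∀ {a L τ C ρ Z K E s S c} → 1 ≤ a → 1 ≤ L → 1 ≤ E → ρ ≤ C * sq a → sq a ≤ K * τ →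
  τ * (τ * (τ * (sq a * ((a * L) * ((a * L) * ((a * L) * ((a * L) * (a * L)))))))) ≤ 16 * ((4 * ρ) ^ 5 * Z) →
  E * Z ≤ L * (L * (L * (L * (L * (E * s + 2 * S * (a * sq a)))))) →
  c ≡ 16 * (4 * C) ^ 5 * (K * (K * K)) → 4 * S * c ≤ E → s ≤ 20 * sq a → a ≤ 40 * c
final-comparison {a} {L} {τ} {C} {ρ} {Z} {K} {E} {s} {S} {c} 1≤a 1≤L 1≤E ρ≤ x≤Kτ Z≥ Z≤ c≡ E≥ s≤ =
  *-cancelʳ-≤ a (40 * c) (E * x) ⦃ >-nonZero (*-mono-≤ 1≤E 1≤x) ⦄ (begin
    a * (E * x)                       ≡⟨ lemma₁ a E x ⟩
    E * (a * x)                       ≤⟨ +-cancelʳ-≤ (E * (a * x)) _ _ doubled ⟩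
    2 * c * (E * s)                   ≤⟨ *-monoʳ-≤ (2 * c) (*-monoʳ-≤ E s≤) ⟩
    2 * c * (E * (20 * x))            ≡⟨ lemma₂ c E x ⟩
    40 * c * (E * x)                  ∎)
  where
  open ≤-Reasoning
  x = sq a
  1≤x : 1 ≤ x
  1≤x = *-mono-≤ 1≤a 1≤a
  L⁵ = L * (L * (L * (L * L)))
  Y = x * (x * (x * (x * (a * (a * L⁵)))))
  lemma₁ : ∀ a e x → a * (e * x) ≡ e * (a * x)
  lemma₁ = solve-∀
  lemma₂ : ∀ c e x → 2 * c * (e * (20 * x)) ≡ 40 * c * (e * x)
  lemma₂ = solve-∀
  lemma₃ : ∀ a L e → e * (a * (a * a)) * (a * a * (a * a * (a * a * (a * a * (a * (a * (L * (L * (L * (L * L)))))))))) ≡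
    e * ((a * a) * ((a * a) * (a * a)) * (a * a * ((a * L) * ((a * L) * ((a * L) * ((a * L) * (a * L)))))))
  lemma₃ = solve-∀
  lemma₄ : ∀ k t e m → e * (k * t * (k * t * (k * t)) * m) ≡ e * (k * (k * k) * (t * (t * (t * m))))
  lemma₄ = solve-∀
  lemma₅ : ∀ k e r z → e * (k * (16 * (r * z))) ≡ 16 * r * k * (e * z)
  lemma₅ = solve-∀
  lemma₆ : ∀ a L q k v → 16 * (q * (a * a * (a * a * (a * a * (a * a * (a * a * 1)))))) * k * (L * (L * (L * (L * (L * v)))))
    ≡ 16 * q * k * v * (a * a * (a * a * (a * a * (a * a * (a * (a * (L * (L * (L * (L * L))))))))))
  lemma₆ = solve-∀
  ρ⁵≤ : (4 * ρ) ^ 5 ≤ (4 * C) ^ 5 * x ^ 5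
  ρ⁵≤ = begin
    (4 * ρ) ^ 5              ≤⟨ ^-monoˡ-≤ 5 (*-monoʳ-≤ 4 ρ≤) ⟩
    (4 * (C * x)) ^ 5        ≡⟨ cong (_^ 5) (sym (*-assoc 4 C x)) ⟩
    (4 * C * x) ^ 5          ≡⟨ ^-distribʳ-* 5 (4 * C) x ⟩
    (4 * C) ^ 5 * x ^ 5      ∎
  v = E * s + 2 * S * (a * x)
  β = (a * L) * ((a * L) * ((a * L) * ((a * L) * (a * L))))
  balanced : E * (a * x) ≤ c * v
  balanced = *-cancelʳ-≤ (E * (a * x)) (c * v) Y ⦃ Y≢0 ⦄ (begin
    E * (a * x) * Y
      ≡⟨ lemma₃ a L E ⟩
    E * (x * (x * x) * (x * β))
      ≤⟨ *-monoʳ-≤ E (*-monoˡ-≤ (x * β) (*-mono-≤ x≤Kτ (*-mono-≤ x≤Kτ x≤Kτ))) ⟩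
    E * (K * τ * (K * τ * (K * τ)) * (x * β))
      ≡⟨ lemma₄ K τ E (x * β) ⟩
    E * (K * (K * K) * (τ * (τ * (τ * (x * β)))))
      ≤⟨ *-monoʳ-≤ E (*-monoʳ-≤ (K * (K * K)) Z≥) ⟩
    E * (K * (K * K) * (16 * ((4 * ρ) ^ 5 * Z)))
      ≡⟨ lemma₅ (K * (K * K)) E ((4 * ρ) ^ 5) Z ⟩
    16 * (4 * ρ) ^ 5 * (K * (K * K)) * (E * Z)
      ≤⟨ *-mono-≤ (*-monoˡ-≤ (K * (K * K)) (*-monoʳ-≤ 16 ρ⁵≤)) Z≤ ⟩
    16 * ((4 * C) ^ 5 * x ^ 5) * (K * (K * K)) * (L * (L * (L * (L * (L * v)))))
      ≡⟨ lemma₆ a L ((4 * C) ^ 5) (K * (K * K)) v ⟩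
    16 * (4 * C) ^ 5 * (K * (K * K)) * v * Y
      ≡⟨ cong (λ k → k * v * Y) c≡ ⟨
    c * v * Y
      ∎)
    where
    Y≢0 : NonZero Y
    Y≢0 = >-nonZero (*-mono-≤ 1≤x (*-mono-≤ 1≤x (*-mono-≤ 1≤x (*-mono-≤ 1≤x (*-mono-≤ 1≤a (*-mono-≤ 1≤a
      (*-mono-≤ 1≤L (*-mono-≤ 1≤L (*-mono-≤ 1≤L (*-mono-≤ 1≤L 1≤L))))))))))
  lemma₇ : ∀ y → y + y ≡ 2 * y
  lemma₇ = solve-∀
  lemma₈ : ∀ c u S y → 2 * (c * (u + 2 * S * y)) ≡ 2 * c * u + 4 * S * c * y
  lemma₈ = solve-∀
  doubled : E * (a * x) + E * (a * x) ≤ 2 * c * (E * s) + E * (a * x)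
  doubled = begin
    E * (a * x) + E * (a * x)                 ≡⟨ lemma₇ (E * (a * x)) ⟩
    2 * (E * (a * x))                         ≤⟨ *-monoʳ-≤ 2 balanced ⟩
    2 * (c * v)                               ≡⟨ lemma₈ c (E * s) S (a * x) ⟩
    2 * c * (E * s) + 4 * S * c * (a * x)     ≤⟨ +-monoʳ-≤ (2 * c * (E * s)) (*-monoˡ-≤ (a * x) E≥) ⟩
    2 * c * (E * s) + E * (a * x)             ∎

abstract
  scarcity : ℕ → ℕ → ℕ → ℕ
  scarcity C₁ u₀ E = 2 * u₀ * capacity C₁ (2 * sq E)

  scarcity-≡ : ∀ C₁ u₀ E → scarcity C₁ u₀ E ≡ 2 * u₀ * capacity C₁ (2 * sq E)
  scarcity-≡ C₁ u₀ E = refl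

  loss : ℕ → ℕ → ℕ → ℕ → ℕ
  loss C₁ C₂ u₀ E = 16 * (4 * C₂) ^ 5 * (scarcity C₁ u₀ E * (scarcity C₁ u₀ E * scarcity C₁ u₀ E))

  loss-≡ : ∀ C₁ C₂ u₀ E →
    loss C₁ C₂ u₀ E ≡ 16 * (4 * C₂) ^ 5 * (scarcity C₁ u₀ E * (scarcity C₁ u₀ E * scarcity C₁ u₀ E))
  loss-≡ C₁ C₂ u₀ E = refl

module Core (𝒮 : SidonSystem) (C₁ C₂ Q u₀ : ℕ) (scale : ℕ → ℕ) where

  private
    B : ℕ
    B = SidonSystem.P 𝒮 + sq (length (SidonSystem.A 𝒮))

  open Transfer 𝒮 B public
  open Degenerate 𝒮 using (NoDistinctSolutionᶻ; few-solutions)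

  K : ℕ → ℕ
  K = scarcity C₁ u₀

  coarse-scale : ℕ → ℕ
  coarse-scale j = S * (2 * scale j)

  c : ℕ → ℕ
  c j = loss C₁ C₂ u₀ (coarse-scale j)

  shifts : List ℤ → List ℤ
  shifts T = map shift₁ T ++ (map (λ (t , u) → shift₂ t u) (cartesianProduct T T)
    ++ (map (λ (t , u) → shift₃ t u) (cartesianProduct T T) ++ map shift₄ T))

  module _ {T : List ℤ} where

    ∈-shifts₁ : ∀ {t} → t ∈ T → shift₁ t ∈ shifts T
    ∈-shifts₁ t∈ = ∈-++⁺ˡ (∈-map⁺ shift₁ t∈)

    ∈-shifts₂ : ∀ {t u} → t ∈ T → u ∈ T → shift₂ t u ∈ shifts T
    ∈-shifts₂ t∈ u∈ = ∈-++⁺ʳ (map shift₁ T) (∈-++⁺ˡ (∈-map⁺ (λ (t , u) → shift₂ t u) (∈-cartesianProduct⁺ t∈ u∈)))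

    ∈-shifts₃ : ∀ {t u} → t ∈ T → u ∈ T → shift₃ t u ∈ shifts T
    ∈-shifts₃ t∈ u∈ = ∈-++⁺ʳ (map shift₁ T) (∈-++⁺ʳ (map (λ (t , u) → shift₂ t u) (cartesianProduct T T))
      (∈-++⁺ˡ (∈-map⁺ (λ (t , u) → shift₃ t u) (∈-cartesianProduct⁺ t∈ u∈))))

    ∈-shifts₄ : ∀ {t} → t ∈ T → shift₄ t ∈ shifts T
    ∈-shifts₄ t∈ = ∈-++⁺ʳ (map shift₁ T) (∈-++⁺ʳ (map (λ (t , u) → shift₂ t u) (cartesianProduct T T))
      (∈-++⁺ʳ (map (λ (t , u) → shift₃ t u) (cartesianProduct T T)) (∈-map⁺ shift₄ t∈)))

    shifts-elim : ∀ (R : ℤ → Set) → (∀ {t} → t ∈ T → R (shift₁ t)) → (∀ {t u} → t ∈ T → u ∈ T → R (shift₂ t u)) →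
      (∀ {t u} → t ∈ T → u ∈ T → R (shift₃ t u)) → (∀ {t} → t ∈ T → R (shift₄ t)) → ∀ {d} → d ∈ shifts T → R d
    shifts-elim R r₁ r₂ r₃ r₄ d∈ with ∈-++⁻ (map shift₁ T) d∈
    ... | inj₁ d∈₁ with ∈-map⁻ shift₁ d∈₁
    ...   | t , t∈ , refl = r₁ t∈
    shifts-elim R r₁ r₂ r₃ r₄ d∈ | inj₂ d∈′ with ∈-++⁻ (map (λ (t , u) → shift₂ t u) (cartesianProduct T T)) d∈′
    ... | inj₁ d∈₂ with ∈-map⁻ (λ (t , u) → shift₂ t u) d∈₂
    ...   | (t , u) , tu∈ , refl = let (t∈ , u∈) = ∈-cartesianProduct⁻ T T tu∈ in r₂ t∈ u∈
    shifts-elim R r₁ r₂ r₃ r₄ d∈ | inj₂ d∈′ | inj₂ d∈″ with ∈-++⁻ (map (λ (t , u) → shift₃ t u) (cartesianProduct T T)) d∈″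
    ... | inj₁ d∈₃ with ∈-map⁻ (λ (t , u) → shift₃ t u) d∈₃
    ...   | (t , u) , tu∈ , refl = let (t∈ , u∈) = ∈-cartesianProduct⁻ T T tu∈ in r₃ t∈ u∈
    shifts-elim R r₁ r₂ r₃ r₄ d∈ | inj₂ d∈′ | inj₂ d∈″ | inj₂ d∈₄ with ∈-map⁻ shift₄ d∈₄
    ...   | t , t∈ , refl = r₄ t∈

    private
      instance
        S≢0 : NonZero S
        S≢0 = >-nonZero 1≤S

      a₄+a₂≤S : a₄ + a₂ ≤ S
      a₄+a₂≤S = ≤-trans (m≤m+n (a₄ + a₂) (a₁ + a₃)) (≤-reflexive (lemma a₁ a₂ a₃ a₄))
        where
        lemma : ∀ x y z t → t + y + (x + z) ≡ x + y + z + t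
        lemma = solve-∀
      a₃+a₁≤S : a₃ + a₁ ≤ S
      a₃+a₁≤S = ≤-trans (m≤m+n (a₃ + a₁) (a₂ + a₄)) (≤-reflexive (lemma a₁ a₂ a₃ a₄))
        where
        lemma : ∀ x y z t → z + x + (y + t) ≡ x + y + z + t
        lemma = solve-∀
      a₃≤S : a₃ ≤ S
      a₃≤S = ≤-trans (m≤m+n a₃ a₁) a₃+a₁≤S
      a₂≤S : a₂ ≤ S
      a₂≤S = ≤-trans (m≤n+m a₂ a₄) a₄+a₂≤S

      *1 : ∀ {b} → b ≤ S → b * 1 ≤ S
      *1 {b} b≤S = ≤-trans (≤-reflexive (*-identityʳ b)) b≤S

      *1+*1 : ∀ {b c} → b + c ≤ S → b * 1 + c * 1 ≤ S
      *1+*1 {b} {c} le = ≤-trans (≤-reflexive (cong₂ _+_ (*-identityʳ b) (*-identityʳ c))) le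

    shifts-period : ∀ {E} → (∀ {t} → t ∈ T → AP 1 (S * E) t) → ∀ {d} → d ∈ shifts T → AP 1 E d
    shifts-period {E} ap = shifts-elim (AP 1 E)
      (λ t∈ → AP-reduce S (AP-weaken (*1 a₃≤S) ≤-refl (AP-neg (AP-* a₃ (ap t∈)))))
      (λ t∈ u∈ → AP-reduce S (AP-weaken (*1+*1 {a₄} {a₂} a₄+a₂≤S) ≤-refl (AP-+ (AP-* a₄ (ap u∈)) (AP-neg (AP-* a₂ (ap t∈))))))
      (λ t∈ u∈ → AP-reduce S (AP-weaken (*1+*1 {a₃} {a₁} a₃+a₁≤S) ≤-refl (AP-+ (AP-* a₃ (ap u∈)) (AP-neg (AP-* a₁ (ap t∈))))))
      (λ t∈ → AP-reduce S (AP-weaken (*1 a₂≤S) ≤-refl (AP-* a₂ (ap t∈))))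

    shifts-short : ∀ {W} → (∀ {t} → t ∈ T → ℤ.∣ t ∣ ≤ W) → ∀ {d} → d ∈ shifts T → ℤ.∣ d ∣ ≤ S * W
    shifts-short {W} short = shifts-elim (λ d → ℤ.∣ d ∣ ≤ S * W)
      (λ {t} t∈ → ≤-trans (≤-reflexive (ℤ.∣-i∣≡∣i∣ (+ a₃ ℤ.* t))) (≤-trans (scaled a₃ t∈) (*-monoˡ-≤ W a₃≤S)))
      (λ t∈ u∈ → difference a₄ a₂ a₄+a₂≤S u∈ t∈)
      (λ t∈ u∈ → difference a₃ a₁ a₃+a₁≤S u∈ t∈)
      (λ t∈ → ≤-trans (scaled a₂ t∈) (*-monoˡ-≤ W a₂≤S))
      where
      scaled : ∀ b {t} → t ∈ T → ℤ.∣ + b ℤ.* t ∣ ≤ b * W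
      scaled b {t} t∈ = ≤-trans (≤-reflexive (ℤ.abs-* (+ b) t)) (*-monoʳ-≤ b (short t∈))
      difference : ∀ b c → b + c ≤ S → ∀ {u t} → u ∈ T → t ∈ T → ℤ.∣ + b ℤ.* u ℤ.- + c ℤ.* t ∣ ≤ S * W
      difference b c b+c≤S {u} {t} u∈ t∈ = ≤-trans (ℤ.∣i-j∣≤∣i∣+∣j∣ (+ b ℤ.* u) (+ c ℤ.* t))
        (≤-trans (+-mono-≤ (scaled b u∈) (scaled c t∈))
        (≤-trans (≤-reflexive (sym (*-distribʳ-+ W b c))) (*-monoˡ-≤ W b+c≤S)))

module Contradiction (𝒮 : SidonSystem) (C₁ C₂ Q u₀ : ℕ) (scale : ℕ → ℕ) where

  open Core 𝒮 C₁ C₂ Q u₀ scale public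
  open Degenerate 𝒮 using (NoDistinctSolutionᶻ; few-solutions)

  module _
    (ρ≤ : ρ ≤ C₁ * sq a) (ρI≤ : ρI ≤ C₂ * sq a) (1≤C₂ : 1 ≤ C₂) (Q≡ : Q ≡ 1024 * sq C₂)
    (u₀≡ : u₀ ≡ suc (8 * Q * S)) (a²≤P : sq a ≤ P)
    (1≤scale : ∀ j → 1 ≤ scale j) (scale-grows : ∀ j → 2 * scale j + 4 * S * c j ≤ scale (suc j))
    (u₀≤a : u₀ ≤ a) (a-fine : 8 * (2 * sq (scale (8 * Q))) ≤ a) (K-fine : K (scale (8 * Q)) ≤ a)
    (a-coarse : ∀ {j} → j < 8 * Q → 8 * (2 * sq (coarse-scale j)) ≤ a)
    (a-large : ∀ {j} → j < 8 * Q → 40 * c j < a)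
    (none : NoDistinctSolutionᶻ) where

    private
      1≤u₀ : 1 ≤ u₀
      1≤u₀ = subst (1 ≤_) (sym u₀≡) (s≤s z≤n)

      1≤a : 1 ≤ a
      1≤a = ≤-trans 1≤u₀ u₀≤a

      instance
        u₀≢0 : NonZero u₀
        u₀≢0 = >-nonZero 1≤u₀
        a≢0 : NonZero a
        a≢0 = >-nonZero 1≤a

      W : ℕ
      W = sq a / u₀

      u₀W≤a² : u₀ * W ≤ sq a
      u₀W≤a² = ≤-trans (≤-reflexive (*-comm u₀ W)) (m/n*n≤m (sq a) u₀)

      1≤W : 1 ≤ W
      1≤W = m≥n⇒m/n>0 (≤-trans u₀≤a (m≤m*n a a))

      a²≤2u₀W : sq a ≤ 2 * u₀ * W
      a²≤2u₀W = begin
        sq a                          ≡⟨ m≡m%n+[m/n]*n (sq a) u₀ ⟩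
        sq a % u₀ + W * u₀            ≤⟨ +-monoˡ-≤ (W * u₀) (<⇒≤ (m%n<n (sq a) u₀)) ⟩
        u₀ + W * u₀
          ≤⟨ +-monoˡ-≤ (W * u₀) (≤-trans (≤-reflexive (sym (*-identityˡ u₀))) (*-monoˡ-≤ u₀ 1≤W)) ⟩
        W * u₀ + W * u₀               ≡⟨ lemma W u₀ ⟩
        2 * u₀ * W                    ∎
        where
        open ≤-Reasoning
        lemma : ∀ w u → w * u + w * u ≡ 2 * u * w
        lemma = solve-∀

      many : ∀ E {n} → W ≤ capacity C₁ (2 * sq E) * n → sq a ≤ K E * n
      many E {n} W≤ = ≤-trans a²≤2u₀W (≤-trans (*-monoʳ-≤ (2 * u₀) W≤) (≤-reflexive
        (trans (sym (*-assoc (2 * u₀) _ n)) (cong (_* n) (sym (scarcity-≡ C₁ u₀ E))))))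

      W≤P : W ≤ P
      W≤P = ≤-trans (m/n≤m (sq a) u₀) a²≤P

      Periods : ℕ → Set
      Periods E = ManyAlmostPeriods (capacity C₁ (2 * sq E)) E W

      coarse : ∀ j → j < 8 * Q → Periods (coarse-scale j)
      coarse j j<8Q = almost-periods {C₁} {coarse-scale j} W ρ≤ 1≤a (a-coarse j<8Q) W≤P

      initial : Periods (scale (8 * Q))
      initial = almost-periods {C₁} {scale (8 * Q)} W ρ≤ 1≤a a-fine W≤P

      D′ : ∀ j → Dec (j < 8 * Q) → List ℤ
      D′ j (yes j<8Q) = shifts (proj₁ (coarse j j<8Q))
      D′ j (no _)     = []

      D : ℕ → List ℤ
      D j = D′ j (j <? 8 * Q)

      D-period : ∀ {j d} (j<? : Dec (j < 8 * Q)) → d ∈ D′ j j<? → AP 1 (2 * scale j) d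
      D-period {j} (yes j<8Q) = shifts-period (λ t∈ → proj₂ (proj₁ (proj₂ (proj₂ (coarse j j<8Q))) t∈))

      D-short : ∀ {j d} (j<? : Dec (j < 8 * Q)) → d ∈ D′ j j<? → ℤ.∣ d ∣ ≤ S * W
      D-short {j} (yes j<8Q) = shifts-short (λ t∈ → proj₁ (proj₁ (proj₂ (proj₂ (coarse j j<8Q))) t∈))

    private module Step = Decrement 𝒮 (P + sq a) (S * W) Q scale D

    private
      1≤Q : 1 ≤ Q
      1≤Q = subst (1 ≤_) (sym Q≡) (*-mono-≤ {1} {1024} (s≤s z≤n) (*-mono-≤ 1≤C₂ 1≤C₂))

      regular : Step.Regular
      regular = start (8 * Q) refl initial
        where
        start : ∀ n → n ≡ 8 * Q → Periods (scale n) → Step.Regular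
        start zero    0≡ _ = contradiction (≤-trans (*-mono-≤ {1} {8} (s≤s z≤n) 1≤Q) (≤-reflexive (sym 0≡))) (λ ())
        start (suc j) j≡ (T , uniqueT , props , W≤) = Step.decrement
          (λ i → ≤-trans (m≤m+n (2 * scale i) (4 * S * c i)) (scale-grows i))
          (λ {i} _ → D-period (i <? 8 * Q)) (λ {i} _ → D-short (i <? 8 * Q))
          j (≤-reflexive j≡) 1≤Q T (≤-trans 1≤a a≤T) small (λ t∈ → proj₂ (props t∈)) supported
          where
          open ≤-Reasoning
          a≤T : a ≤ length T
          a≤T = *-cancelˡ-≤ a (≤-trans (many (scale (suc j)) W≤)
            (*-monoˡ-≤ (length T) (subst (λ n → K (scale n) ≤ a) (sym j≡) K-fine)))
          supported : ∀ {t} → t ∈ T → P + ℤ.∣ t ∣ + suc j * (S * W) ≤ P + sq a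
          supported {t} t∈ = begin
            P + ℤ.∣ t ∣ + suc j * (S * W)
              ≤⟨ +-mono-≤ (+-monoʳ-≤ P (proj₁ (props t∈))) (≤-reflexive (cong (_* (S * W)) j≡)) ⟩
            P + W + 8 * Q * (S * W)            ≡⟨ lemma P W (8 * Q) S ⟩
            P + suc (8 * Q * S) * W            ≡⟨ cong (λ u → P + u * W) (sym u₀≡) ⟩
            P + u₀ * W                         ≤⟨ +-monoʳ-≤ P u₀W≤a² ⟩
            P + sq a                           ∎
            where
            lemma : ∀ p w q s → p + w + q * (s * w) ≡ p + (1 + q * s) * w
            lemma = solve-∀
          small : 4 * Q * Step.energy T ≤ suc j * sq (length T)
          small = begin
            4 * Q * Step.energy T                 ≤⟨ *-monoʳ-≤ (4 * Q) (Step.initial-energy uniqueT a≤T) ⟩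
            4 * Q * (2 * sq (length T))          ≡⟨ lemma Q (sq (length T)) ⟩
            8 * Q * sq (length T)                ≡⟨ cong (_* sq (length T)) (sym j≡) ⟩
            suc j * sq (length T)                ∎
            where
            lemma : ∀ q l → 4 * q * (2 * l) ≡ 8 * q * l
            lemma = solve-∀

      open Step.Regular regular

      finish : (j<? : Dec (j < 8 * Q)) → (∀ {d} → d ∈ D′ j j<? → Q * variation ν d ≤ sq (length ν)) → ⊥
      finish (no j≮) _ = j≮ j<8Q
      finish (yes j<) stable = contradiction
        (final-comparison {C = C₂} {ρ = ρI} {Z = Z} {K = K (coarse-scale j)} {E = scale (suc j)} {S = S}
          1≤a nonempty (1≤scale (suc j)) ρI≤ (many (coarse-scale j) W≤) lower upper (loss-≡ C₁ C₂ u₀ (coarse-scale j))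
          (≤-trans (m≤n+m (4 * S * c j) (2 * scale j)) (scale-grows j)) (few-solutions none))
        (<⇒≱ (a-large j<))
        where
        open ≤-Reasoning
        T = proj₁ (coarse j j<)
        uniqueT = proj₁ (proj₂ (coarse j j<))
        W≤ = proj₂ (proj₂ (proj₂ (coarse j j<)))
        τ = length T
        L = length ν
        β = (a * L) * ((a * L) * ((a * L) * ((a * L) * (a * L))))
        f : Index → ℕ
        f i = F ν (y₀ i) * (F ν (y₁ i) * (F ν (y₂ i) * (F ν (y₃ i) * F ν (y₄ i))))
        Z : ℕ
        Z = ∑ (index uniqueT ν) f
        r = (4 * ρI) ^ 5
        upper : scale (suc j) * Z ≤ L * (L * (L * (L * (L * (scale (suc j) * solutions (+ 0) + 2 * S * (a * sq a))))))
        upper = five-fold-fine uniqueT ν {scale (suc j)} fine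
        one : ∀ {t₁ t₂ t₃} → t₁ ∈ T → t₂ ∈ T → t₃ ∈ T → sq a * β ≤ 16 * (r * ∑ I (λ x → f (t₁ , t₂ , t₃ , x)))
        one {t₁} {t₂} {t₃} t₁∈ t₂∈ t₃∈ = fiveFold-sum 1≤a ρI≤ nonempty supported energy-≤
          (shift₁ t₃) (shift₂ t₂ t₃) (shift₃ t₁ t₂) (shift₄ t₁) Q≡ 1≤C₂
          (stable (∈-shifts₁ t₃∈)) (stable (∈-shifts₂ t₂∈ t₃∈)) (stable (∈-shifts₃ t₁∈ t₂∈)) (stable (∈-shifts₄ t₁∈))
        collect : ∀ {n} (g : ℤ → ℕ) → (∀ {t} → t ∈ T → n ≤ 16 * (r * g t)) → τ * n ≤ 16 * (r * ∑ T g)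
        collect {n} g le = begin
          τ * n                               ≡⟨ ∑-const T n ⟨
          ∑ T (λ _ → n)                       ≤⟨ ∑-mono-∈ T le ⟩
          ∑ T (λ t → 16 * (r * g t))          ≡⟨ trans (∑-*ˡ T 16 (λ t → r * g t)) (cong (16 *_) (∑-*ˡ T r g)) ⟩
          16 * (r * ∑ T g)                    ∎
        lower : τ * (τ * (τ * (sq a * β))) ≤ 16 * (r * Z)
        lower = begin
          τ * (τ * (τ * (sq a * β)))
            ≤⟨ collect _ (λ t₁∈ → collect _ (λ t₂∈ → collect _ (λ t₃∈ → one t₁∈ t₂∈ t₃∈))) ⟩
          16 * (r * ∑ T (λ t₁ → ∑ T (λ t₂ → ∑ T (λ t₃ → ∑ I (λ x → f (t₁ , t₂ , t₃ , x))))))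
            ≡⟨ cong (λ z → 16 * (r * z)) (trans (∑-× T (cartesianProduct T (cartesianProduct T I)) f)
                 (∑-cong T (λ t₁ → trans (∑-× T (cartesianProduct T I) (λ i → f (t₁ , i)))
                 (∑-cong T (λ t₂ → ∑-× T I (λ i → f (t₁ , t₂ , i))))))) ⟨
          16 * (r * Z)
            ∎

    contradictory : ⊥
    contradictory = finish (j <? 8 * Q) (λ d∈ → invariant d∈)

Sidon⇒Sidonᶻ : ∀ {A} → Sidon A → Sidonᶻ (map (λ n → + n) A)
Sidon⇒Sidonᶻ sidonA x∈ y∈ z∈ w∈ eq
  with ∈-map⁻ (λ n → + n) x∈ | ∈-map⁻ (λ n → + n) y∈ | ∈-map⁻ (λ n → + n) z∈ | ∈-map⁻ (λ n → + n) w∈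
... | x , x∈A , refl | y , y∈A , refl | z , z∈A , refl | w , w∈A , refl with sidonA x∈A y∈A z∈A w∈A (ℤ.+-injective eq)
...   | inj₁ (refl , refl) = inj₁ (refl , refl)
...   | inj₂ (refl , refl) = inj₂ (refl , refl)

module UpperBound {a₁ a₂ a₃ a₄ D : ℕ} (1≤a₁ : 1 ≤ a₁) (1≤a₂ : 1 ≤ a₂) (1≤a₃ : 1 ≤ a₃) (1≤a₄ : 1 ≤ a₄) (1≤D : 1 ≤ D)
  {C₁ C₂ Q u₀ : ℕ} (C₁≡ : C₁ ≡ 1 + 6 * (a₁ + a₂ + a₃ + a₄) * D) (C₂≡ : C₂ ≡ 3 + 2 * D)
  (Q≡ : Q ≡ 1024 * sq C₂) (u₀≡ : u₀ ≡ suc (8 * Q * (a₁ + a₂ + a₃ + a₄))) where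

  private
    S : ℕ
    S = a₁ + a₂ + a₃ + a₄

  K : ℕ → ℕ
  K = scarcity C₁ u₀

  c : ℕ → ℕ
  c e = loss C₁ C₂ u₀ (S * (2 * e))

  scale : ℕ → ℕ
  scale zero    = 1
  scale (suc j) = 2 * scale j + 4 * S * c (scale j)

  1≤scale : ∀ j → 1 ≤ scale j
  1≤scale zero    = ≤-refl
  1≤scale (suc j) = ≤-trans (1≤scale j) (≤-trans (m≤n*m (scale j) 2) (m≤m+n (2 * scale j) _))

  coarse-bound : ℕ → ℕ
  coarse-bound j = 8 * (2 * sq (S * (2 * scale j))) + suc (40 * c (scale j))

  fine-bound : ℕ
  fine-bound = u₀ + (8 * (2 * sq (scale (8 * Q))) + K (scale (8 * Q)))

  threshold : ℕ
  threshold = fine-bound + ∑ (upTo (8 * Q)) coarse-bound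

  module _ {A : List ℕ} (uniqueA : Unique A) (sidonA : Sidon A) (none : NoDistinctSolution a₁ a₂ a₃ a₄ A)
           (bounded : ∀ {x} → x ∈ A → x ≤ D * sq (length A)) where

    private
      A′ : List ℤ
      A′ = map (λ n → + n) A

      length-A′ : length A′ ≡ length A
      length-A′ = length-map (λ n → + n) A

      system : SidonSystem
      system = record
        { A = A′ ; uniqueA = Unique.map⁺ ℤ.+-injective uniqueA ; sidonA = Sidon⇒Sidonᶻ sidonA
        ; a₁ = a₁ ; a₂ = a₂ ; a₃ = a₃ ; a₄ = a₄
        ; 1≤a₁ = 1≤a₁ ; 1≤a₂ = 1≤a₂ ; 1≤a₃ = 1≤a₃ ; 1≤a₄ = 1≤a₄
        ; P = D * sq (length A′)
        ; A-bounded = A′-bounded }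
        where
        A′-bounded : ∀ {x} → x ∈ A′ → ℤ.∣ x ∣ ≤ D * sq (length A′)
        A′-bounded x∈ with ∈-map⁻ (λ n → + n) x∈
        ... | n , n∈A , refl = subst (λ l → n ≤ D * sq l) (sym length-A′) (bounded n∈A)

      module C = Contradiction system C₁ C₂ Q u₀ scale

      none′ : Degenerate.NoDistinctSolutionᶻ system
      none′ x₁∈ x₂∈ x₃∈ x₄∈ x₅∈ n₁₂ n₁₃ n₁₄ n₁₅ n₂₃ n₂₄ n₂₅ n₃₄ n₃₅ n₄₅ eq
        with ∈-map⁻ (λ n → + n) x₁∈ | ∈-map⁻ (λ n → + n) x₂∈ | ∈-map⁻ (λ n → + n) x₃∈ | ∈-map⁻ (λ n → + n) x₄∈ | ∈-map⁻ (λ n → + n) x₅∈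
      ... | x₁ , p₁ , refl | x₂ , p₂ , refl | x₃ , p₃ , refl | x₄ , p₄ , refl | x₅ , p₅ , refl =
        none p₁ p₂ p₃ p₄ p₅ (lift n₁₂ , lift n₁₃ , lift n₁₄ , lift n₁₅ , lift n₂₃ , lift n₂₄ , lift n₂₅ , lift n₃₄ , lift n₃₅ , lift n₄₅)
          (ℤ.+-injective (≡-from eq (trans (cong₂ ℤ._-_ lhs (ℤ.pos-* S x₅))
            (lemma (+ a₁) (+ a₂) (+ a₃) (+ a₄) (+ S) (+ x₁) (+ x₂) (+ x₃) (+ x₄) (+ x₅)))))
        where
        lift : ∀ {m n} → + m ≢ + n → m ≢ n
        lift ≢ refl = ≢ refl
        lhs : + (a₁ * x₁ + a₂ * x₂ + a₃ * x₃ + a₄ * x₄)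
          ≡ + a₁ ℤ.* + x₁ ℤ.+ + a₂ ℤ.* + x₂ ℤ.+ + a₃ ℤ.* + x₃ ℤ.+ + a₄ ℤ.* + x₄
        lhs = trans (ℤ.pos-+ (a₁ * x₁ + a₂ * x₂ + a₃ * x₃) (a₄ * x₄)) (cong₂ ℤ._+_
          (trans (ℤ.pos-+ (a₁ * x₁ + a₂ * x₂) (a₃ * x₃)) (cong₂ ℤ._+_
            (trans (ℤ.pos-+ (a₁ * x₁) (a₂ * x₂)) (cong₂ ℤ._+_ (ℤ.pos-* a₁ x₁) (ℤ.pos-* a₂ x₂)))
            (ℤ.pos-* a₃ x₃))) (ℤ.pos-* a₄ x₄))
        lemma : ∀ b₁ b₂ b₃ b₄ s x₁ x₂ x₃ x₄ x₅ →
          b₁ ℤ.* x₁ ℤ.+ b₂ ℤ.* x₂ ℤ.+ b₃ ℤ.* x₃ ℤ.+ b₄ ℤ.* x₄ ℤ.- s ℤ.* x₅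
          ≡ b₁ ℤ.* x₁ ℤ.+ b₂ ℤ.* x₂ ℤ.+ (b₃ ℤ.* x₃ ℤ.+ b₄ ℤ.* x₄) ℤ.+ (ℤ.- s) ℤ.* x₅ ℤ.- + 0
        lemma = ℤ-Solver.solve-∀

    length-<-threshold : length A < threshold
    length-<-threshold with length A <? threshold
    ... | yes small = small
    ... | no ¬small = ⊥-elim (C.contradictory ρ≤ ρI≤ (subst (1 ≤_) (sym C₂≡) (s≤s z≤n)) Q≡ u₀≡ a²≤P
        1≤scale (λ j → ≤-refl)
        (≤-trans (m≤m+n u₀ _) fine≤a)
        (≤-trans (≤-trans (m≤m+n (8 * (2 * sq (scale (8 * Q)))) _) (m≤n+m _ u₀)) fine≤a)
        (≤-trans (≤-trans (m≤n+m (K (scale (8 * Q))) _) (m≤n+m _ u₀)) fine≤a)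
        (λ {j} j< → ≤-trans (m≤m+n (8 * (2 * sq (S * (2 * scale j)))) _) (coarse≤a j<))
        (λ {j} j< → ≤-trans (m≤n+m (suc (40 * c (scale j))) _) (coarse≤a j<))
        none′)
      where
      open ≤-Reasoning
      threshold≤a : threshold ≤ length A′
      threshold≤a = ≤-trans (≮⇒≥ ¬small) (≤-reflexive (sym length-A′))
      fine≤a : fine-bound ≤ length A′
      fine≤a = ≤-trans (m≤m+n fine-bound (∑ (upTo (8 * Q)) coarse-bound)) threshold≤a
      coarse≤a : ∀ {j} → j < 8 * Q → coarse-bound j ≤ length A′
      coarse≤a j< = ≤-trans (≤-∑ (upTo (8 * Q)) coarse-bound (∈-upTo⁺ j<))
        (≤-trans (m≤n+m (∑ (upTo (8 * Q)) coarse-bound) fine-bound) threshold≤a)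
      x : ℕ
      x = sq (length A′)
      1≤a : 1 ≤ length A′
      1≤a = ≤-trans (subst (1 ≤_) (sym u₀≡) (s≤s z≤n)) (≤-trans (m≤m+n u₀ _) fine≤a)
      1≤x : 1 ≤ x
      1≤x = *-mono-≤ 1≤a 1≤a
      ρ≤ : C.ρ ≤ C₁ * x
      ρ≤ = begin
        C.ρ                                        ≡⟨ length-interval (3 * (S * (D * x))) ⟩
        1 + (3 * (S * (D * x)) + 3 * (S * (D * x)))  ≤⟨ +-monoˡ-≤ _ 1≤x ⟩
        x + (3 * (S * (D * x)) + 3 * (S * (D * x)))  ≡⟨ lemma S D x ⟩
        (1 + 6 * S * D) * x                        ≡⟨ cong (_* x) C₁≡ ⟨
        C₁ * x                                     ∎
        where
        lemma : ∀ s d x → x + (3 * (s * (d * x)) + 3 * (s * (d * x))) ≡ (1 + 6 * s * d) * x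
        lemma = solve-∀
      ρI≤ : C.ρI ≤ C₂ * x
      ρI≤ = begin
        C.ρI                                       ≡⟨ length-interval (D * x + x) ⟩
        1 + (D * x + x + (D * x + x))              ≤⟨ +-monoˡ-≤ _ 1≤x ⟩
        x + (D * x + x + (D * x + x))              ≡⟨ lemma D x ⟩
        (3 + 2 * D) * x                            ≡⟨ cong (_* x) C₂≡ ⟨
        C₂ * x                                     ∎
        where
        lemma : ∀ d x → x + (d * x + x + (d * x + x)) ≡ (3 + 2 * d) * x
        lemma = solve-∀
      a²≤P : x ≤ D * x
      a²≤P = ≤-trans (≤-reflexive (sym (*-identityˡ x))) (*-monoˡ-≤ x 1≤D)

abstract
  sidon-upper-bound : ∀ {a₁ a₂ a₃ a₄} → 1 ≤ a₁ → 1 ≤ a₂ → 1 ≤ a₃ → 1 ≤ a₄ → ∀ D → 1 ≤ D →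
    ∃[ a₀ ] (∀ {A} → Unique A → Sidon A → NoDistinctSolution a₁ a₂ a₃ a₄ A →
      (∀ {x} → x ∈ A → x ≤ D * sq (length A)) → length A < a₀)
  sidon-upper-bound 1≤a₁ 1≤a₂ 1≤a₃ 1≤a₄ D 1≤D =
      UpperBound.threshold 1≤a₁ 1≤a₂ 1≤a₃ 1≤a₄ 1≤D refl refl refl refl
    , λ uniqueA sidonA none bounded →
        UpperBound.length-<-threshold 1≤a₁ 1≤a₂ 1≤a₃ 1≤a₄ 1≤D refl refl refl refl uniqueA sidonA none bounded

sidon-little-o : ∀ {a₁ a₂ a₃ a₄} → 1 ≤ a₁ → 1 ≤ a₂ → 1 ≤ a₃ → 1 ≤ a₄ → ∀ k →
  ∃[ N ] (∀ n → N ≤ n → ∀ A → Admissible a₁ a₂ a₃ a₄ n A → (suc k * suc k) * (length A * length A) ≤ n)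
sidon-little-o {a₁} {a₂} {a₃} {a₄} 1≤a₁ 1≤a₂ 1≤a₃ 1≤a₄ k with sidon-upper-bound 1≤a₁ 1≤a₂ 1≤a₃ 1≤a₄ (sq (suc k)) (s≤s z≤n)
... | a₀ , length<a₀ = sq (suc k) * sq a₀ , bound
  where
  bound : ∀ n → sq (suc k) * sq a₀ ≤ n → ∀ A → Admissible a₁ a₂ a₃ a₄ n A → sq (suc k) * sq (length A) ≤ n
  bound n N≤n A ((uniqueA , range) , sidonA , none) with sq (suc k) * sq (length A) ≤? n
  ... | yes small = small
  ... | no ¬small = ≤-trans (*-monoʳ-≤ (sq (suc k)) (*-mono-≤ a≤a₀ a≤a₀)) N≤n
    where
    a≤a₀ : length A ≤ a₀
    a≤a₀ = <⇒≤ (length<a₀ uniqueA sidonA none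
      (λ x∈ → ≤-trans (proj₂ (All.lookup range x∈)) (<⇒≤ (≰⇒> ¬small))))

-- Primes

-- The Beta integrals ℓ ∫ xⁱ (1 - x)ʲ = ℓ i! j! / (i + j + 1)! are integers b, and b (i , j) is the sum of
-- b (i + 1 , j) and b (i , j + 1); starting from b (0 , 0) = ℓ, each is at least 2ᵗ when i + j + t < n.
module CommonMultiple {n ℓ : ℕ} (1≤ℓ : 1 ≤ ℓ) (divisors : ∀ j → suc j ≤ n → suc j ∣ ℓ) where

  Beta : ℕ → ℕ → ℕ → Set
  Beta i j b = b * suc (i + j) ! ≡ ℓ * (i ! * j !)

  beta : ∀ i j → i + j < n → ∃[ b ] Beta i j b
  beta zero    j j<n with divisors j j<n
  ... | divides b ℓ≡ = b , trans (sym (*-assoc b (suc j) (j !))) (trans (cong (_* j !) (sym ℓ≡)) (cong (ℓ *_) (sym (*-identityˡ (j !)))))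
  beta (suc i) j i+j<n with beta i j (<-trans (n<1+n (i + j)) i+j<n) | beta i (suc j) (subst (_< n) (sym (+-suc i j)) i+j<n)
  ... | α , α≡ | β , β≡ = α ∸ β , (begin
    (α ∸ β) * suc (suc (i + j)) !
      ≡⟨ *-distribʳ-∸ (suc (suc (i + j)) !) α β ⟩
    α * suc (suc (i + j)) ! ∸ β * suc (suc (i + j)) !
      ≡⟨ cong₂ _∸_ (trans (lemma₁ α (2 + (i + j)) (suc (i + j) !)) (cong ((2 + (i + j)) *_) α≡))
                   (trans (cong (λ k → β * suc k !) (sym (+-suc i j))) β≡) ⟩
    (2 + (i + j)) * (ℓ * (i ! * j !)) ∸ ℓ * (i ! * (suc j * j !))
      ≡⟨ cong (_∸ ℓ * (i ! * (suc j * j !))) (lemma₂ i j ℓ (i !) (j !)) ⟩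
    ℓ * (suc i * i ! * j !) + ℓ * (i ! * (suc j * j !)) ∸ ℓ * (i ! * (suc j * j !))
      ≡⟨ m+n∸n≡m (ℓ * (suc i * i ! * j !)) (ℓ * (i ! * (suc j * j !))) ⟩
    ℓ * (suc i * i ! * j !)
      ∎)
    where
    open ≡-Reasoning
    lemma₁ : ∀ α k f → α * (k * f) ≡ k * (α * f)
    lemma₁ = solve-∀
    lemma₂ : ∀ i j l x y → (2 + (i + j)) * (l * (x * y)) ≡ l * ((1 + i) * x * y) + l * (x * ((1 + j) * y))
    lemma₂ = solve-∀

  beta-≥ : ∀ t i j {b} → i + j + t < n → Beta i j b → 2 ^ t ≤ b
  beta-≥ zero i j {zero} _ b≡ = contradiction b≡ (<⇒≢ (*-mono-≤ 1≤ℓ (*-mono-≤ (>-nonZero⁻¹ (i !) ⦃ i !≢0 ⦄) (>-nonZero⁻¹ (j !) ⦃ j !≢0 ⦄))))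
  beta-≥ zero i j {suc b} _ _ = s≤s z≤n
  beta-≥ (suc t) i j {b} large b≡ = extend (beta (suc i) j first) (beta i (suc j) second)
    where
    open ≤-Reasoning
    larger : suc (i + j + t) < n
    larger = subst (_< n) (+-suc (i + j) t) large
    first : suc i + j < n
    first = ≤-<-trans (s≤s (m≤m+n (i + j) t)) larger
    second : i + suc j < n
    second = subst (_< n) (sym (+-suc i j)) first
    larger′ : i + suc j + t < n
    larger′ = subst (λ k → k + t < n) (sym (+-suc i j)) larger
    lemma₁ : ∀ α k f → α * (k * f) ≡ k * (α * f)
    lemma₁ = solve-∀
    lemma₂ : ∀ i j l x y → (2 + (i + j)) * (l * (x * y)) ≡ l * ((1 + i) * x * y) + l * (x * ((1 + j) * y))
    lemma₂ = solve-∀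
    extend : ∃ (Beta (suc i) j) → ∃ (Beta i (suc j)) → 2 ^ suc t ≤ b
    extend (α , α≡) (β , β≡) = begin
      2 ^ t + (2 ^ t + 0)      ≡⟨ cong (λ s → 2 ^ t + s) (+-identityʳ (2 ^ t)) ⟩
      2 ^ t + 2 ^ t            ≤⟨ +-mono-≤ (beta-≥ t (suc i) j {α} larger α≡) (beta-≥ t i (suc j) {β} larger′ β≡) ⟩
      α + β                    ≡⟨ *-cancelʳ-≡ (α + β) b (suc (suc (i + j)) !) ⦃ suc (suc (i + j)) !≢0 ⦄ same ⟩
      b                        ∎
      where
      β≡′ : β * suc (suc (i + j)) ! ≡ ℓ * (i ! * (suc j * j !))
      β≡′ = trans (cong (λ k → β * suc k !) (sym (+-suc i j))) β≡
      same : (α + β) * suc (suc (i + j)) ! ≡ b * suc (suc (i + j)) !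
      same = begin-equality
        (α + β) * suc (suc (i + j)) !
          ≡⟨ *-distribʳ-+ (suc (suc (i + j)) !) α β ⟩
        α * suc (suc (i + j)) ! + β * suc (suc (i + j)) !
          ≡⟨ cong₂ _+_ α≡ β≡′ ⟩
        ℓ * (suc i * i ! * j !) + ℓ * (i ! * (suc j * j !))
          ≡⟨ lemma₂ i j ℓ (i !) (j !) ⟨
        (2 + (i + j)) * (ℓ * (i ! * j !))
          ≡⟨ cong ((2 + (i + j)) *_) b≡ ⟨
        (2 + (i + j)) * (b * suc (i + j) !)
          ≡⟨ lemma₁ b (2 + (i + j)) (suc (i + j) !) ⟨
        b * suc (suc (i + j)) !
          ∎

  common-multiple-≥ : ∀ t → t < n → 2 ^ t ≤ ℓ
  common-multiple-≥ t t<n = beta-≥ t 0 0 {ℓ} t<n refl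

crossing : ∀ (g : ℕ → ℕ) {n} m → g 0 ≤ n → n < g m → ∃[ f ] (f < m × g f ≤ n × n < g (suc f))
crossing g zero    g0≤n n<g0 = contradiction g0≤n (<⇒≱ n<g0)
crossing g {n} (suc m) g0≤n n<g with g m ≤? n
... | yes gm≤n = m , ≤-refl , gm≤n , n<g
... | no  gm≰n with crossing g m g0≤n (≰⇒> gm≰n)
...   | f , f<m , rest = f , m≤n⇒m≤1+n f<m , rest

n<2^n : ∀ n → n < 2 ^ n
n<2^n zero    = s≤s z≤n
n<2^n (suc n) = begin
  suc (suc n)           ≤⟨ s≤s (n<2^n n) ⟩
  1 + 2 ^ n             ≤⟨ +-monoˡ-≤ (2 ^ n) (m^n>0 2 n) ⟩
  2 ^ n + 2 ^ n         ≡⟨ cong (λ s → 2 ^ n + s) (+-identityʳ (2 ^ n)) ⟨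
  2 ^ suc n             ∎
  where open ≤-Reasoning

largest-power : ∀ {p Y} → 2 ≤ p → 1 ≤ Y → ∃[ P ] (1 ≤ P × P ≤ Y × (∀ e → p ^ e ≤ Y → p ^ e ∣ P))
largest-power {p} {Y} 2≤p 1≤Y with crossing (p ^_) Y 1≤Y (<-≤-trans (n<2^n Y) (^-monoˡ-≤ Y 2≤p))
... | f , _ , p^f≤Y , Y<p^1+f = p ^ f , m^n>0 p ⦃ p≢0 ⦄ f , p^f≤Y , divides-power
  where
  p≢0 : NonZero p
  p≢0 = >-nonZero (≤-trans (s≤s z≤n) 2≤p)
  divides-power : ∀ e → p ^ e ≤ Y → p ^ e ∣ p ^ f
  divides-power e p^e≤Y with e ≤? f
  ... | yes e≤f = divides (p ^ (f ∸ e)) (trans (cong (p ^_) (sym (m∸n+n≡m e≤f))) (^-distribˡ-+-* p (f ∸ e) e))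
  ... | no  e≰f = contradiction (≤-trans (^-monoʳ-≤ p ⦃ p≢0 ⦄ (≰⇒> e≰f)) p^e≤Y) (<⇒≱ Y<p^1+f)

strip-prime : ∀ {p} → 2 ≤ p → ∀ j → 1 ≤ j → Acc _<_ j → ∃[ e ] ∃[ j′ ] (j ≡ p ^ e * j′ × p ∤ j′ × 1 ≤ j′)
strip-prime {p} 2≤p j 1≤j (acc smaller) with p ∣? j
... | no p∤j = 0 , j , sym (*-identityˡ j) , p∤j , 1≤j
... | yes (divides zero j≡) = contradiction (subst (1 ≤_) j≡ 1≤j) λ ()
... | yes (divides i@(suc _) j≡) with strip-prime 2≤p i (s≤s z≤n) (smaller i<j)
  where
  i<j : i < j
  i<j = subst (i <_) (sym j≡) (<-≤-trans (m<m+n i (s≤s z≤n)) (≤-trans (≤-reflexive (lemma i)) (*-monoʳ-≤ i 2≤p)))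
    where
    lemma : ∀ i → i + i ≡ i * 2
    lemma = solve-∀
... | e , j′ , i≡ , p∤j′ , 1≤j′ = suc e , j′ , trans j≡ (trans (cong (_* p) i≡) (lemma (p ^ e) j′ p)) , p∤j′ , 1≤j′
  where
  lemma : ∀ x y p → x * y * p ≡ p * x * y
  lemma = solve-∀

prime⇒2≤ : ∀ {p} → Prime p → 2 ≤ p
prime⇒2≤ {p} pp = nonTrivial⇒n>1 p ⦃ prime⇒nonTrivial pp ⦄

prime-divisor : ∀ j → 2 ≤ j → ∃[ p ] (Prime p × p ∣ j)
prime-divisor j 2≤j with factorise j ⦃ >-nonZero (≤-trans (s≤s z≤n) 2≤j) ⦄
... | record { factors = [] ; isFactorisation = refl } = contradiction 2≤j λ { (s≤s ()) }
... | record { factors = p ∷ ps ; isFactorisation = refl ; factorsPrime = pp ∷ _ } = p , pp , m∣m*n (product ps)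

smooth-multiple : ∀ {Y} → 1 ≤ Y → ∀ X → ∃[ ℓ ] (1 ≤ ℓ × ℓ ≤ Y ^ X ×
  (∀ j → 1 ≤ j → j ≤ Y → (∀ {p} → Prime p → p ∣ j → p ≤ X) → j ∣ ℓ))
smooth-multiple {Y} 1≤Y zero = 1 , ≤-refl , ≤-refl , only-one
  where
  only-one : ∀ j → 1 ≤ j → j ≤ Y → (∀ {p} → Prime p → p ∣ j → p ≤ 0) → j ∣ 1
  only-one (suc zero)      _ _ _ = n∣n
  only-one j@(suc (suc _)) _ _ smooth = let (p , pp , p∣j) = prime-divisor j (s≤s (s≤s z≤n)) in
    contradiction (≤-trans (prime⇒2≤ pp) (smooth pp p∣j)) λ ()
smooth-multiple {Y} 1≤Y (suc X) with smooth-multiple 1≤Y X | prime? (suc X)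
... | ℓ , 1≤ℓ , ℓ≤ , all | no ¬prime = ℓ , 1≤ℓ , ≤-trans ℓ≤ (^-monoʳ-≤ Y ⦃ >-nonZero 1≤Y ⦄ (n≤1+n X)) , λ j 1≤j j≤Y smooth →
  all j 1≤j j≤Y (λ pp p∣j → ≤-pred (≤∧≢⇒< (smooth pp p∣j) (λ { refl → ¬prime pp })))
... | ℓ , 1≤ℓ , ℓ≤ , all | yes pp with largest-power (prime⇒2≤ pp) 1≤Y
...   | P , 1≤P , P≤Y , powers = P * ℓ , *-mono-≤ 1≤P 1≤ℓ , *-mono-≤ P≤Y ℓ≤ , λ j 1≤j j≤Y smooth →
        divide j j≤Y smooth (strip-prime (prime⇒2≤ pp) j 1≤j (<-wellFounded j))
  where
  divide : ∀ j → j ≤ Y → (∀ {p} → Prime p → p ∣ j → p ≤ suc X) →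
    ∃[ e ] ∃[ j′ ] (j ≡ suc X ^ e * j′ × suc X ∤ j′ × 1 ≤ j′) → j ∣ P * ℓ
  divide j j≤Y smooth (e , j′ , refl , p∤j′ , 1≤j′) = *-pres-∣
    (powers e (≤-trans (m≤m*n (suc X ^ e) j′ ⦃ >-nonZero 1≤j′ ⦄) j≤Y))
    (all j′ 1≤j′ (≤-trans (m≤n*m j′ (suc X ^ e) ⦃ m^n≢0 (suc X) e ⦄) j≤Y)
      (λ pp p∣j′ → ≤-pred (≤∧≢⇒< (smooth pp (∣n⇒∣m*n (suc X ^ e) p∣j′)) (λ { refl → p∤j′ p∣j′ }))))

prime-between : ∀ X t → suc t ^ X < 2 ^ t → ∃[ p ] (Prime p × X < p × p ≤ suc t)
prime-between X t small with anyUpTo? (λ p → prime? p ×-dec X <? p) (suc (suc t))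
... | yes (p , s≤s p≤ , pp , X<p) = p , pp , X<p , p≤
... | no none with smooth-multiple {suc t} (s≤s z≤n) X
...   | ℓ , 1≤ℓ , ℓ≤ , all = contradiction (≤-trans (CommonMultiple.common-multiple-≥ 1≤ℓ multiple t ≤-refl) ℓ≤) (<⇒≱ small)
  where
  multiple : ∀ j → suc j ≤ suc t → suc j ∣ ℓ
  multiple j j≤t = all (suc j) (s≤s z≤n) j≤t (λ {p} pp p∣j → ≮⇒≥ (λ X<p →
    none (p , s≤s (≤-trans (∣⇒≤ p∣j) j≤t) , pp , X<p)))

-- Behrend's construction

digit-unique : ∀ {b u w} p q → u < b → w < b → u + b * p ≡ w + b * q → u ≡ w × p ≡ q
digit-unique {b} {u} {w} zero zero _ _ eq = (begin
    u            ≡⟨ trans (cong (λ s → u + s) (*-zeroʳ b)) (+-identityʳ u) ⟨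
    u + b * 0    ≡⟨ eq ⟩
    w + b * 0    ≡⟨ trans (cong (λ s → w + s) (*-zeroʳ b)) (+-identityʳ w) ⟩
    w            ∎) , refl
  where open ≡-Reasoning
digit-unique {b} {u} {w} zero (suc q) u<b _ eq = contradiction u<b (≤⇒≯ (begin
    b                 ≤⟨ m≤m*n b (suc q) ⟩
    b * suc q         ≤⟨ m≤n+m (b * suc q) w ⟩
    w + b * suc q     ≡⟨ eq ⟨
    u + b * 0         ≡⟨ trans (cong (λ s → u + s) (*-zeroʳ b)) (+-identityʳ u) ⟩
    u                 ∎))
  where open ≤-Reasoning
digit-unique {b} {u} {w} (suc p) zero _ w<b eq = contradiction w<b (≤⇒≯ (begin
    b                 ≤⟨ m≤m*n b (suc p) ⟩
    b * suc p         ≤⟨ m≤n+m (b * suc p) u ⟩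
    u + b * suc p     ≡⟨ eq ⟩
    w + b * 0         ≡⟨ trans (cong (λ s → w + s) (*-zeroʳ b)) (+-identityʳ w) ⟩
    w                 ∎))
  where open ≤-Reasoning
digit-unique {b} {u} {w} (suc p) (suc q) u<b w<b eq with digit-unique p q u<b w<b (+-cancelˡ-≡ b _ _ (begin
    b + (u + b * p)      ≡⟨ lemma b u p ⟩
    u + b * suc p        ≡⟨ eq ⟩
    w + b * suc q        ≡⟨ lemma b w q ⟨
    b + (w + b * q)      ∎))
  where
  open ≡-Reasoning
  lemma : ∀ b u p → b + (u + b * p) ≡ u + b * (1 + p)
  lemma = solve-∀
... | u≡w , p≡q = u≡w , cong suc p≡q

combination : (a₁ a₂ a₃ a₄ x₁ x₂ x₃ x₄ : ℕ) → ℕ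
combination a₁ a₂ a₃ a₄ x₁ x₂ x₃ x₄ = a₁ * x₁ + a₂ * x₂ + a₃ * x₃ + a₄ * x₄

combination-mono : ∀ a₁ a₂ a₃ a₄ {x₁ x₂ x₃ x₄ m} → x₁ ≤ m → x₂ ≤ m → x₃ ≤ m → x₄ ≤ m →
  combination a₁ a₂ a₃ a₄ x₁ x₂ x₃ x₄ ≤ (a₁ + a₂ + a₃ + a₄) * m
combination-mono a₁ a₂ a₃ a₄ {m = m} x₁≤ x₂≤ x₃≤ x₄≤ = ≤-trans
  (+-mono-≤ (+-mono-≤ (+-mono-≤ (*-monoʳ-≤ a₁ x₁≤) (*-monoʳ-≤ a₂ x₂≤)) (*-monoʳ-≤ a₃ x₃≤)) (*-monoʳ-≤ a₄ x₄≤))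
  (≤-reflexive (lemma a₁ a₂ a₃ a₄ m))
  where
  lemma : ∀ a₁ a₂ a₃ a₄ m → a₁ * m + a₂ * m + a₃ * m + a₄ * m ≡ (a₁ + a₂ + a₃ + a₄) * m
  lemma = solve-∀

sq-distance : ∀ x y → sq ∣ x - y ∣ + 2 * (x * y) ≡ sq x + sq y
sq-distance x y = +-cancelˡ-≡ (sq (x + y)) _ _ (begin
  sq (x + y) + (sq ∣ x - y ∣ + 2 * (x * y))    ≡⟨ +-assoc (sq (x + y)) _ _ ⟨
  sq (x + y) + sq ∣ x - y ∣ + 2 * (x * y)      ≡⟨ cong (_+ 2 * (x * y)) (parallelogram x y) ⟩
  2 * sq x + 2 * sq y + 2 * (x * y)            ≡⟨ lemma x y ⟩
  sq (x + y) + (sq x + sq y)                   ∎)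
  where
  open ≡-Reasoning
  lemma : ∀ x y → 2 * (x * x) + 2 * (y * y) + 2 * (x * y) ≡ (x + y) * (x + y) + (x * x + y * y)
  lemma = solve-∀

module Sphere {a₁ a₂ a₃ a₄ : ℕ} (1≤a₁ : 1 ≤ a₁) (M : ℕ) (1≤M : 1 ≤ M) where

  private
    S b : ℕ
    S = a₁ + a₂ + a₃ + a₄
    b = S * M

    comb : ℕ → ℕ → ℕ → ℕ → ℕ
    comb = combination a₁ a₂ a₃ a₄

    1≤S : 1 ≤ S
    1≤S = 1≤sum 1≤a₁

  value norm : ∀ {d} → Vec ℕ d → ℕ
  value []      = 0
  value (i ∷ v) = i + b * value v
  norm []      = 0
  norm (i ∷ v) = sq i + norm v

  distance : ∀ {d} → Vec ℕ d → Vec ℕ d → ℕ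
  distance []      []      = 0
  distance (i ∷ v) (j ∷ u) = sq ∣ i - j ∣ + distance v u

  Small : ∀ {d} → Vec ℕ d → Set
  Small []      = 1 ≤ M
  Small (i ∷ v) = i < M × Small v

  grid : ∀ d → List (Vec ℕ d)
  grid zero    = [] ∷ []
  grid (suc d) = map (λ (i , v) → i ∷ v) (cartesianProduct (upTo M) (grid d))

  length-grid : ∀ d → length (grid d) ≡ M ^ d
  length-grid zero    = refl
  length-grid (suc d) = begin
    length (map (λ (i , v) → i ∷ v) (cartesianProduct (upTo M) (grid d)))
      ≡⟨ length-map _ (cartesianProduct (upTo M) (grid d)) ⟩
    length (cartesianProduct (upTo M) (grid d))
      ≡⟨ trans (sym (*-identityʳ _)) (sym (∑-const (cartesianProduct (upTo M) (grid d)) 1)) ⟩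
    ∑ (cartesianProduct (upTo M) (grid d)) (λ _ → 1)
      ≡⟨ ∑-× (upTo M) (grid d) (λ _ → 1) ⟩
    ∑ (upTo M) (λ _ → ∑ (grid d) (λ _ → 1))
      ≡⟨ ∑-const (upTo M) _ ⟩
    length (upTo M) * ∑ (grid d) (λ _ → 1)
      ≡⟨ cong₂ _*_ (length-upTo M) (trans (∑-const (grid d) 1) (trans (*-identityʳ _) (length-grid d))) ⟩
    M * M ^ d
      ∎
    where open ≡-Reasoning

  grid-! : ∀ d → Unique (grid d)
  grid-! zero    = [] ∷ []
  grid-! (suc d) = Unique.map⁺ (λ { refl → refl }) (Unique.cartesianProduct⁺ (Unique.upTo⁺ M) (grid-! d))

  grid-small : ∀ d {v : Vec ℕ d} → v ∈ grid d → Small v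
  grid-small zero (here refl) = 1≤M
  grid-small (suc d) v∈ with ∈-map⁻ (λ (i , v) → i ∷ v) v∈
  ... | (i , v) , iv∈ , refl with ∈-cartesianProduct⁻ (upTo M) (grid d) iv∈
  ...   | i∈ , v∈′ = ∈-upTo⁻ i∈ , grid-small d v∈′

  M≤b : M ≤ b
  M≤b = ≤-trans (≤-reflexive (sym (*-identityˡ M))) (*-monoˡ-≤ M 1≤S)

  value-injective : ∀ {d} {v u : Vec ℕ d} → Small v → Small u → value v ≡ value u → v ≡ u
  value-injective {v = []}    {[]}    _ _ _ = refl
  value-injective {v = i ∷ v} {j ∷ u} (i< , small-v) (j< , small-u) eq
    with digit-unique (value v) (value u) (<-≤-trans i< M≤b) (<-≤-trans j< M≤b) eq
  ... | i≡j , eq′ = cong₂ _∷_ i≡j (value-injective small-v small-u eq′)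

  value-< : ∀ {d} {v : Vec ℕ d} → Small v → value v < b ^ d
  value-< {v = []}            _ = ≤-refl
  value-< {suc d} {v = i ∷ v} (i< , small) = begin
    suc i + b * value v       ≤⟨ +-monoˡ-≤ (b * value v) (≤-trans i< M≤b) ⟩
    b + b * value v           ≡⟨ *-suc b (value v) ⟨
    b * suc (value v)         ≤⟨ *-monoʳ-≤ b (value-< small) ⟩
    b * b ^ d                 ∎
    where open ≤-Reasoning

  norm-≤ : ∀ {d} {v : Vec ℕ d} → Small v → norm v ≤ d * sq M
  norm-≤ {v = []}    _            = z≤n
  norm-≤ {v = i ∷ v} (i< , small) = +-mono-≤ (*-mono-≤ (<⇒≤ i<) (<⇒≤ i<)) (norm-≤ small)

  distance≡0 : ∀ {d} (v u : Vec ℕ d) → distance v u ≡ 0 → v ≡ u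
  distance≡0 []      []      _  = refl
  distance≡0 (i ∷ v) (j ∷ u) eq = cong₂ _∷_ (∣m-n∣≡0⇒m≡n (square≡0 (m+n≡0⇒m≡0 _ eq))) (distance≡0 v u (m+n≡0⇒n≡0 (sq ∣ i - j ∣) eq))
    where
    square≡0 : ∀ {n} → sq n ≡ 0 → n ≡ 0
    square≡0 {zero} _ = refl

  -- The weighted parallelogram identity, coordinate by coordinate: no carries occur in base S M.
  convexity : ∀ {d} {v₁ v₂ v₃ v₄ v₅ : Vec ℕ d} → Small v₁ → Small v₂ → Small v₃ → Small v₄ → Small v₅ →
    comb (value v₁) (value v₂) (value v₃) (value v₄) ≡ S * value v₅ →
    comb (norm v₁) (norm v₂) (norm v₃) (norm v₄)
      ≡ S * norm v₅ + comb (distance v₁ v₅) (distance v₂ v₅) (distance v₃ v₅) (distance v₄ v₅)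
  convexity {v₁ = []} {[]} {[]} {[]} {[]} _ _ _ _ _ _ = lemma a₁ a₂ a₃ a₄
    where
    lemma : ∀ a₁ a₂ a₃ a₄ → a₁ * 0 + a₂ * 0 + a₃ * 0 + a₄ * 0
      ≡ (a₁ + a₂ + a₃ + a₄) * 0 + (a₁ * 0 + a₂ * 0 + a₃ * 0 + a₄ * 0)
    lemma = solve-∀
  convexity {v₁ = i₁ ∷ v₁} {i₂ ∷ v₂} {i₃ ∷ v₃} {i₄ ∷ v₄} {i₅ ∷ v₅} (i₁< , s₁) (i₂< , s₂) (i₃< , s₃) (i₄< , s₄) (i₅< , s₅) eq =
    begin
      comb (sq i₁ + norm v₁) (sq i₂ + norm v₂) (sq i₃ + norm v₃) (sq i₄ + norm v₄)
        ≡⟨ comb-+ a₁ a₂ a₃ a₄ (sq i₁) (sq i₂) (sq i₃) (sq i₄) (norm v₁) (norm v₂) (norm v₃) (norm v₄) ⟩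
      comb (sq i₁) (sq i₂) (sq i₃) (sq i₄) + comb (norm v₁) (norm v₂) (norm v₃) (norm v₄)
        ≡⟨ cong₂ _+_ coordinate (convexity s₁ s₂ s₃ s₄ s₅ (proj₂ digits)) ⟩
      S * sq i₅ + comb (e i₁) (e i₂) (e i₃) (e i₄)
        + (S * norm v₅ + comb (distance v₁ v₅) (distance v₂ v₅) (distance v₃ v₅) (distance v₄ v₅))
        ≡⟨ collect a₁ a₂ a₃ a₄ (sq i₅) (norm v₅) (e i₁) (e i₂) (e i₃) (e i₄)
             (distance v₁ v₅) (distance v₂ v₅) (distance v₃ v₅) (distance v₄ v₅) ⟩
      S * (sq i₅ + norm v₅) + comb (e i₁ + distance v₁ v₅) (e i₂ + distance v₂ v₅) (e i₃ + distance v₃ v₅) (e i₄ + distance v₄ v₅)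
        ∎
    where
    open ≡-Reasoning
    e : ℕ → ℕ
    e i = sq ∣ i - i₅ ∣
    comb-+ : ∀ a₁ a₂ a₃ a₄ x₁ x₂ x₃ x₄ y₁ y₂ y₃ y₄ →
      a₁ * (x₁ + y₁) + a₂ * (x₂ + y₂) + a₃ * (x₃ + y₃) + a₄ * (x₄ + y₄)
        ≡ a₁ * x₁ + a₂ * x₂ + a₃ * x₃ + a₄ * x₄ + (a₁ * y₁ + a₂ * y₂ + a₃ * y₃ + a₄ * y₄)
    comb-+ = solve-∀
    comb-digit : ∀ a₁ a₂ a₃ a₄ b x₁ x₂ x₃ x₄ y₁ y₂ y₃ y₄ →
      a₁ * (x₁ + b * y₁) + a₂ * (x₂ + b * y₂) + a₃ * (x₃ + b * y₃) + a₄ * (x₄ + b * y₄)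
        ≡ a₁ * x₁ + a₂ * x₂ + a₃ * x₃ + a₄ * x₄ + b * (a₁ * y₁ + a₂ * y₂ + a₃ * y₃ + a₄ * y₄)
    comb-digit = solve-∀
    scale-digit : ∀ s b x y → s * (x + b * y) ≡ s * x + b * (s * y)
    scale-digit = solve-∀
    collect : ∀ a₁ a₂ a₃ a₄ x n e₁ e₂ e₃ e₄ d₁ d₂ d₃ d₄ →
      (a₁ + a₂ + a₃ + a₄) * x + (a₁ * e₁ + a₂ * e₂ + a₃ * e₃ + a₄ * e₄)
        + ((a₁ + a₂ + a₃ + a₄) * n + (a₁ * d₁ + a₂ * d₂ + a₃ * d₃ + a₄ * d₄))
      ≡ (a₁ + a₂ + a₃ + a₄) * (x + n) + (a₁ * (e₁ + d₁) + a₂ * (e₂ + d₂) + a₃ * (e₃ + d₃) + a₄ * (e₄ + d₄))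
    collect = solve-∀
    <b : ∀ {x} → x ≤ S * pred M → x < b
    <b x≤ = ≤-<-trans x≤ (*-monoʳ-< S ⦃ >-nonZero 1≤S ⦄ (≤-reflexive (suc-pred M ⦃ >-nonZero 1≤M ⦄)))
    digits : comb i₁ i₂ i₃ i₄ ≡ S * i₅ × comb (value v₁) (value v₂) (value v₃) (value v₄) ≡ S * value v₅
    digits = digit-unique (comb (value v₁) (value v₂) (value v₃) (value v₄)) (S * value v₅)
      (<b (combination-mono a₁ a₂ a₃ a₄ (<⇒≤pred i₁<) (<⇒≤pred i₂<) (<⇒≤pred i₃<) (<⇒≤pred i₄<)))
      (<b (*-monoʳ-≤ S (<⇒≤pred i₅<)))
      (trans (sym (comb-digit a₁ a₂ a₃ a₄ b i₁ i₂ i₃ i₄ (value v₁) (value v₂) (value v₃) (value v₄)))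
        (trans eq (scale-digit S b i₅ (value v₅))))
    regroup₁ : ∀ a₁ a₂ a₃ a₄ q₁ q₂ q₃ q₄ y → a₁ * q₁ + a₂ * q₂ + a₃ * q₃ + a₄ * q₄ + (a₁ + a₂ + a₃ + a₄) * y
      ≡ a₁ * (q₁ + y) + a₂ * (q₂ + y) + a₃ * (q₃ + y) + a₄ * (q₄ + y)
    regroup₁ = solve-∀
    regroup₂ : ∀ a₁ a₂ a₃ a₄ e₁ e₂ e₃ e₄ x₁ x₂ x₃ x₄ y →
      a₁ * (e₁ + 2 * (x₁ * y)) + a₂ * (e₂ + 2 * (x₂ * y)) + a₃ * (e₃ + 2 * (x₃ * y)) + a₄ * (e₄ + 2 * (x₄ * y))
      ≡ a₁ * e₁ + a₂ * e₂ + a₃ * e₃ + a₄ * e₄ + 2 * (a₁ * x₁ + a₂ * x₂ + a₃ * x₃ + a₄ * x₄) * y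
    regroup₂ = solve-∀
    regroup₃ : ∀ c s y → c + 2 * (s * y) * y ≡ s * (y * y) + c + s * (y * y)
    regroup₃ = solve-∀
    coordinate : comb (sq i₁) (sq i₂) (sq i₃) (sq i₄) ≡ S * sq i₅ + comb (e i₁) (e i₂) (e i₃) (e i₄)
    coordinate = +-cancelʳ-≡ (S * sq i₅) _ _ (begin
      comb (sq i₁) (sq i₂) (sq i₃) (sq i₄) + S * sq i₅
        ≡⟨ regroup₁ a₁ a₂ a₃ a₄ (sq i₁) (sq i₂) (sq i₃) (sq i₄) (sq i₅) ⟩
      comb (sq i₁ + sq i₅) (sq i₂ + sq i₅) (sq i₃ + sq i₅) (sq i₄ + sq i₅)
        ≡⟨ cong₂ _+_ (cong₂ _+_ (cong₂ _+_ (cong (a₁ *_) (sq-distance i₁ i₅)) (cong (a₂ *_) (sq-distance i₂ i₅)))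
             (cong (a₃ *_) (sq-distance i₃ i₅))) (cong (a₄ *_) (sq-distance i₄ i₅)) ⟨
      comb (e i₁ + 2 * (i₁ * i₅)) (e i₂ + 2 * (i₂ * i₅)) (e i₃ + 2 * (i₃ * i₅)) (e i₄ + 2 * (i₄ * i₅))
        ≡⟨ regroup₂ a₁ a₂ a₃ a₄ (e i₁) (e i₂) (e i₃) (e i₄) i₁ i₂ i₃ i₄ i₅ ⟩
      comb (e i₁) (e i₂) (e i₃) (e i₄) + 2 * comb i₁ i₂ i₃ i₄ * i₅
        ≡⟨ cong (λ s → comb (e i₁) (e i₂) (e i₃) (e i₄) + 2 * s * i₅) (proj₁ digits) ⟩
      comb (e i₁) (e i₂) (e i₃) (e i₄) + 2 * (S * i₅) * i₅
        ≡⟨ regroup₃ (comb (e i₁) (e i₂) (e i₃) (e i₄)) S i₅ ⟩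
      S * sq i₅ + comb (e i₁) (e i₂) (e i₃) (e i₄) + S * sq i₅
        ∎)

  sphere-rigid : ∀ {d r} {v₁ v₂ v₃ v₄ v₅ : Vec ℕ d} → Small v₁ → Small v₂ → Small v₃ → Small v₄ → Small v₅ →
    norm v₁ ≡ r → norm v₂ ≡ r → norm v₃ ≡ r → norm v₄ ≡ r → norm v₅ ≡ r →
    comb (value v₁) (value v₂) (value v₃) (value v₄) ≡ S * value v₅ → v₁ ≡ v₅
  sphere-rigid {r = r} {v₁} {v₂} {v₃} {v₄} {v₅} s₁ s₂ s₃ s₄ s₅ n₁ n₂ n₃ n₄ n₅ eq = distance≡0 v₁ v₅
    (m*n≡0⇒m≡0 (distance v₁ v₅) a₁ ⦃ >-nonZero 1≤a₁ ⦄ (trans (*-comm (distance v₁ v₅) a₁) (m+n≡0⇒m≡0 _ (m+n≡0⇒m≡0 _ (m+n≡0⇒m≡0 _ vanishing)))))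
    where
    open ≡-Reasoning
    lemma : ∀ a₁ a₂ a₃ a₄ r → a₁ * r + a₂ * r + a₃ * r + a₄ * r ≡ (a₁ + a₂ + a₃ + a₄) * r + 0
    lemma = solve-∀
    vanishing : comb (distance v₁ v₅) (distance v₂ v₅) (distance v₃ v₅) (distance v₄ v₅) ≡ 0
    vanishing = +-cancelˡ-≡ (S * r) _ _ (begin
      S * r + comb (distance v₁ v₅) (distance v₂ v₅) (distance v₃ v₅) (distance v₄ v₅)
        ≡⟨ cong (λ n → S * n + comb (distance v₁ v₅) (distance v₂ v₅) (distance v₃ v₅) (distance v₄ v₅)) n₅ ⟨
      S * norm v₅ + comb (distance v₁ v₅) (distance v₂ v₅) (distance v₃ v₅) (distance v₄ v₅)
        ≡⟨ convexity s₁ s₂ s₃ s₄ s₅ eq ⟨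
      comb (norm v₁) (norm v₂) (norm v₃) (norm v₄)
        ≡⟨ cong₂ _+_ (cong₂ _+_ (cong₂ _+_ (cong (a₁ *_) n₁) (cong (a₂ *_) n₂)) (cong (a₃ *_) n₃)) (cong (a₄ *_) n₄) ⟩
      a₁ * r + a₂ * r + a₃ * r + a₄ * r
        ≡⟨ lemma a₁ a₂ a₃ a₄ r ⟩
      S * r + 0
        ∎)

  behrend : ∀ d → ∃[ Bs ] (Unique Bs × (∀ {x} → x ∈ Bs → x < b ^ d) × M ^ d ≤ suc (d * sq M) * length Bs ×
    (∀ {x₁ x₂ x₃ x₄ x₅} → x₁ ∈ Bs → x₂ ∈ Bs → x₃ ∈ Bs → x₄ ∈ Bs → x₅ ∈ Bs → comb x₁ x₂ x₃ x₄ ≡ S * x₅ → x₁ ≡ x₅))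
  behrend d with pigeonhole-colour norm (d * sq M) (grid d) (λ v∈ → norm-≤ (grid-small d v∈))
  ... | r , many = map value sphere , unique , bounded , size , rigid
    where
    sphere : List (Vec ℕ d)
    sphere = filter (λ v → norm v ≟ r) (grid d)
    members : ∀ {x} → x ∈ map value sphere → ∃[ v ] (Small v × norm v ≡ r × x ≡ value v)
    members x∈ with ∈-map⁻ value x∈
    ... | v , v∈ , eq with ∈-filter⁻ (λ v → norm v ≟ r) {xs = grid d} v∈
    ...   | v∈grid , nv = v , grid-small d v∈grid , nv , eq
    size : M ^ d ≤ suc (d * sq M) * length (map value sphere)
    size = subst₂ (λ l m → l ≤ suc (d * sq M) * m) (length-grid d) (sym (length-map value sphere)) many
    bounded : ∀ {x} → x ∈ map value sphere → x < b ^ d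
    bounded x∈ with members x∈
    ... | v , small , _ , refl = value-< small
    unique : Unique (map value sphere)
    unique = map-unique (Unique.filter⁺ (λ v → norm v ≟ r) (grid-! d)) (λ v∈ → grid-small d (proj₁ (∈-filter⁻ (λ v → norm v ≟ r) {xs = grid d} v∈)))
      where
      map-unique : ∀ {L : List (Vec ℕ d)} → Unique L → (∀ {v} → v ∈ L → Small v) → Unique (map value L)
      map-unique [] _ = []
      map-unique {v ∷ L} (v∉ ∷ u) small = All.map⁺ (All.tabulate (λ u∈ eq →
        All.lookup v∉ u∈ (value-injective (small (here refl)) (small (there u∈)) eq))) ∷ map-unique u (small ∘ there)
    rigid : ∀ {x₁ x₂ x₃ x₄ x₅} → x₁ ∈ map value sphere → x₂ ∈ map value sphere → x₃ ∈ map value sphere →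
      x₄ ∈ map value sphere → x₅ ∈ map value sphere → comb x₁ x₂ x₃ x₄ ≡ S * x₅ → x₁ ≡ x₅
    rigid x₁∈ x₂∈ x₃∈ x₄∈ x₅∈ eq with members x₁∈ | members x₂∈ | members x₃∈ | members x₄∈ | members x₅∈
    ... | v₁ , s₁ , n₁ , refl | v₂ , s₂ , n₂ , refl | v₃ , s₃ , n₃ , refl | v₄ , s₄ , n₄ , refl | v₅ , s₅ , n₅ , refl =
      cong value (sphere-rigid s₁ s₂ s₃ s₄ s₅ n₁ n₂ n₃ n₄ n₅ eq)

-- The lower bound

module ErdősTurán {a₁ a₂ a₃ a₄ : ℕ} (1≤a₁ : 1 ≤ a₁) {p : ℕ} (pp : Prime p) (2<p : 2 < p)
  {Bs : List ℕ} (unique : Unique Bs) (bounded : ∀ {x} → x ∈ Bs → x < p)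
  (rigid : ∀ {x₁ x₂ x₃ x₄ x₅} → x₁ ∈ Bs → x₂ ∈ Bs → x₃ ∈ Bs → x₄ ∈ Bs → x₅ ∈ Bs →
    combination a₁ a₂ a₃ a₄ x₁ x₂ x₃ x₄ ≡ (a₁ + a₂ + a₃ + a₄) * x₅ → x₁ ≡ x₅) where

  private
    S base : ℕ
    S = a₁ + a₂ + a₃ + a₄
    base = suc S * p

    instance
      p≢0 : NonZero p
      p≢0 = prime⇒nonZero pp

    res : ℕ → ℕ
    res x = x * x % p

    res<p : ∀ x → res x < p
    res<p x = m%n<n (x * x) p

    1≤S : 1 ≤ S
    1≤S = 1≤sum 1≤a₁

    Sp<base : S * p < base
    Sp<base = m<n+m (S * p) (>-nonZero⁻¹ p)

    res<base : ∀ x → res x < base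
    res<base x = <-≤-trans (res<p x) (m≤m+n p (S * p))

  point : ℕ → ℕ
  point x = suc (res x + base * x)

  point-injective : ∀ {x y} → point x ≡ point y → x ≡ y
  point-injective {x} {y} eq = proj₂ (digit-unique x y (res<base x) (res<base y) (suc-injective eq))

  point-range : ∀ {x} → x ∈ Bs → 1 ≤ point x × point x ≤ suc S * (p * p)
  point-range {x} x∈ = s≤s z≤n , (begin
    suc (res x) + base * x        ≤⟨ +-monoˡ-≤ (base * x) (res<base x) ⟩
    base + base * x               ≡⟨ *-suc base x ⟨
    base * suc x                  ≤⟨ *-monoʳ-≤ base (bounded x∈) ⟩
    suc S * p * p                 ≡⟨ *-assoc (suc S) p p ⟩
    suc S * (p * p)               ∎)
    where open ≤-Reasoning

  -- x₁ + x₂ = x₃ + x₄ turns x₁² + x₂² - x₃² - x₄² into 2 (x₁ - x₃) (x₁ - x₄).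
  difference-product : ∀ {x₁ x₂ x₃ x₄} → x₁ + x₂ ≡ x₃ + x₄ → res x₁ + res x₂ ≡ res x₃ + res x₄ →
    p ∣ 2 * (ℤ.∣ + x₁ ℤ.- + x₃ ∣ * ℤ.∣ + x₁ ℤ.- + x₄ ∣)
  difference-product {x₁} {x₂} {x₃} {x₄} sums residues = divides ℤ.∣ Z ∣ (begin
    2 * (ℤ.∣ + x₁ ℤ.- + x₃ ∣ * ℤ.∣ + x₁ ℤ.- + x₄ ∣)
      ≡⟨ cong (2 *_) (ℤ.abs-* (+ x₁ ℤ.- + x₃) (+ x₁ ℤ.- + x₄)) ⟨
    2 * ℤ.∣ (+ x₁ ℤ.- + x₃) ℤ.* (+ x₁ ℤ.- + x₄) ∣
      ≡⟨ ℤ.abs-* (+ 2) ((+ x₁ ℤ.- + x₃) ℤ.* (+ x₁ ℤ.- + x₄)) ⟨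
    ℤ.∣ + 2 ℤ.* ((+ x₁ ℤ.- + x₃) ℤ.* (+ x₁ ℤ.- + x₄)) ∣
      ≡⟨ cong ℤ.∣_∣ product-≡ ⟩
    ℤ.∣ Z ℤ.* + p ∣
      ≡⟨ ℤ.abs-* Z (+ p) ⟩
    ℤ.∣ Z ∣ * p
      ∎)
    where
    open ≡-Reasoning
    R q : ℕ → ℤ
    R x = + res x
    q x = + (x * x / p)
    Z : ℤ
    Z = q x₁ ℤ.+ q x₂ ℤ.- q x₃ ℤ.- q x₄
    square : ∀ x → + x ℤ.* + x ≡ R x ℤ.+ q x ℤ.* + p
    square x = trans (sym (ℤ.pos-* x x)) (trans (cong (λ n → + n) (m≡m%n+[m/n]*n (x * x) p))
      (trans (ℤ.pos-+ (res x) (x * x / p * p)) (cong (λ i → R x ℤ.+ i) (ℤ.pos-* (x * x / p) p))))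
    x₂≡ : + x₃ ℤ.+ + x₄ ℤ.- + x₁ ≡ + x₂
    x₂≡ = trans (cong (λ s → s ℤ.- + x₁) (trans (sym (ℤ.pos-+ x₃ x₄)) (trans (cong (λ n → + n) (sym sums)) (ℤ.pos-+ x₁ x₂))))
      (cancel (+ x₁) (+ x₂))
      where
      cancel : ∀ x y → x ℤ.+ y ℤ.- x ≡ y
      cancel = ℤ-Solver.solve-∀
    residuesᶻ : R x₁ ℤ.+ R x₂ ≡ R x₃ ℤ.+ R x₄
    residuesᶻ = trans (sym (ℤ.pos-+ (res x₁) (res x₂))) (trans (cong (λ n → + n) residues) (ℤ.pos-+ (res x₃) (res x₄)))
    expand : ∀ x₁ x₃ x₄ → + 2 ℤ.* ((x₁ ℤ.- x₃) ℤ.* (x₁ ℤ.- x₄))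
      ≡ x₁ ℤ.* x₁ ℤ.+ (x₃ ℤ.+ x₄ ℤ.- x₁) ℤ.* (x₃ ℤ.+ x₄ ℤ.- x₁) ℤ.- x₃ ℤ.* x₃ ℤ.- x₄ ℤ.* x₄
    expand = ℤ-Solver.solve-∀
    collect : ∀ r₁ r₂ r₃ r₄ q₁ q₂ q₃ q₄ p → (r₁ ℤ.+ q₁ ℤ.* p) ℤ.+ (r₂ ℤ.+ q₂ ℤ.* p) ℤ.- (r₃ ℤ.+ q₃ ℤ.* p) ℤ.- (r₄ ℤ.+ q₄ ℤ.* p)
      ≡ (r₁ ℤ.+ r₂ ℤ.- (r₃ ℤ.+ r₄)) ℤ.+ (q₁ ℤ.+ q₂ ℤ.- q₃ ℤ.- q₄) ℤ.* p
    collect = ℤ-Solver.solve-∀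
    product-≡ : + 2 ℤ.* ((+ x₁ ℤ.- + x₃) ℤ.* (+ x₁ ℤ.- + x₄)) ≡ Z ℤ.* + p
    product-≡ = begin
      + 2 ℤ.* ((+ x₁ ℤ.- + x₃) ℤ.* (+ x₁ ℤ.- + x₄))
        ≡⟨ expand (+ x₁) (+ x₃) (+ x₄) ⟩
      + x₁ ℤ.* + x₁ ℤ.+ (+ x₃ ℤ.+ + x₄ ℤ.- + x₁) ℤ.* (+ x₃ ℤ.+ + x₄ ℤ.- + x₁) ℤ.- + x₃ ℤ.* + x₃ ℤ.- + x₄ ℤ.* + x₄
        ≡⟨ cong (λ y → + x₁ ℤ.* + x₁ ℤ.+ y ℤ.* y ℤ.- + x₃ ℤ.* + x₃ ℤ.- + x₄ ℤ.* + x₄) x₂≡ ⟩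
      + x₁ ℤ.* + x₁ ℤ.+ + x₂ ℤ.* + x₂ ℤ.- + x₃ ℤ.* + x₃ ℤ.- + x₄ ℤ.* + x₄
        ≡⟨ cong₂ ℤ._-_ (cong₂ ℤ._-_ (cong₂ ℤ._+_ (square x₁) (square x₂)) (square x₃)) (square x₄) ⟩
      (R x₁ ℤ.+ q x₁ ℤ.* + p) ℤ.+ (R x₂ ℤ.+ q x₂ ℤ.* + p) ℤ.- (R x₃ ℤ.+ q x₃ ℤ.* + p) ℤ.- (R x₄ ℤ.+ q x₄ ℤ.* + p)
        ≡⟨ collect (R x₁) (R x₂) (R x₃) (R x₄) (q x₁) (q x₂) (q x₃) (q x₄) (+ p) ⟩
      (R x₁ ℤ.+ R x₂ ℤ.- (R x₃ ℤ.+ R x₄)) ℤ.+ Z ℤ.* + p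
        ≡⟨ cong (λ i → i ℤ.+ Z ℤ.* + p) (ℤ.i≡j⇒i-j≡0 residuesᶻ) ⟩
      + 0 ℤ.+ Z ℤ.* + p
        ≡⟨ ℤ.+-identityˡ (Z ℤ.* + p) ⟩
      Z ℤ.* + p
        ∎

  divides-difference : ∀ {x y} → x < p → y < p → p ∣ ℤ.∣ + x ℤ.- + y ∣ → x ≡ y
  divides-difference {x} {y} x<p y<p p∣ with ℤ.∣ + x ℤ.- + y ∣ ≟ 0
  ... | yes ≡0 = ℤ.+-injective (ℤ.i-j≡0⇒i≡j (+ x) (+ y) (ℤ.∣i∣≡0⇒i≡0 ≡0))
  ... | no  ≢0 = contradiction (≤-trans (∣⇒≤ ⦃ ≢-nonZero ≢0 ⦄ p∣) (∣x-y∣≤ (≤-trans (<⇒≤pred x<p) (m≤n+m (pred p) y))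
                   (≤-trans (<⇒≤pred y<p) (m≤n+m (pred p) x)))) (<⇒≱ (≤-reflexive (suc-pred p)))

  sidon-parameters : ∀ {x₁ x₂ x₃ x₄} → x₁ ∈ Bs → x₂ ∈ Bs → x₃ ∈ Bs → x₄ ∈ Bs →
    point x₁ + point x₂ ≡ point x₃ + point x₄ → (x₁ ≡ x₃ × x₂ ≡ x₄) ⊎ (x₁ ≡ x₄ × x₂ ≡ x₃)
  sidon-parameters {x₁} {x₂} {x₃} {x₄} x₁∈ x₂∈ x₃∈ x₄∈ eq = conclude (euclidsLemma 2 _ pp (difference-product {x₁} {x₂} {x₃} {x₄} sums residues))
    where
    regroup : ∀ r s b x y → suc (r + b * x) + suc (s + b * y) ≡ 2 + (r + s + b * (x + y))
    regroup = solve-∀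
    two<base : ∀ x y → res x + res y < base
    two<base x y = <-≤-trans (+-mono-< (res<p x) (res<p y)) (+-monoʳ-≤ p (≤-trans (≤-reflexive (sym (*-identityˡ p))) (*-monoˡ-≤ p 1≤S)))
    digits : res x₁ + res x₂ ≡ res x₃ + res x₄ × x₁ + x₂ ≡ x₃ + x₄
    digits = digit-unique (x₁ + x₂) (x₃ + x₄) (two<base x₁ x₂) (two<base x₃ x₄)
      (+-cancelˡ-≡ 2 _ _ (trans (sym (regroup (res x₁) (res x₂) base x₁ x₂)) (trans eq (regroup (res x₃) (res x₄) base x₃ x₄))))
    residues = proj₁ digits
    sums = proj₂ digits
    same₁ : x₁ ≡ x₃ → x₁ ≡ x₃ × x₂ ≡ x₄
    same₁ refl = refl , +-cancelˡ-≡ x₁ x₂ x₄ sums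
    same₂ : x₁ ≡ x₄ → x₁ ≡ x₄ × x₂ ≡ x₃
    same₂ refl = refl , +-cancelˡ-≡ x₁ x₂ x₃ (trans sums (+-comm x₃ x₁))
    conclude : p ∣ 2 ⊎ p ∣ ℤ.∣ + x₁ ℤ.- + x₃ ∣ * ℤ.∣ + x₁ ℤ.- + x₄ ∣ → (x₁ ≡ x₃ × x₂ ≡ x₄) ⊎ (x₁ ≡ x₄ × x₂ ≡ x₃)
    conclude (inj₁ p∣2) = contradiction (∣⇒≤ p∣2) (<⇒≱ 2<p)
    conclude (inj₂ p∣) with euclidsLemma ℤ.∣ + x₁ ℤ.- + x₃ ∣ ℤ.∣ + x₁ ℤ.- + x₄ ∣ pp p∣
    ... | inj₁ p∣₁₃ = inj₁ (same₁ (divides-difference (bounded x₁∈) (bounded x₃∈) p∣₁₃))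
    ... | inj₂ p∣₁₄ = inj₂ (same₂ (divides-difference (bounded x₁∈) (bounded x₄∈) p∣₁₄))

  rigid-points : ∀ {x₁ x₂ x₃ x₄ x₅} → x₁ ∈ Bs → x₂ ∈ Bs → x₃ ∈ Bs → x₄ ∈ Bs → x₅ ∈ Bs →
    combination a₁ a₂ a₃ a₄ (point x₁) (point x₂) (point x₃) (point x₄) ≡ S * point x₅ → x₁ ≡ x₅
  rigid-points {x₁} {x₂} {x₃} {x₄} {x₅} x₁∈ x₂∈ x₃∈ x₄∈ x₅∈ eq = rigid x₁∈ x₂∈ x₃∈ x₄∈ x₅∈ (proj₂
    (digit-unique (combination a₁ a₂ a₃ a₄ x₁ x₂ x₃ x₄) (S * x₅)
      (≤-<-trans (combination-mono a₁ a₂ a₃ a₄ (<⇒≤ (res<p x₁)) (<⇒≤ (res<p x₂)) (<⇒≤ (res<p x₃)) (<⇒≤ (res<p x₄))) Sp<base)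
      (≤-<-trans (*-monoʳ-≤ S (<⇒≤ (res<p x₅))) Sp<base)
      (+-cancelˡ-≡ S _ _ (trans (sym (regroup a₁ a₂ a₃ a₄ base (res x₁) (res x₂) (res x₃) (res x₄) x₁ x₂ x₃ x₄))
        (trans eq (regroup₅ S base (res x₅) x₅))))))
    where
    regroup : ∀ a₁ a₂ a₃ a₄ b r₁ r₂ r₃ r₄ x₁ x₂ x₃ x₄ →
      a₁ * suc (r₁ + b * x₁) + a₂ * suc (r₂ + b * x₂) + a₃ * suc (r₃ + b * x₃) + a₄ * suc (r₄ + b * x₄)
      ≡ a₁ + a₂ + a₃ + a₄ + (a₁ * r₁ + a₂ * r₂ + a₃ * r₃ + a₄ * r₄ + b * (a₁ * x₁ + a₂ * x₂ + a₃ * x₃ + a₄ * x₄))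
    regroup = solve-∀
    regroup₅ : ∀ s b r x → s * suc (r + b * x) ≡ s + (s * r + b * (s * x))
    regroup₅ = solve-∀

  points-admissible : ∀ {n} → suc S * (p * p) ≤ n → Admissible a₁ a₂ a₃ a₄ n (map point Bs)
  points-admissible {n} large = (Unique.map⁺ point-injective unique , All.map⁺ (All.tabulate (λ x∈ →
      proj₁ (point-range x∈) , ≤-trans (proj₂ (point-range x∈)) large))) , sidon , none
    where
    sidon : Sidon (map point Bs)
    sidon y₁∈ y₂∈ y₃∈ y₄∈ eq with ∈-map⁻ point y₁∈ | ∈-map⁻ point y₂∈ | ∈-map⁻ point y₃∈ | ∈-map⁻ point y₄∈
    ... | x₁ , x₁∈ , refl | x₂ , x₂∈ , refl | x₃ , x₃∈ , refl | x₄ , x₄∈ , refl =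
      Sum.map both both (sidon-parameters x₁∈ x₂∈ x₃∈ x₄∈ eq)
      where
      both : ∀ {x y u v} → x ≡ y × u ≡ v → point x ≡ point y × point u ≡ point v
      both (x≡y , u≡v) = cong point x≡y , cong point u≡v
    none : NoDistinctSolution a₁ a₂ a₃ a₄ (map point Bs)
    none y₁∈ y₂∈ y₃∈ y₄∈ y₅∈ (_ , _ , _ , y₁≢y₅ , _) eq
      with ∈-map⁻ point y₁∈ | ∈-map⁻ point y₂∈ | ∈-map⁻ point y₃∈ | ∈-map⁻ point y₄∈ | ∈-map⁻ point y₅∈
    ... | x₁ , x₁∈ , refl | x₂ , x₂∈ , refl | x₃ , x₃∈ , refl | x₄ , x₄∈ , refl | x₅ , x₅∈ , refl =
      y₁≢y₅ (cong point (rigid-points x₁∈ x₂∈ x₃∈ x₄∈ x₅∈ eq))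

power-≤-2^ : ∀ e .⦃ _ : NonZero e ⦄ {M} → 4 * sq e ≤ M → M ^ e ≤ 2 ^ M
power-≤-2^ e {M} large = begin
  M ^ e                          ≤⟨ ^-monoˡ-≤ e M≤ ⟩
  (2 ^ (2 * q)) ^ e              ≡⟨ ^-*-assoc 2 (2 * q) e ⟩
  2 ^ (2 * q * e)                ≤⟨ ^-monoʳ-≤ 2 (≤-trans (≤-reflexive (lemma q e)) (m/n*n≤m M (2 * e))) ⟩
  2 ^ M                          ∎
  where
  open ≤-Reasoning
  instance
    double≢0 : NonZero (2 * e)
    double≢0 = m*n≢0 2 e
  q : ℕ
  q = M / (2 * e)
  lemma : ∀ q e → 2 * q * e ≡ q * (2 * e)
  lemma = solve-∀
  lemma′ : ∀ e → 2 * e * (2 * e) ≡ 4 * (e * e)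
  lemma′ = solve-∀
  double≤q : 2 * e ≤ q
  double≤q = begin
    2 * e                          ≡⟨ m*n/n≡m (2 * e) (2 * e) ⟨
    2 * e * (2 * e) / (2 * e)      ≤⟨ /-monoˡ-≤ (2 * e) (≤-trans (≤-reflexive (lemma′ e)) large) ⟩
    q                              ∎
  M≤ : M ≤ 2 ^ (2 * q)
  M≤ = begin
    M                              ≡⟨ m≡m%n+[m/n]*n M (2 * e) ⟩
    M % (2 * e) + q * (2 * e)      ≤⟨ +-monoˡ-≤ (q * (2 * e)) (<⇒≤ (m%n<n M (2 * e))) ⟩
    suc q * (2 * e)                ≤⟨ *-mono-≤ (n<2^n q) (≤-trans double≤q (<⇒≤ (n<2^n q))) ⟩
    2 ^ q * 2 ^ q                  ≡⟨ ^-distribˡ-+-* 2 q q ⟨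
    2 ^ (q + q)                    ≡⟨ cong (λ r → 2 ^ (q + r)) (+-identityʳ q) ⟨
    2 ^ (2 * q)                    ∎

prime-in-range : ∀ {X M} → 1 ≤ X → X * M * 4 ≤ 2 ^ M → 1 ≤ M → ∃[ p ] (Prime p × X < p × p ≤ X * M)
prime-in-range {X} {M} 1≤X large 1≤M = subst (λ Y → ∃[ p ] (Prime p × X < p × p ≤ Y)) Y≡ (prime-between X t gap)
  where
  open ≤-Reasoning
  t : ℕ
  t = pred (X * M)
  Y≡ : suc t ≡ X * M
  Y≡ = suc-pred (X * M) ⦃ >-nonZero (*-mono-≤ 1≤X 1≤M) ⦄
  y : ℕ
  y = (X * M) ^ X
  1≤y : 1 ≤ y
  1≤y = m^n>0 (X * M) ⦃ >-nonZero (*-mono-≤ 1≤X 1≤M) ⦄ X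
  lemma : ∀ y → 2 * (2 * y) ≡ 4 * y
  lemma = solve-∀
  halved : 2 * y ≤ 2 ^ t
  halved = *-cancelˡ-≤ 2 (begin
    2 * (2 * y)                    ≡⟨ lemma y ⟩
    4 * y                          ≤⟨ *-monoˡ-≤ y (^-monoʳ-≤ 4 1≤X) ⟩
    4 ^ X * y                      ≡⟨ *-comm (4 ^ X) y ⟩
    (X * M) ^ X * 4 ^ X            ≡⟨ ^-distribʳ-* X (X * M) 4 ⟨
    (X * M * 4) ^ X                ≤⟨ ^-monoˡ-≤ X large ⟩
    (2 ^ M) ^ X                    ≡⟨ ^-*-assoc 2 M X ⟩
    2 ^ (M * X)                    ≡⟨ cong (2 ^_) (trans (*-comm M X) (sym Y≡)) ⟩
    2 * 2 ^ t                      ∎)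
  gap : suc t ^ X < 2 ^ t
  gap = subst (λ Y → Y ^ X < 2 ^ t) (sym Y≡) (<-≤-trans (m<m+n y (≤-trans 1≤y (≤-reflexive (sym (+-identityʳ y))))) halved)

module LowerBound {a₁ a₂ a₃ a₄ : ℕ} (1≤a₁ : 1 ≤ a₁) (k : ℕ) {d : ℕ} (d≡ : d ≡ 3 + 3 * k) where

  private
    S : ℕ
    S = a₁ + a₂ + a₃ + a₄

    1≤S : 1 ≤ S
    1≤S = 1≤sum 1≤a₁

  needed : ℕ → ℕ
  needed M = suc S * sq ((S * M) ^ d * M)

  private
    M₀ : ℕ
    M₀ = 2 + (4 * S ^ d + (4 * sq (2 + d) + (suc d + suc S * (4 * (2 * S) ^ (2 * d)))))

    module Large {M : ℕ} (M₀≤M : M₀ ≤ M) where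

      2≤M : 2 ≤ M
      2≤M = ≤-trans (m≤m+n 2 _) M₀≤M
      1≤M : 1 ≤ M
      1≤M = ≤-trans (s≤s z≤n) 2≤M
      rest≤M : 4 * S ^ d + (4 * sq (2 + d) + (suc d + suc S * (4 * (2 * S) ^ (2 * d)))) ≤ M
      rest≤M = ≤-trans (m≤n+m _ 2) M₀≤M
      4Sᵈ≤M : 4 * S ^ d ≤ M
      4Sᵈ≤M = ≤-trans (m≤m+n _ _) rest≤M
      rest₂≤M : 4 * sq (2 + d) + (suc d + suc S * (4 * (2 * S) ^ (2 * d))) ≤ M
      rest₂≤M = ≤-trans (m≤n+m _ (4 * S ^ d)) rest≤M
      exponent≤M : 4 * sq (2 + d) ≤ M
      exponent≤M = ≤-trans (m≤m+n _ _) rest₂≤M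
      rest₃≤M : suc d + suc S * (4 * (2 * S) ^ (2 * d)) ≤ M
      rest₃≤M = ≤-trans (m≤n+m _ (4 * sq (2 + d))) rest₂≤M
      1+d≤M : suc d ≤ M
      1+d≤M = ≤-trans (m≤m+n _ _) rest₃≤M
      constant≤M : suc S * (4 * (2 * S) ^ (2 * d)) ≤ M
      constant≤M = ≤-trans (m≤n+m _ (suc d)) rest₃≤M

      instance
        M≢0 : NonZero M
        M≢0 = >-nonZero 1≤M

      X : ℕ
      X = (S * M) ^ d

      2<X : 2 < X
      2<X = begin
        3                       ≤⟨ s≤s (s≤s (s≤s z≤n)) ⟩
        2 ^ 3
          ≤⟨ ^-monoˡ-≤ 3 (≤-trans 2≤M (≤-trans (≤-reflexive (sym (*-identityˡ M))) (*-monoˡ-≤ M 1≤S))) ⟩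
        (S * M) ^ 3
          ≤⟨ ^-monoʳ-≤ (S * M) ⦃ >-nonZero (*-mono-≤ 1≤S 1≤M) ⦄ (≤-trans (m≤m+n 3 (3 * k)) (≤-reflexive (sym d≡))) ⟩
        X                       ∎
        where open ≤-Reasoning

      large-power : X * M * 4 ≤ 2 ^ M
      large-power = begin
        (S * M) ^ d * M * 4         ≡⟨ cong (λ x → x * M * 4) (^-distribʳ-* d S M) ⟩
        S ^ d * M ^ d * M * 4       ≡⟨ lemma (S ^ d) (M ^ d) M ⟩
        4 * S ^ d * (M * M ^ d)     ≤⟨ *-monoˡ-≤ (M * M ^ d) 4Sᵈ≤M ⟩
        M ^ (2 + d)                 ≤⟨ power-≤-2^ (2 + d) exponent≤M ⟩
        2 ^ M                       ∎
        where
        open ≤-Reasoning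
        lemma : ∀ s m n → s * m * n * 4 ≡ 4 * s * (n * m)
        lemma = solve-∀

      Rigid : List ℕ → Set
      Rigid Bs = ∀ {x₁ x₂ x₃ x₄ x₅} → x₁ ∈ Bs → x₂ ∈ Bs → x₃ ∈ Bs → x₄ ∈ Bs → x₅ ∈ Bs →
        combination a₁ a₂ a₃ a₄ x₁ x₂ x₃ x₄ ≡ S * x₅ → x₁ ≡ x₅

      assemble : ∀ {n p Bs} → needed M ≤ n → Prime p → X < p → p ≤ X * M → Unique Bs → (∀ {x} → x ∈ Bs → x < X) →
        M ^ d ≤ suc (d * sq M) * length Bs → Rigid Bs → ∃[ A ] (Admissible a₁ a₂ a₃ a₄ n A × M ^ (3 * k) ≤ length A)
      assemble {n} {p} {Bs} needed≤n pp X<p p≤ unique bounded size rigid =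
          map ET.point Bs
        , ET.points-admissible (≤-trans (*-monoʳ-≤ (suc S) (*-mono-≤ p≤ p≤)) needed≤n)
        , subst (M ^ (3 * k) ≤_) (sym (length-map ET.point Bs)) (*-cancelˡ-≤ (M ^ 3) ⦃ m^n≢0 M 3 ⦄ (begin
            M ^ 3 * M ^ (3 * k)           ≡⟨ ^-distribˡ-+-* M 3 (3 * k) ⟨
            M ^ (3 + 3 * k)               ≡⟨ cong (M ^_) d≡ ⟨
            M ^ d                         ≤⟨ size ⟩
            suc (d * sq M) * length Bs    ≤⟨ *-monoˡ-≤ (length Bs) norms ⟩
            M ^ 3 * length Bs             ∎))
        where
        open ≤-Reasoning
        module ET = ErdősTurán {a₁} {a₂} {a₃} {a₄} 1≤a₁ pp (<-trans 2<X X<p) unique (λ x∈ → <-trans (bounded x∈) X<p) rigid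
        cube : ∀ m → m * (m * m) ≡ m * (m * (m * 1))
        cube = solve-∀
        norms : suc (d * sq M) ≤ M ^ 3
        norms = begin
          1 + d * sq M           ≤⟨ +-monoˡ-≤ (d * sq M) (*-mono-≤ 1≤M 1≤M) ⟩
          suc d * sq M           ≤⟨ *-monoˡ-≤ (sq M) 1+d≤M ⟩
          M * sq M               ≡⟨ cube M ⟩
          M ^ 3                  ∎

      construct : ∀ {n} → needed M ≤ n → ∃[ A ] (Admissible a₁ a₂ a₃ a₄ n A × M ^ (3 * k) ≤ length A)
      construct needed≤n =
        let (p , pp , X<p , p≤) = prime-in-range (≤-trans (s≤s z≤n) 2<X) large-power 1≤M
            (Bs , unique , bounded , size , rigid) = Sphere.behrend {a₁} {a₂} {a₃} {a₄} 1≤a₁ M 1≤M d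
        in assemble needed≤n pp X<p p≤ unique bounded size rigid

      next-needed : needed (suc M) ≤ M ^ (3 + 2 * d)
      next-needed = begin
        suc S * sq ((S * suc M) ^ d * suc M)
          ≤⟨ *-monoʳ-≤ (suc S) (*-mono-≤ step step) ⟩
        suc S * sq ((2 * S) ^ d * M ^ d * (2 * M))
          ≡⟨ lemma₁ (suc S) ((2 * S) ^ d) (M ^ d) M ⟩
        suc S * (4 * ((2 * S) ^ d * (2 * S) ^ d)) * (M * (M * (M ^ d * M ^ d)))
          ≡⟨ cong₂ (λ u v → suc S * (4 * u) * (M * (M * v))) (double (2 * S)) (double M) ⟩
        suc S * (4 * (2 * S) ^ (2 * d)) * (M * (M * M ^ (2 * d)))
          ≤⟨ *-monoˡ-≤ (M * (M * M ^ (2 * d))) constant≤M ⟩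
        M ^ (3 + 2 * d)
          ∎
        where
        open ≤-Reasoning
        1+M≤2M : suc M ≤ 2 * M
        1+M≤2M = ≤-trans (+-monoˡ-≤ M 1≤M) (≤-reflexive (cong (λ s → M + s) (sym (+-identityʳ M))))
        lemma₀ : ∀ s m → s * (2 * m) ≡ 2 * s * m
        lemma₀ = solve-∀
        step : (S * suc M) ^ d * suc M ≤ (2 * S) ^ d * M ^ d * (2 * M)
        step = *-mono-≤ (begin
          (S * suc M) ^ d           ≤⟨ ^-monoˡ-≤ d (*-monoʳ-≤ S 1+M≤2M) ⟩
          (S * (2 * M)) ^ d         ≡⟨ cong (_^ d) (lemma₀ S M) ⟩
          (2 * S * M) ^ d           ≡⟨ ^-distribʳ-* d (2 * S) M ⟩
          (2 * S) ^ d * M ^ d       ∎) 1+M≤2M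
        lemma₁ : ∀ c u v m → c * (u * v * (2 * m) * (u * v * (2 * m))) ≡ c * (4 * (u * u)) * (m * (m * (v * v)))
        lemma₁ = solve-∀
        double : ∀ x → x ^ d * x ^ d ≡ x ^ (2 * d)
        double x = trans (sym (^-distribˡ-+-* x d d)) (cong (λ e → x ^ (d + e)) (sym (+-identityʳ d)))

      dense : ∀ {n l} → n ≤ M ^ (3 + 2 * d) → M ^ (3 * k) ≤ l → n ^ k ≤ l ^ (2 * (k + 2))
      dense {n} {l} n≤ l≥ = begin
        n ^ k                                      ≤⟨ ^-monoˡ-≤ k n≤ ⟩
        (M ^ (3 + 2 * d)) ^ k                      ≡⟨ ^-*-assoc M (3 + 2 * d) k ⟩
        M ^ ((3 + 2 * d) * k)
          ≤⟨ ^-monoʳ-≤ M (≤-trans (m≤m+n ((3 + 2 * d) * k) (3 * k)) (≤-reflexive (trans (cong (λ d → (3 + 2 * d) * k + 3 * k) d≡) (lemma k)))) ⟩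
        M ^ (3 * k * (2 * (k + 2)))                ≡⟨ ^-*-assoc M (3 * k) (2 * (k + 2)) ⟨
        (M ^ (3 * k)) ^ (2 * (k + 2))              ≤⟨ ^-monoˡ-≤ (2 * (k + 2)) l≥ ⟩
        l ^ (2 * (k + 2))                          ∎
        where
        open ≤-Reasoning
        lemma : ∀ k → (3 + 2 * (3 + 3 * k)) * k + 3 * k ≡ 3 * k * (2 * (k + 2))
        lemma = solve-∀

    M≤needed : ∀ M → M ≤ needed M
    M≤needed zero       = z≤n
    M≤needed M@(suc _) = begin
      M
        ≤⟨ m≤n*m M ((S * M) ^ d) ⦃ m^n≢0 (S * M) d ⦃ >-nonZero (*-mono-≤ 1≤S (s≤s z≤n)) ⦄ ⦄ ⟩
      y                                ≤⟨ m≤m*n y y ⦃ y≢0 ⦄ ⟩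
      sq y                             ≤⟨ m≤n*m (sq y) (suc S) ⟩
      needed M                         ∎
      where
      open ≤-Reasoning
      y = (S * M) ^ d * M
      y≢0 : NonZero y
      y≢0 = m*n≢0 ((S * M) ^ d) M ⦃ m^n≢0 (S * M) d ⦃ >-nonZero (*-mono-≤ 1≤S (s≤s z≤n)) ⦄ ⦄

  sidon-lower-bound : ∃[ N ] (∀ n → N ≤ n → ∃[ A ] (Admissible a₁ a₂ a₃ a₄ n A × n ^ k ≤ length A ^ (2 * (k + 2))))
  sidon-lower-bound = needed M₀ , build
    where
    build : ∀ n → needed M₀ ≤ n → ∃[ A ] (Admissible a₁ a₂ a₃ a₄ n A × n ^ k ≤ length A ^ (2 * (k + 2)))
    build n N≤n =
      let (m , _ , below , above) = crossing (λ m → needed (m + M₀)) (suc n) N≤n (≤-trans (m≤m+n (suc n) M₀) (M≤needed (suc n + M₀)))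
          (A , admissible , size) = Large.construct (m≤n+m M₀ m) below
      in A , admissible , Large.dense (m≤n+m M₀ m) (≤-trans (<⇒≤ above) (Large.next-needed (m≤n+m M₀ m))) size

theorem1p15 : (a₁ a₂ a₃ a₄ : ℕ) → 1 ≤ a₁ → 1 ≤ a₂ → 1 ≤ a₃ → 1 ≤ a₄ →
    ((k : ℕ) → ∃[ N ] ((n : ℕ) → N ≤ n → (A : List ℕ) →
    Admissible a₁ a₂ a₃ a₄ n A →
    (suc k * suc k) * (length A * length A) ≤ n))
    ×
    ((k : ℕ) → ∃[ N ] ((n : ℕ) → N ≤ n → ∃[ A ] (
    Admissible a₁ a₂ a₃ a₄ n A × n ^ k ≤ length A ^ (2 * (k + 2)))))
theorem1p15 a₁ a₂ a₃ a₄ 1≤a₁ 1≤a₂ 1≤a₃ 1≤a₄ =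
    sidon-little-o 1≤a₁ 1≤a₂ 1≤a₃ 1≤a₄
  , λ k → LowerBound.sidon-lower-bound {a₁} {a₂} {a₃} {a₄} 1≤a₁ k refl
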